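{- Let $q$ be a prime power and $n$ a positive integer such that every prime divisor of $n$ divides $q-1$, and suppose that $q\equiv 1\pmod 4$ if $8$ divides $n$. Let $f\in\mathbb F_q[x]$ be a monic irreducible polynomial of degree $k$ and order $e$ with $\gcd(ek,n)=1$. Let $r$ be a positive integer with $nr\equiv 1\pmod e$, let $\alpha\in\overline{\mathbb F}_q$ be a root of $f$, let $d=\gcd(n,q-1)$, let $\theta\in\mathbb F_q^*$ have multiplicative order $d$, and set $m=n/d$. For each positive divisor $t$ of $m$ let $g_t(x)=\prod_{i=0}^{k-1}(x-\alpha^{trq^{i}})$. Then the factorization of $f(x^n)$ into monic irreducible polynomials over $\mathbb F_q$ is $$f(x^{n})=\prod_{t\mid m}\ \prod_{\substack{1\le u\le d\\ \gcd(u,t)=1}}\theta^{ -uk}\, g_t(\theta^{u}x^{t}).$$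
   Context: $\overline{\mathbb F}_q$ denotes an algebraic closure of $\mathbb F_q$. For a polynomial $f\in\mathbb F_q[x]$ with $f(0)\neq 0$, the order of $f$ is the least positive integer $e$ such that $f(x)$ divides $x^e-1$. -}

module Defs where

open import Level using (0ℓ)
open import Algebra.Bundles using (CommutativeRing)
open import Algebra.Morphism.Structures using (module RingMorphisms)
import Data.Nat as ℕ
open ℕ using (ℕ; zero; suc; _<_; _≤_)
open import Data.Nat.Divisibility using (_∣?_)
open import Data.Nat.GCD using (gcd)
open import Data.Fin using (Fin)
open import Data.List using (List; []; _∷_; map; foldr; replicate; _++_; filter; upTo; concatMap)
open import Data.Product using (Σ; ∃; _×_; _,_)
open import Data.Sum using (_⊎_)
open import Relation.Nullary using (¬_)
open import Relation.Binary.PropositionalEquality using (_≡_)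

record Field : Set₁ where
  field
    commutativeRing : CommutativeRing 0ℓ 0ℓ
  open CommutativeRing commutativeRing public
  infix 8 _⁻¹
  field
    _⁻¹      : Carrier → Carrier
    0≉1      : ¬ (0# ≈ 1#)
    inverseˡ : ∀ x → ¬ (x ≈ 0#) → (x ⁻¹) * x ≈ 1#

HasCardinality : Field → ℕ → Set
HasCardinality K q =
  Σ (Fin q → Carrier) λ g →
    (∀ i j → g i ≈ g j → i ≡ j) × (∀ x → ∃ λ i → g i ≈ x)
  where open Field K

-- Field extension K → L: a (unital) ring homomorphism (automatically injective).
IsFieldHom : (K L : Field) → (Field.Carrier K → Field.Carrier L) → Set
IsFieldHom K L ι = RingMorphisms.IsRingHomomorphism (Field.rawRing K) (Field.rawRing L) ι

IsPrimePower : ℕ → Set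
IsPrimePower q = ∃ λ p → ∃ λ j → Data.Nat.Primality.Prime p × q ≡ p ℕ.^ suc j
  where import Data.Nat.Primality

divisors : ℕ → List ℕ
divisors m = filter (_∣? m) (map suc (upTo m))

coprimeRange : ℕ → ℕ → List ℕ
coprimeRange d t = filter (λ u → gcd u t ℕ.≟ 1) (map suc (upTo d))

-- Univariate polynomials over a commutative ring, as coefficient lists
-- (constant term first); equality is coefficientwise, missing = 0.

module Poly (R : CommutativeRing 0ℓ 0ℓ) where
  open CommutativeRing R

  Pol : Set
  Pol = List Carrier

  coeff : Pol → ℕ → Carrier
  coeff []      _       = 0#
  coeff (a ∷ p) zero    = a
  coeff (a ∷ p) (suc i) = coeff p i

  infix 4 _≈ₚ_
  _≈ₚ_ : Pol → Pol → Set
  p ≈ₚ q = ∀ i → coeff p i ≈ coeff q i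

  infixl 6 _+ₚ_
  _+ₚ_ : Pol → Pol → Pol
  []      +ₚ q       = q
  (a ∷ p) +ₚ []      = a ∷ p
  (a ∷ p) +ₚ (b ∷ q) = (a + b) ∷ (p +ₚ q)

  -ₚ_ : Pol → Pol
  -ₚ_ = map (λ a → - a)

  scale : Carrier → Pol → Pol
  scale c = map (c *_)

  infixl 7 _*ₚ_
  _*ₚ_ : Pol → Pol → Pol
  []      *ₚ q = []
  (a ∷ p) *ₚ q = scale a q +ₚ (0# ∷ (p *ₚ q))

  const : Carrier → Pol
  const a = a ∷ []

  0ₚ 1ₚ X : Pol
  0ₚ = []
  1ₚ = const 1#
  X  = 0# ∷ 1# ∷ []

  monomial : Carrier → ℕ → Pol
  monomial c t = replicate t 0# ++ (c ∷ [])

  linear : Carrier → Pol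
  linear c = (- c) ∷ 1# ∷ []

  compose : Pol → Pol → Pol
  compose p Y = foldr (λ a acc → const a +ₚ (Y *ₚ acc)) [] p

  eval : Pol → Carrier → Carrier
  eval p x = foldr (λ a acc → a + x * acc) 0# p

  prodₚ : List Pol → Pol
  prodₚ = foldr _*ₚ_ 1ₚ

  pow : Carrier → ℕ → Carrier
  pow x zero    = 1#
  pow x (suc n) = x * pow x n

  MonicOfDegree : Pol → ℕ → Set
  MonicOfDegree p k = (coeff p k ≈ 1#) × (∀ i → k < i → coeff p i ≈ 0#)

  Monic : Pol → Set
  Monic p = ∃ λ k → MonicOfDegree p k

  IsUnit : Pol → Set
  IsUnit p = ∃ λ h → p *ₚ h ≈ₚ 1ₚ

  Irreducible : Pol → Set
  Irreducible p =
    ¬ (p ≈ₚ 0ₚ) × ¬ IsUnit p × (∀ a b → p ≈ₚ a *ₚ b → IsUnit a ⊎ IsUnit b)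

  infix 4 _∣ₚ_
  _∣ₚ_ : Pol → Pol → Set
  p ∣ₚ q = ∃ λ h → q ≈ₚ p *ₚ h

  xpow-1 : ℕ → Pol
  xpow-1 e = monomial 1# e +ₚ (-ₚ 1ₚ)

  HasOrder : Pol → ℕ → Set
  HasOrder f e = (0 < e) × (f ∣ₚ xpow-1 e) × (∀ e′ → 0 < e′ → f ∣ₚ xpow-1 e′ → e ≤ e′)

module _ (L : Field) where
  open Field L
  open Poly commutativeRing

  gpoly : (α : Carrier) (q k r t : ℕ) → Pol
  gpoly α q k r t = prodₚ (map (λ i → linear (pow α (t ℕ.* r ℕ.* q ℕ.^ i))) (upTo k))

  -- θ^{-uk} g_t(θ^u x^t), with θ given as its image θL in L
  factor : (θL α : Carrier) (q k r t u : ℕ) → Pol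
  factor θL α q k r t u =
    scale (pow (θL ⁻¹) (u ℕ.* k)) (compose (gpoly α q k r t) (monomial (pow θL u) t))

  factorProduct : (θL α : Carrier) (q k r d m : ℕ) → Pol
  factorProduct θL α q k r d m =
    prodₚ (concatMap (λ t → map (factor θL α q k r t) (coprimeRange d t)) (divisors m))

module PolyF (K : Field) = Poly (Field.commutativeRing K)

{-# OPTIONS --safe #-}

-- Work in E = F_q[x]/(f) with α = x and β = α^r, so that β^n = α.  The Frobenius map is additive because
-- (X + z)^q - X^q - z^q has degree < q and vanishes on F_q, hence f is the product of the x - α^(q^i), and
-- ∏ (x - β^(t q^i)) is the minimal polynomial G of β^t over F_q.
--
-- Product formula: f(x^n) = ∏ (x^n - b^n) over the b = β^(q^i), and x^n - b^n splits into the binomials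
-- x^t - θ^(-u) b^t by repeated use of ∏_j (x^t - θ^(-v - j d/ℓ) b^t) = x^(ℓt) - θ^(-ℓv) b^(ℓt) for primes ℓ ∣ d.
--
-- Irreducibility of h = θ^(-uk) G(θ^u x^t), of degree kt: let γ be a root of an irreducible factor of h of degree
-- D, so γ^(q^j) = γ for some 1 ≤ j ≤ D.  A power of w = θ^u γ^t is a root of f, so k ∣ j.  As w^e = 1, the order of
-- γ^e is t times that of a power of θ, and as it divides q^j - 1 this gives t ∣ 1 + q + ... + q^(j-1), hence t ∣ j.
-- Since k and t are coprime, kt ≤ j ≤ D.
module Submission where

open import Defs
open import Algebra.Bundles using (CommutativeRing; RawRing)
open import Algebra.Morphism.Structures using (module RingMorphisms)
import Algebra.Properties.CommutativeMonoid.Sum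
open import Data.Empty using (⊥; ⊥-elim)
open import Data.Fin using (Fin; toℕ)
import Data.Fin as Fin
open import Data.Fin.Permutation using (Permutation; permutation; _⟨$⟩ʳ_)
import Data.Fin.Properties as Finₚ
open import Data.List using (List; []; _∷_; map; length; foldr; _++_; upTo; applyUpTo; tabulate; filter; concatMap)
open import Data.List.Membership.Propositional using (_∈_)
open import Data.List.Membership.Propositional.Properties using (∈-filter⁻)
open import Data.List.Properties using (length-tabulate; length-applyUpTo; map-applyUpTo; map-∘)
open import Data.List.Relation.Unary.All as All using (All; []; _∷_)
import Data.List.Relation.Unary.All.Properties as All
open import Data.List.Relation.Unary.AllPairs as AllPairs using (AllPairs; []; _∷_)
import Data.List.Relation.Unary.AllPairs.Properties as AllPairs
open import Data.Maybe using (Maybe; just; nothing)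
open import Data.Nat using (ℕ; zero; suc; _<_; _≤_; z≤n; s≤s)
import Data.Nat as ℕ
open import Data.Nat.Coprimality using (Coprime; coprime-Bézout; coprime-divisor; gcd≡1⇒coprime; coprime⇒gcd≡1)
open import Data.Nat.DivMod using (m≡m%n+[m/n]*n)
open import Data.Nat.Divisibility using (_∣_; _∣?_; _∣0; 1∣_; divides; ∣-refl; ∣-trans; ∣⇒≤;
  ∣1⇒≡1; 0∣⇒≡0; m∣m*n; n∣m*n; ∣m⇒∣m*n; ∣n⇒∣m*n; ∣m∣n⇒∣m+n; ∣m+n∣m⇒∣n;
  *-cancelʳ-∣; *-cancelˡ-∣; *-monoˡ-∣; *-monoʳ-∣)
open import Data.Nat.GCD using (gcd; gcd[m,n]∣m; gcd[m,n]∣n; gcd-greatest; c*gcd[m,n]≡gcd[cm,cn]; module Bézout)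
open Bézout.Identity using (+-; -+)
open import Data.Nat.Induction using (<-wellFounded)
open import Data.Nat.ListAction using (product)
open import Data.Nat.Primality using (Prime; euclidsLemma; prime⇒irreducible;
  prime⇒nonZero; prime⇒nonTrivial; ¬prime[1]; prime[2])
open import Data.Nat.Primality.Factorisation using (factorise)
import Data.Nat.Properties as ℕₚ
open import Data.Nat.Tactic.RingSolver using (solve-∀)
open import Data.Product using (∃; _×_; _,_; proj₁; proj₂)
open import Data.Sum using (_⊎_; inj₁; inj₂)
open import Function using (_∘_; id; case_of_)
open import Induction.WellFounded using (Acc; acc)
open import Level using (0ℓ)
open import Relation.Binary.Definitions using (tri<; tri≈; tri>)
open import Relation.Binary.PropositionalEquality using (_≡_)
import Relation.Binary.PropositionalEquality as ≡
import Relation.Binary.Reasoning.Setoid as ≈-Reasoning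
open import Relation.Nullary using (¬_; Dec; yes; no)
open import Relation.Nullary.Decidable using (_×-dec_)

-- No decision procedure for equality in `L` is given, so case distinctions on equality are made in
-- `K` and in residue fields K[x]/(p) with p irreducible, where division with remainder decides
-- equality. Factorisations found in E are carried to `L` by the homomorphism sending the class of x
-- to α; irreducibility is settled over `K` alone. That t ∣ 1 + q + ... + q^(j-1) gives t ∣ j is
-- lifting the exponent: each prime ℓ of t divides q - 1, and the sum then contains ℓ to the same
-- power as j. The exception is ℓ = 2 with q ≡ 3 mod 4, where already 1 + q is divisible by 4. It is
-- harmless unless 4 ∣ t; but then d is even, 8 divides m d = n, and the congruence modulo 4
-- applies. Passing from γ to γ^e removes w and leaves a relation between γ^e and θ alone. Nothing
-- is lost by it: e is prime to n, so at the primes of t the order of θ^(ue) is that of θ^u.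

CRing : Set₁
CRing = CommutativeRing 0ℓ 0ℓ

-- Solving ring identities

module IntegerSolver (R : CRing) where
  open CommutativeRing R hiding (zero)
  open import Algebra.Properties.Ring ring
  open import Algebra.Properties.Semiring.Mult.TCOptimised semiring using (×-homo-+; ×1-homo-*) renaming (_×_ to _·_)
  open import Algebra.Properties.CommutativeSemigroup +-commutativeSemigroup using (interchange)
  open import Algebra.Solver.Ring.AlmostCommutativeRing using (fromCommutativeRing; _-Raw-AlmostCommutative⟶_)
  open ≈-Reasoning setoid

  -- Coefficients are integers, as formal differences of naturals.
  private
    coefficients : RawRing 0ℓ 0ℓ
    coefficients = record
      { Carrier = ℕ × ℕ
      ; _≈_     = _≡_
      ; _+_     = λ (a , b) (c , d) → a ℕ.+ c , b ℕ.+ d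
      ; _*_     = λ (a , b) (c , d) → a ℕ.* c ℕ.+ b ℕ.* d , a ℕ.* d ℕ.+ b ℕ.* c
      ; -_      = λ (a , b) → b , a
      ; 0#      = 0 , 0
      ; 1#      = 1 , 0
      }

    difference : ℕ × ℕ → Carrier
    difference (a , b) = a · 1# - b · 1#

    -- Equal to difference, but computes to 0# and 1# on the constants.
    embed : ℕ × ℕ → Carrier
    embed (a , zero)      = a · 1#
    embed (a , b@(suc _)) = difference (a , b)

    embed≈ : ∀ p → embed p ≈ difference p
    embed≈ (a , zero)  = sym (trans (+-congˡ -0#≈0#) (+-identityʳ _))
    embed≈ (a , suc b) = refl

    difference-+ : ∀ x y z w → (x - y) + (z - w) ≈ (x + z) - (y + w)
    difference-+ x y z w = trans (interchange x (- y) z (- w)) (+-congˡ (-‿+-comm y w))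

    difference-* : ∀ x y z w → (x - y) * (z - w) ≈ (x * z + y * w) - (x * w + y * z)
    difference-* x y z w = begin
      (x - y) * (z - w)  ≈⟨ [y-z]x≈yx-zx (z - w) x y ⟩
      x * (z - w) - y * (z - w)  ≈⟨ +-cong (x[y-z]≈xy-xz x z w) (-‿cong (x[y-z]≈xy-xz y z w)) ⟩
      (x * z - x * w) - (y * z - y * w)  ≈⟨ +-congˡ (-‿+-comm _ _) ⟨
      (x * z - x * w) + (- (y * z) - - (y * w))  ≈⟨ +-congˡ (trans (+-congˡ (-‿involutive _)) (+-comm _ _)) ⟩
      (x * z - x * w) + (y * w - y * z)  ≈⟨ difference-+ _ _ _ _ ⟩
      (x * z + y * w) - (x * w + y * z)  ∎

    homomorphism : coefficients -Raw-AlmostCommutative⟶ fromCommutativeRing R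
    homomorphism = record
      { ⟦_⟧    = embed
      ; +-homo = λ p@(a , b) q@(c , d) → begin
          embed (a ℕ.+ c , b ℕ.+ d)  ≈⟨ embed≈ (a ℕ.+ c , b ℕ.+ d) ⟩
          (a ℕ.+ c) · 1# - (b ℕ.+ d) · 1#  ≈⟨ +-cong (×-homo-+ 1# a c) (-‿cong (×-homo-+ 1# b d)) ⟩
          (a · 1# + c · 1#) - (b · 1# + d · 1#)  ≈⟨ difference-+ _ _ _ _ ⟨
          difference p + difference q  ≈⟨ +-cong (embed≈ p) (embed≈ q) ⟨
          embed p + embed q  ∎
      ; *-homo = λ p@(a , b) q@(c , d) → begin
          embed (a ℕ.* c ℕ.+ b ℕ.* d , a ℕ.* d ℕ.+ b ℕ.* c)
            ≈⟨ embed≈ (a ℕ.* c ℕ.+ b ℕ.* d , a ℕ.* d ℕ.+ b ℕ.* c) ⟩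
          (a ℕ.* c ℕ.+ b ℕ.* d) · 1# - (a ℕ.* d ℕ.+ b ℕ.* c) · 1#
            ≈⟨ +-cong (product-sum a c b d) (-‿cong (product-sum a d b c)) ⟩
          ((a · 1#) * (c · 1#) + (b · 1#) * (d · 1#)) - ((a · 1#) * (d · 1#) + (b · 1#) * (c · 1#))
            ≈⟨ difference-* _ _ _ _ ⟨
          difference p * difference q  ≈⟨ *-cong (embed≈ p) (embed≈ q) ⟨
          embed p * embed q  ∎
      ; -‿homo = λ (a , b) → begin
          embed (b , a)  ≈⟨ embed≈ (b , a) ⟩
          b · 1# - a · 1#  ≈⟨ +-comm _ _ ⟩
          - (a · 1#) + b · 1#  ≈⟨ +-congˡ (-‿involutive _) ⟨
          - (a · 1#) - - (b · 1#)  ≈⟨ -‿+-comm _ _ ⟩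
          - (a · 1# - b · 1#)  ≈⟨ -‿cong (embed≈ (a , b)) ⟨
          - embed (a , b)  ∎
      ; 0-homo = refl
      ; 1-homo = refl
      }
      where
      product-sum : ∀ a c b d → (a ℕ.* c ℕ.+ b ℕ.* d) · 1# ≈ (a · 1#) * (c · 1#) + (b · 1#) * (d · 1#)
      product-sum a c b d = trans (×-homo-+ 1# (a ℕ.* c) (b ℕ.* d)) (+-cong (×1-homo-* a c) (×1-homo-* b d))

    difference-cong : ∀ a b c d → a ℕ.+ d ≡ c ℕ.+ b → difference (a , b) ≈ difference (c , d)
    difference-cong a b c d eq = begin
      a · 1# - b · 1#  ≈⟨ cancel-right (a · 1#) (b · 1#) (d · 1#) ⟨
      (a · 1# + d · 1#) - (b · 1# + d · 1#)  ≈⟨ +-cong sum-eq (-‿cong (+-comm _ _)) ⟩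
      (c · 1# + b · 1#) - (d · 1# + b · 1#)  ≈⟨ cancel-right (c · 1#) (d · 1#) (b · 1#) ⟩
      c · 1# - d · 1#  ∎
      where
      cancel-right : ∀ x y z → (x + z) - (y + z) ≈ x - y
      cancel-right x y z = begin
        (x + z) - (y + z)  ≈⟨ difference-+ x y z z ⟨
        (x - y) + (z - z)  ≈⟨ +-congˡ (-‿inverseʳ z) ⟩
        (x - y) + 0#  ≈⟨ +-identityʳ _ ⟩
        x - y  ∎
      sum-eq : a · 1# + d · 1# ≈ c · 1# + b · 1#
      sum-eq = begin
        a · 1# + d · 1#  ≈⟨ ×-homo-+ 1# a d ⟨
        (a ℕ.+ d) · 1#  ≡⟨ ≡.cong (_· 1#) eq ⟩
        (c ℕ.+ b) · 1#  ≈⟨ ×-homo-+ 1# c b ⟩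
        c · 1# + b · 1#  ∎

    -- Formal differences denote the same integer exactly when the cross sums agree. Distinct
    -- integers may still coincide in `R`, so failure of the test asserts nothing.
    equal? : ∀ p q → Maybe (embed p ≈ embed q)
    equal? p@(a , b) q@(c , d) with a ℕ.+ d ℕ.≟ c ℕ.+ b
    ... | yes eq = just (trans (embed≈ p) (trans (difference-cong a b c d eq) (sym (embed≈ q))))
    ... | no _   = nothing

  open import Algebra.Solver.Ring coefficients (fromCommutativeRing R) homomorphism equal? public
    using (solve; _:=_; _:+_; _:*_; :-_; con; Polynomial)

  infixl 7 _⊝_
  _⊝_ : ∀ {n} → Polynomial n → Polynomial n → Polynomial n
  x ⊝ y = x :+ :- y

  :0 :1 : ∀ {n} → Polynomial n
  :0 = con (0 , 0)
  :1 = con (1 , 0)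

-- Polynomial rings

IsHom : (R S : CRing) → (CommutativeRing.Carrier R → CommutativeRing.Carrier S) → Set
IsHom R S = RingMorphisms.IsRingHomomorphism (CommutativeRing.rawRing R) (CommutativeRing.rawRing S)

module _ (R S : CRing) (φ : CommutativeRing.Carrier R → CommutativeRing.Carrier S) where
  private
    module R = CommutativeRing R
    module S = CommutativeRing S
  open import Algebra.Properties.Ring S.ring using (x+x≈x⇒x≈0; +-inverseˡ-unique)

  -- Zero and negation come for free: additivity makes the image of zero its own double, and
  -- additive inverses are unique.
  isHom : (∀ {x y} → x R.≈ y → φ x S.≈ φ y) → (∀ x y → φ (x R.+ y) S.≈ φ x S.+ φ y) →
          (∀ x y → φ (x R.* y) S.≈ φ x S.* φ y) → φ R.1# S.≈ S.1# → IsHom R S φ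
  isHom cong +-homo *-homo 1-homo = record
    { isSemiringHomomorphism = record
      { isNearSemiringHomomorphism = record
        { +-isMonoidHomomorphism = record
          { isMagmaHomomorphism = record { isRelHomomorphism = record { cong = cong } ; homo = +-homo }
          ; ε-homo = 0-homo
          }
        ; *-homo = *-homo
        }
      ; 1#-homo = 1-homo
      }
    ; -‿homo = λ x → +-inverseˡ-unique (φ (R.- x)) (φ x)
        (S.trans (S.sym (+-homo (R.- x) x)) (S.trans (cong (R.-‿inverseˡ x)) 0-homo))
    }
    where
    0-homo : φ R.0# S.≈ S.0#
    0-homo = x+x≈x⇒x≈0 (φ R.0#) (S.trans (S.sym (+-homo R.0# R.0#)) (cong (R.+-identityˡ R.0#)))

module Hom (R S : CRing) (φ : CommutativeRing.Carrier R → CommutativeRing.Carrier S)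
           (φ-hom : IsHom R S φ) where
  open RingMorphisms.IsRingHomomorphism φ-hom public using (+-homo; *-homo; -‿homo; 0#-homo; 1#-homo) renaming (⟦⟧-cong to cong)
  private
    module R = CommutativeRing R
    module S = CommutativeRing S

  minus-homo : ∀ x y → φ (x R.- y) S.≈ φ x S.- φ y
  minus-homo x y = S.trans (+-homo x (R.- y)) (S.+-congˡ (-‿homo y))

  pow-homo : ∀ x n → φ (Poly.pow R x n) S.≈ Poly.pow S (φ x) n
  pow-homo x zero    = 1#-homo
  pow-homo x (suc n) = S.trans (*-homo x (Poly.pow R x n)) (S.*-congˡ (pow-homo x n))

module _ (R S T : CRing)
         (φ : CommutativeRing.Carrier R → CommutativeRing.Carrier S) (ψ : CommutativeRing.Carrier S → CommutativeRing.Carrier T)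
         (φ-hom : IsHom R S φ) (ψ-hom : IsHom S T ψ) where
  private
    module T = CommutativeRing T
    module φ = Hom R S φ φ-hom
    module ψ = Hom S T ψ ψ-hom

  ∘-isHom : IsHom R T (ψ ∘ φ)
  ∘-isHom = isHom R T (ψ ∘ φ) (λ eq → ψ.cong (φ.cong eq))
    (λ x y → T.trans (ψ.cong (φ.+-homo x y)) (ψ.+-homo (φ x) (φ y)))
    (λ x y → T.trans (ψ.cong (φ.*-homo x y)) (ψ.*-homo (φ x) (φ y)))
    (T.trans (ψ.cong φ.1#-homo) ψ.1#-homo)

module Powers (R : CRing) where
  open CommutativeRing R hiding (zero)
  open Poly R using (pow)
  open import Algebra.Properties.CommutativeSemigroup *-commutativeSemigroup using (interchange)

  pow-cong : ∀ {x y} n → x ≈ y → pow x n ≈ pow y n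
  pow-cong zero    eq = refl
  pow-cong (suc n) eq = *-cong eq (pow-cong n eq)

  pow-≡ : ∀ x {m n} → m ≡ n → pow x m ≈ pow x n
  pow-≡ x ≡.refl = refl

  pow-1# : ∀ n → pow 1# n ≈ 1#
  pow-1# zero    = refl
  pow-1# (suc n) = trans (*-identityˡ _) (pow-1# n)

  pow-1 : ∀ x → pow x 1 ≈ x
  pow-1 = *-identityʳ

  pow-+ : ∀ x m n → pow x (m ℕ.+ n) ≈ pow x m * pow x n
  pow-+ x zero    n = sym (*-identityˡ _)
  pow-+ x (suc m) n = trans (*-congˡ (pow-+ x m n)) (sym (*-assoc _ _ _))

  pow-distrib : ∀ x y n → pow (x * y) n ≈ pow x n * pow y n
  pow-distrib x y zero    = sym (*-identityˡ _)
  pow-distrib x y (suc n) = trans (*-congˡ (pow-distrib x y n)) (interchange _ _ _ _)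

  pow-* : ∀ x m n → pow x (m ℕ.* n) ≈ pow (pow x m) n
  pow-* x zero    n = sym (pow-1# n)
  pow-* x (suc m) n = trans (pow-+ x n (m ℕ.* n)) (trans (*-congˡ (pow-* x m n)) (sym (pow-distrib x (pow x m) n)))

  pow-comm : ∀ x m n → pow (pow x m) n ≈ pow (pow x n) m
  pow-comm x m n = trans (sym (pow-* x m n)) (trans (pow-≡ x (ℕₚ.*-comm m n)) (pow-* x n m))

  pow-trivial : ∀ x m n → pow x m ≈ 1# → pow x (m ℕ.* n) ≈ 1#
  pow-trivial x m n eq = trans (pow-* x m n) (trans (pow-cong n eq) (pow-1# n))

module PolyRing (R : CRing) where
  open CommutativeRing R hiding (zero)
  open Poly R
  open import Algebra.Properties.Ring ring using (-0#≈0#)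

  -- A record, so that p and q can be inferred from the type p ≋ q.
  infix 4 _≋_
  record _≋_ (p q : Pol) : Set where
    constructor coeffs
    field coeff-eq : p ≈ₚ q
  open _≋_ public

  ≋-refl : ∀ {p} → p ≋ p
  ≋-refl = coeffs (λ i → refl)

  ≋-sym : ∀ {p q} → p ≋ q → q ≋ p
  ≋-sym (coeffs eq) = coeffs (λ i → sym (eq i))

  ≋-trans : ∀ {p q r} → p ≋ q → q ≋ r → p ≋ r
  ≋-trans (coeffs eq) (coeffs eq′) = coeffs (λ i → trans (eq i) (eq′ i))

  ∷-cong : ∀ {a b p q} → a ≈ b → p ≋ q → a ∷ p ≋ b ∷ q
  ∷-cong a≈b (coeffs eq) = coeffs λ { zero → a≈b ; (suc i) → eq i }

  ∷-tail : ∀ {a b p q} → a ∷ p ≋ b ∷ q → p ≋ q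
  ∷-tail (coeffs eq) = coeffs (eq ∘ suc)

  []-tail : ∀ {a p} → a ∷ p ≋ [] → p ≋ []
  []-tail (coeffs eq) = coeffs (eq ∘ suc)

  0∷[] : ∀ {a p} → a ≈ 0# → p ≋ [] → a ∷ p ≋ []
  0∷[] a≈0 (coeffs eq) = coeffs λ { zero → a≈0 ; (suc i) → eq i }

  coeff-+ : ∀ p q i → coeff (p +ₚ q) i ≈ coeff p i + coeff q i
  coeff-+ []      q       i       = sym (+-identityˡ _)
  coeff-+ (a ∷ p) []      i       = sym (+-identityʳ _)
  coeff-+ (a ∷ p) (b ∷ q) zero    = refl
  coeff-+ (a ∷ p) (b ∷ q) (suc i) = coeff-+ p q i

  coeff-scale : ∀ c p i → coeff (scale c p) i ≈ c * coeff p i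
  coeff-scale c []      i       = sym (zeroʳ c)
  coeff-scale c (a ∷ p) zero    = refl
  coeff-scale c (a ∷ p) (suc i) = coeff-scale c p i

  coeff-neg : ∀ p i → coeff (-ₚ p) i ≈ - coeff p i
  coeff-neg []      i       = sym -0#≈0#
  coeff-neg (a ∷ p) zero    = refl
  coeff-neg (a ∷ p) (suc i) = coeff-neg p i

  coeff-minus : ∀ p q i → coeff (p +ₚ (-ₚ q)) i ≈ coeff p i - coeff q i
  coeff-minus p q i = trans (coeff-+ p (-ₚ q) i) (+-congˡ (coeff-neg q i))

  +ₚ-cong : ∀ {p p′ q q′} → p ≋ p′ → q ≋ q′ → p +ₚ q ≋ p′ +ₚ q′
  +ₚ-cong {p} {p′} {q} {q′} (coeffs e) (coeffs e′) =
    coeffs λ i → trans (coeff-+ p q i) (trans (+-cong (e i) (e′ i)) (sym (coeff-+ p′ q′ i)))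

  scale-cong : ∀ {c d p q} → c ≈ d → p ≋ q → scale c p ≋ scale d q
  scale-cong {c} {d} {p} {q} c≈d (coeffs e) =
    coeffs λ i → trans (coeff-scale c p i) (trans (*-cong c≈d (e i)) (sym (coeff-scale d q i)))

  scale-+ : ∀ c p q → scale c (p +ₚ q) ≋ scale c p +ₚ scale c q
  scale-+ c p q = coeffs λ i → begin
    coeff (scale c (p +ₚ q)) i  ≈⟨ coeff-scale c (p +ₚ q) i ⟩
    c * coeff (p +ₚ q) i  ≈⟨ *-congˡ (coeff-+ p q i) ⟩
    c * (coeff p i + coeff q i)  ≈⟨ distribˡ _ _ _ ⟩
    c * coeff p i + c * coeff q i  ≈⟨ +-cong (coeff-scale c p i) (coeff-scale c q i) ⟨
    coeff (scale c p) i + coeff (scale c q) i  ≈⟨ coeff-+ (scale c p) (scale c q) i ⟨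
    coeff (scale c p +ₚ scale c q) i  ∎
    where open ≈-Reasoning setoid

  scale-scale : ∀ c d p → scale c (scale d p) ≋ scale (c * d) p
  scale-scale c d p = coeffs λ i →
    trans (coeff-scale c (scale d p) i) (trans (*-congˡ (coeff-scale d p i))
      (trans (sym (*-assoc _ _ _)) (sym (coeff-scale (c * d) p i))))

  scale-0# : ∀ p → scale 0# p ≋ []
  scale-0# p = coeffs λ i → trans (coeff-scale 0# p i) (zeroˡ _)

  scale-1# : ∀ p → scale 1# p ≋ p
  scale-1# p = coeffs λ i → trans (coeff-scale 1# p i) (*-identityˡ _)

  private
    +ₚ-assoc : ∀ p q r → (p +ₚ q) +ₚ r ≋ p +ₚ (q +ₚ r)
    +ₚ-assoc p q r = coeffs λ i → begin
      coeff ((p +ₚ q) +ₚ r) i  ≈⟨ coeff-+ (p +ₚ q) r i ⟩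
      coeff (p +ₚ q) i + coeff r i  ≈⟨ +-congʳ (coeff-+ p q i) ⟩
      (coeff p i + coeff q i) + coeff r i  ≈⟨ +-assoc _ _ _ ⟩
      coeff p i + (coeff q i + coeff r i)  ≈⟨ +-congˡ (coeff-+ q r i) ⟨
      coeff p i + coeff (q +ₚ r) i  ≈⟨ coeff-+ p (q +ₚ r) i ⟨
      coeff (p +ₚ (q +ₚ r)) i  ∎
      where open ≈-Reasoning setoid

    +ₚ-comm : ∀ p q → p +ₚ q ≋ q +ₚ p
    +ₚ-comm p q = coeffs λ i → trans (coeff-+ p q i) (trans (+-comm _ _) (sym (coeff-+ q p i)))

    +ₚ-identityʳ : ∀ p → p +ₚ [] ≋ p
    +ₚ-identityʳ p = coeffs λ i → trans (coeff-+ p [] i) (+-identityʳ _)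

    -ₚ-cong : ∀ {p q} → p ≋ q → -ₚ p ≋ -ₚ q
    -ₚ-cong {p} {q} (coeffs e) = coeffs λ i → trans (coeff-neg p i) (trans (-‿cong (e i)) (sym (coeff-neg q i)))

    -ₚ-inverseʳ : ∀ p → p +ₚ (-ₚ p) ≋ []
    -ₚ-inverseʳ p = coeffs λ i → trans (coeff-minus p p i) (-‿inverseʳ _)

    +ₚ-interchange : ∀ p q r s → (p +ₚ q) +ₚ (r +ₚ s) ≋ (p +ₚ r) +ₚ (q +ₚ s)
    +ₚ-interchange p q r s = coeffs λ i → begin
      coeff ((p +ₚ q) +ₚ (r +ₚ s)) i  ≈⟨ split p q r s i ⟩
      (coeff p i + coeff q i) + (coeff r i + coeff s i)  ≈⟨ interchange _ _ _ _ ⟩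
      (coeff p i + coeff r i) + (coeff q i + coeff s i)  ≈⟨ split p r q s i ⟨
      coeff ((p +ₚ r) +ₚ (q +ₚ s)) i  ∎
      where
      open ≈-Reasoning setoid
      open import Algebra.Properties.CommutativeSemigroup +-commutativeSemigroup using (interchange)
      split : ∀ p q r s i → coeff ((p +ₚ q) +ₚ (r +ₚ s)) i ≈ (coeff p i + coeff q i) + (coeff r i + coeff s i)
      split p q r s i = trans (coeff-+ (p +ₚ q) (r +ₚ s) i) (+-cong (coeff-+ p q i) (coeff-+ r s i))

    +ₚ-leftComm : ∀ p q r → p +ₚ (q +ₚ r) ≋ q +ₚ (p +ₚ r)
    +ₚ-leftComm p q r =
      ≋-trans (≋-sym (+ₚ-assoc p q r)) (≋-trans (+ₚ-cong (+ₚ-comm p q) ≋-refl) (+ₚ-assoc q p r))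

    shift : Pol → Pol
    shift p = 0# ∷ p

    shift-+ : ∀ p q → shift (p +ₚ q) ≋ shift p +ₚ shift q
    shift-+ p q = ∷-cong (sym (+-identityˡ _)) ≋-refl

    scale-shift : ∀ c p → scale c (shift p) ≋ shift (scale c p)
    scale-shift c p = ∷-cong (zeroʳ c) ≋-refl

    *ₚ-congˡ : ∀ p {q q′} → q ≋ q′ → p *ₚ q ≋ p *ₚ q′
    *ₚ-congˡ []      eq = ≋-refl
    *ₚ-congˡ (a ∷ p) eq = +ₚ-cong (scale-cong refl eq) (∷-cong refl (*ₚ-congˡ p eq))

    *ₚ-zeroʳ : ∀ p → p *ₚ [] ≋ []
    *ₚ-zeroʳ []      = ≋-refl
    *ₚ-zeroʳ (a ∷ p) = 0∷[] refl (*ₚ-zeroʳ p)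

    *ₚ-distribˡ : ∀ p q r → p *ₚ (q +ₚ r) ≋ p *ₚ q +ₚ p *ₚ r
    *ₚ-distribˡ []      q r = ≋-refl
    *ₚ-distribˡ (a ∷ p) q r =
      ≋-trans (+ₚ-cong (scale-+ a q r) (≋-trans (∷-cong refl (*ₚ-distribˡ p q r)) (shift-+ (p *ₚ q) (p *ₚ r))))
              (+ₚ-interchange (scale a q) (scale a r) (shift (p *ₚ q)) (shift (p *ₚ r)))

    -- The mirror image of the defining equation of `_*ₚ_`; with it commutativity is a plain
    -- induction on the left factor.
    *ₚ-∷ : ∀ p b q → p *ₚ (b ∷ q) ≋ scale b p +ₚ shift (p *ₚ q)
    *ₚ-∷ []      b q = ≋-sym (0∷[] refl ≋-refl)
    *ₚ-∷ (a ∷ p) b q = ∷-cong (+-congʳ (*-comm a b))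
      (≋-trans (+ₚ-cong (≋-refl {scale a q}) (*ₚ-∷ p b q)) (+ₚ-leftComm (scale a q) (scale b p) (shift (p *ₚ q))))

    *ₚ-comm : ∀ p q → p *ₚ q ≋ q *ₚ p
    *ₚ-comm []      q = ≋-sym (*ₚ-zeroʳ q)
    *ₚ-comm (a ∷ p) q = ≋-trans (+ₚ-cong (≋-refl {scale a q}) (∷-cong refl (*ₚ-comm p q))) (≋-sym (*ₚ-∷ q a p))

    *ₚ-congʳ : ∀ {p p′} q → p ≋ p′ → p *ₚ q ≋ p′ *ₚ q
    *ₚ-congʳ {p} {p′} q eq = ≋-trans (*ₚ-comm p q) (≋-trans (*ₚ-congˡ q eq) (*ₚ-comm q p′))

    *ₚ-distribʳ : ∀ r p q → (p +ₚ q) *ₚ r ≋ p *ₚ r +ₚ q *ₚ r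
    *ₚ-distribʳ r p q =
      ≋-trans (*ₚ-comm (p +ₚ q) r) (≋-trans (*ₚ-distribˡ r p q) (+ₚ-cong (*ₚ-comm r p) (*ₚ-comm r q)))

  scale-* : ∀ c p q → scale c p *ₚ q ≋ scale c (p *ₚ q)
  scale-* c []      q = ≋-refl
  scale-* c (a ∷ p) q = ≋-trans
    (+ₚ-cong (≋-sym (scale-scale c a q)) (≋-trans (∷-cong refl (scale-* c p q)) (≋-sym (scale-shift c (p *ₚ q)))))
    (≋-sym (scale-+ c (scale a q) (shift (p *ₚ q))))

  shift-* : ∀ p q → (0# ∷ p) *ₚ q ≋ 0# ∷ (p *ₚ q)
  shift-* p q = +ₚ-cong (scale-0# q) ≋-refl

  private
    *ₚ-assoc : ∀ p q r → (p *ₚ q) *ₚ r ≋ p *ₚ (q *ₚ r)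
    *ₚ-assoc []      q r = ≋-refl
    *ₚ-assoc (a ∷ p) q r = ≋-trans (*ₚ-distribʳ r (scale a q) (shift (p *ₚ q)))
      (+ₚ-cong (scale-* a q r) (≋-trans (shift-* (p *ₚ q) r) (∷-cong refl (*ₚ-assoc p q r))))

  const-* : ∀ c p → const c *ₚ p ≋ scale c p
  const-* c p = ≋-trans (+ₚ-cong (≋-refl {scale c p}) (0∷[] refl ≋-refl)) (+ₚ-identityʳ (scale c p))

  private
    *ₚ-identityˡ : ∀ p → 1ₚ *ₚ p ≋ p
    *ₚ-identityˡ p = ≋-trans (const-* 1# p) (scale-1# p)

  polyRing : CRing
  polyRing = record
    { Carrier = Pol ; _≈_ = _≋_ ; _+_ = _+ₚ_ ; _*_ = _*ₚ_ ; -_ = -ₚ_ ; 0# = 0ₚ ; 1# = 1ₚ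
    ; isCommutativeRing = record
      { isRing = record
        { +-isAbelianGroup = record
          { isGroup = record
            { isMonoid = record
              { isSemigroup = record
                { isMagma = record
                  { isEquivalence = record { refl = ≋-refl ; sym = ≋-sym ; trans = ≋-trans }
                  ; ∙-cong = +ₚ-cong
                  }
                ; assoc = +ₚ-assoc
                }
              ; identity = (λ p → ≋-refl) , +ₚ-identityʳ
              }
            ; inverse = (λ p → ≋-trans (+ₚ-comm (-ₚ p) p) (-ₚ-inverseʳ p)) , -ₚ-inverseʳ
            ; ⁻¹-cong = -ₚ-cong
            }
          ; comm = +ₚ-comm
          }
        ; *-cong = λ {p} {p′} {q} {q′} e e′ → ≋-trans (*ₚ-congʳ q e) (*ₚ-congˡ p′ e′)
        ; *-assoc = *ₚ-assoc
        ; *-identity = *ₚ-identityˡ , λ p → ≋-trans (*ₚ-comm p 1ₚ) (*ₚ-identityˡ p)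
        ; distrib = *ₚ-distribˡ , *ₚ-distribʳ
        }
      ; *-comm = *ₚ-comm
      }
    }

  X*-shift : ∀ p → X *ₚ p ≋ 0# ∷ p
  X*-shift p = ≋-trans (shift-* 1ₚ p) (∷-cong refl (*ₚ-identityˡ p))

  ∷-decompose : ∀ a p → const a +ₚ X *ₚ p ≋ a ∷ p
  ∷-decompose a p = ≋-trans (+ₚ-cong (≋-refl {const a}) (X*-shift p)) (∷-cong (+-identityʳ a) ≋-refl)

  const-isHom : IsHom R polyRing const
  const-isHom = isHom R polyRing const (λ eq → ∷-cong eq ≋-refl) (λ x y → ≋-refl)
    (λ x y → ≋-sym (const-* x (const y))) ≋-refl

  monomial≋ : ∀ c t → monomial c t ≋ const c *ₚ Poly.pow polyRing X t
  monomial≋ c zero    = ≋-trans (∷-cong (sym (*-identityʳ c)) ≋-refl) (≋-sym (const-* c 1ₚ))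
  monomial≋ c (suc t) = ≋-trans (∷-cong refl (monomial≋ c t)) (≋-trans (≋-sym (X*-shift _)) (leftComm X (const c) (P.pow X t)))
    where
    module P = Poly polyRing
    open import Algebra.Properties.CommutativeSemigroup (CommutativeRing.*-commutativeSemigroup polyRing)
      using () renaming (x∙yz≈y∙xz to leftComm)

-- Evaluation, change of coefficients and substitution as ring homomorphisms

module Eval (R : CRing) where
  open CommutativeRing R hiding (zero)
  open Poly R
  open PolyRing R
  open ≈-Reasoning setoid
  open import Algebra.Properties.CommutativeSemigroup +-commutativeSemigroup using (interchange)
  open import Algebra.Properties.CommutativeSemigroup *-commutativeSemigroup using (x∙yz≈y∙xz)

  module _ (x : Carrier) where
    eval-[] : ∀ {p} → p ≋ [] → eval p x ≈ 0#
    eval-[] {[]}    eq = refl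
    eval-[] {a ∷ p} eq =
      trans (+-cong (coeff-eq eq zero) (trans (*-congˡ (eval-[] ([]-tail eq))) (zeroʳ x))) (+-identityˡ 0#)

    eval-cong : ∀ {p q} → p ≋ q → eval p x ≈ eval q x
    eval-cong {[]}    {q}     eq = sym (eval-[] (≋-sym eq))
    eval-cong {a ∷ p} {[]}    eq = eval-[] eq
    eval-cong {a ∷ p} {b ∷ q} eq = +-cong (coeff-eq eq zero) (*-congˡ (eval-cong (∷-tail eq)))

    eval-+ : ∀ p q → eval (p +ₚ q) x ≈ eval p x + eval q x
    eval-+ []      q       = sym (+-identityˡ _)
    eval-+ (a ∷ p) []      = sym (+-identityʳ _)
    eval-+ (a ∷ p) (b ∷ q) =
      trans (+-congˡ (trans (*-congˡ (eval-+ p q)) (distribˡ _ _ _))) (interchange _ _ _ _)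

    eval-scale : ∀ c p → eval (scale c p) x ≈ c * eval p x
    eval-scale c []      = sym (zeroʳ c)
    eval-scale c (a ∷ p) =
      trans (+-congˡ (trans (*-congˡ (eval-scale c p)) (x∙yz≈y∙xz _ _ _))) (sym (distribˡ _ _ _))

    eval-* : ∀ p q → eval (p *ₚ q) x ≈ eval p x * eval q x
    eval-* []      q = sym (zeroˡ _)
    eval-* (a ∷ p) q = begin
      eval (scale a q +ₚ (0# ∷ p *ₚ q)) x  ≈⟨ eval-+ (scale a q) (0# ∷ p *ₚ q) ⟩
      eval (scale a q) x + (0# + x * eval (p *ₚ q) x)  ≈⟨ +-cong (eval-scale a q) (+-identityˡ _) ⟩
      a * eval q x + x * eval (p *ₚ q) x  ≈⟨ +-congˡ (*-congˡ (eval-* p q)) ⟩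
      a * eval q x + x * (eval p x * eval q x)  ≈⟨ +-congˡ (*-assoc _ _ _) ⟨
      a * eval q x + (x * eval p x) * eval q x  ≈⟨ distribʳ _ _ _ ⟨
      (a + x * eval p x) * eval q x  ∎

    eval-const : ∀ a → eval (const a) x ≈ a
    eval-const a = trans (+-congˡ (zeroʳ x)) (+-identityʳ a)

    eval-isHom : IsHom polyRing R (λ p → eval p x)
    eval-isHom = isHom polyRing R (λ p → eval p x) eval-cong eval-+ eval-* (eval-const 1#)

    eval-X : eval X x ≈ x
    eval-X = trans (+-identityˡ _) (trans (*-congˡ (eval-const 1#)) (*-identityʳ x))

    eval-linear : ∀ c → eval (linear c) x ≈ x - c
    eval-linear c = trans (+-congˡ (trans (*-congˡ (eval-const 1#)) (*-identityʳ x))) (+-comm _ _)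

    eval-monomial : ∀ c t → eval (monomial c t) x ≈ c * pow x t
    eval-monomial c zero    = trans (eval-const c) (sym (*-identityʳ c))
    eval-monomial c (suc t) = trans (+-identityˡ _) (trans (*-congˡ (eval-monomial c t)) (x∙yz≈y∙xz _ _ _))

  eval-congʳ : ∀ p {x y} → x ≈ y → eval p x ≈ eval p y
  eval-congʳ []      eq = refl
  eval-congʳ (a ∷ p) eq = +-congˡ (*-cong eq (eval-congʳ p eq))

module MapPoly (R S : CRing) (φ : CommutativeRing.Carrier R → CommutativeRing.Carrier S)
               (φ-hom : IsHom R S φ) where
  private
    module R = CommutativeRing R
    module PR = Poly R
    module RX = PolyRing R
    module PS = Poly S
    module φ = Hom R S φ φ-hom
  open CommutativeRing S hiding (zero)
  open PolyRing S

  coeff-map : ∀ p i → PS.coeff (map φ p) i ≈ φ (PR.coeff p i)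
  coeff-map []      i       = sym φ.0#-homo
  coeff-map (a ∷ p) zero    = refl
  coeff-map (a ∷ p) (suc i) = coeff-map p i

  map-cong : ∀ {p q} → p RX.≋ q → map φ p ≋ map φ q
  map-cong {p} {q} eq = coeffs λ i → trans (coeff-map p i) (trans (φ.cong (RX.coeff-eq eq i)) (sym (coeff-map q i)))

  map-+ : ∀ p q → map φ (p PR.+ₚ q) ≋ map φ p PS.+ₚ map φ q
  map-+ []      q       = ≋-refl
  map-+ (a ∷ p) []      = ≋-refl
  map-+ (a ∷ p) (b ∷ q) = ∷-cong (φ.+-homo a b) (map-+ p q)

  map-scale : ∀ c p → map φ (PR.scale c p) ≋ PS.scale (φ c) (map φ p)
  map-scale c []      = ≋-refl
  map-scale c (a ∷ p) = ∷-cong (φ.*-homo c a) (map-scale c p)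

  map-* : ∀ p q → map φ (p PR.*ₚ q) ≋ map φ p PS.*ₚ map φ q
  map-* []      q = ≋-refl
  map-* (a ∷ p) q = ≋-trans (map-+ (PR.scale a q) (R.0# ∷ p PR.*ₚ q))
    (+ₚ-cong (map-scale a q) (∷-cong φ.0#-homo (map-* p q)))

  map-isHom : IsHom RX.polyRing polyRing (map φ)
  map-isHom = isHom RX.polyRing polyRing (map φ) map-cong map-+ map-* (∷-cong φ.1#-homo ≋-refl)

  eval-map : ∀ p x → φ (PR.eval p x) ≈ PS.eval (map φ p) (φ x)
  eval-map []      x = φ.0#-homo
  eval-map (a ∷ p) x = trans (φ.+-homo a _) (+-congˡ (trans (φ.*-homo x _) (*-congˡ (eval-map p x))))

  map-monomial : ∀ c t → map φ (PR.monomial c t) ≋ PS.monomial (φ c) t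
  map-monomial c zero    = ≋-refl
  map-monomial c (suc t) = ∷-cong φ.0#-homo (map-monomial c t)

  map-linear : ∀ c → map φ (PR.linear c) ≋ PS.linear (φ c)
  map-linear c = ∷-cong (φ.-‿homo c) (∷-cong φ.1#-homo ≋-refl)

  map-compose : ∀ p Y → map φ (PR.compose p Y) ≋ PS.compose (map φ p) (map φ Y)
  map-compose []      Y = ≋-refl
  map-compose (a ∷ p) Y = ≋-trans (map-+ (PR.const a) (Y PR.*ₚ PR.compose p Y))
    (+ₚ-cong ≋-refl (≋-trans (map-* Y (PR.compose p Y)) (P.*-cong (≋-refl {map φ Y}) (map-compose p Y))))
    where module P = CommutativeRing polyRing

  map-injective : (∀ {x y} → φ x ≈ φ y → x R.≈ y) → ∀ {p q} → map φ p ≋ map φ q → p RX.≋ q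
  map-injective inj {p} {q} (coeffs eq) =
    RX.coeffs λ i → inj (trans (sym (coeff-map p i)) (trans (eq i) (coeff-map q i)))

module Compose (R : CRing) where
  open CommutativeRing R hiding (zero)
  open Poly R
  open PolyRing R
  private
    module P = CommutativeRing polyRing
    module PP = Poly polyRing
    module E = Eval polyRing

  -- Substitution is evaluation over the polynomial ring itself, so every law of `compose` is an
  -- instance of a law of `eval`.
  compose≡eval : ∀ p Y → compose p Y ≡ PP.eval (map const p) Y
  compose≡eval []      Y = ≡.refl
  compose≡eval (a ∷ p) Y = ≡.cong (λ z → const a +ₚ (Y *ₚ z)) (compose≡eval p Y)

  module _ (Y : Pol) where
    private
      module C = MapPoly R polyRing const const-isHom

    compose-isHom : IsHom polyRing polyRing (λ p → compose p Y)
    compose-isHom = isHom polyRing polyRing (λ p → compose p Y)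
      (λ {p} {q} eq → via p q (E.eval-cong Y (C.map-cong eq)))
      (λ p q → P.trans (P.reflexive (compose≡eval (p +ₚ q) Y)) (P.trans
        (E.eval-cong Y (C.map-+ p q)) (P.trans (E.eval-+ Y (map const p) (map const q))
          (P.sym (P.+-cong (P.reflexive (compose≡eval p Y)) (P.reflexive (compose≡eval q Y)))))))
      (λ p q → P.trans (P.reflexive (compose≡eval (p *ₚ q) Y)) (P.trans
        (E.eval-cong Y (C.map-* p q)) (P.trans (E.eval-* Y (map const p) (map const q))
          (P.sym (P.*-cong (P.reflexive (compose≡eval p Y)) (P.reflexive (compose≡eval q Y)))))))
      (compose-const 1#)
      where
      via : ∀ p q → PP.eval (map const p) Y ≋ PP.eval (map const q) Y → compose p Y ≋ compose q Y
      via p q eq = P.trans (P.reflexive (compose≡eval p Y)) (P.trans eq (P.sym (P.reflexive (compose≡eval q Y))))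
      compose-const : ∀ a → compose (const a) Y ≋ const a
      compose-const a = E.eval-const Y (const a)

    compose-linear : ∀ c → compose (linear c) Y ≋ Y +ₚ (-ₚ const c)
    compose-linear c = E.eval-linear Y (const c)

  compose-congʳ : ∀ p {Y Z} → Y ≋ Z → compose p Y ≋ compose p Z
  compose-congʳ p {Y} {Z} eq = P.trans (P.reflexive (compose≡eval p Y))
    (P.trans (E.eval-congʳ (map const p) eq) (P.sym (P.reflexive (compose≡eval p Z))))

  compose-X : ∀ p → compose p X ≋ p
  compose-X []      = ≋-refl
  compose-X (a ∷ p) = P.trans (P.+-cong (≋-refl {const a}) (P.*-cong (≋-refl {X}) (compose-X p))) (∷-decompose a p)

  eval-compose : ∀ p Y x → eval (compose p Y) x ≈ eval p (eval Y x)
  eval-compose []      Y x = refl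
  eval-compose (a ∷ p) Y x = trans (Eval.eval-+ R x (const a) (Y *ₚ compose p Y))
    (+-cong (Eval.eval-const R x a) (trans (Eval.eval-* R x Y (compose p Y)) (*-congˡ (eval-compose p Y x))))

module EvalHom (R S : CRing) (φ : CommutativeRing.Carrier R → CommutativeRing.Carrier S)
               (φ-hom : IsHom R S φ) where
  private
    module R = CommutativeRing R
    module PR = Poly R
    module RX = PolyRing R
    module φ = Hom R S φ φ-hom
    module M = MapPoly R S φ φ-hom
  open CommutativeRing S hiding (zero)
  open Poly S
  open PolyRing S
  open Eval S
  open import Algebra.Properties.Group +-group using (x∙y⁻¹≈ε⇒x≈y; x≈y⇒x∙y⁻¹≈ε)

  evalAt : Carrier → PR.Pol → Carrier
  evalAt y p = eval (map φ p) y

  evalAt-isHom : ∀ y → IsHom RX.polyRing S (evalAt y)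
  evalAt-isHom y = ∘-isHom RX.polyRing polyRing S (map φ) (λ p → eval p y) M.map-isHom (eval-isHom y)

  evalAt-monomial : ∀ y c t → evalAt y (PR.monomial c t) ≈ φ c * pow y t
  evalAt-monomial y c t = trans (eval-cong y (M.map-monomial c t)) (eval-monomial y (φ c) t)

  evalAt-1-monomial : ∀ y t → evalAt y (PR.monomial R.1# t) ≈ pow y t
  evalAt-1-monomial y t = trans (evalAt-monomial y R.1# t) (trans (*-congʳ φ.1#-homo) (*-identityˡ _))

  evalAt-compose : ∀ y p Y → evalAt y (PR.compose p Y) ≈ evalAt (evalAt y Y) p
  evalAt-compose y p Y = trans (eval-cong y (M.map-compose p Y)) (Compose.eval-compose S (map φ p) (map φ Y) y)

  evalAt-multiple : ∀ {y g p} → evalAt y g ≈ 0# → (∃ λ h → p RX.≋ g PR.*ₚ h) → evalAt y p ≈ 0#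
  evalAt-multiple {y} {g} g-root (h , eq) = trans (ev.cong eq) (trans (ev.*-homo g h) (trans (*-congʳ g-root) (zeroˡ _)))
    where module ev = Hom RX.polyRing S (evalAt y) (evalAt-isHom y)

  private
    evalAt-xpow-1 : ∀ y e → evalAt y (PR.xpow-1 e) ≈ pow y e - 1#
    evalAt-xpow-1 y e = trans (ev.minus-homo (PR.monomial R.1# e) PR.1ₚ) (+-cong (evalAt-1-monomial y e) (-‿cong ev.1#-homo))
      where module ev = Hom RX.polyRing S (evalAt y) (evalAt-isHom y)

  root⇒pow≈1 : ∀ {y} e → evalAt y (PR.xpow-1 e) ≈ 0# → pow y e ≈ 1#
  root⇒pow≈1 {y} e root = x∙y⁻¹≈ε⇒x≈y _ _ (trans (sym (evalAt-xpow-1 y e)) root)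

  pow≈1⇒root : ∀ {y} e → pow y e ≈ 1# → evalAt y (PR.xpow-1 e) ≈ 0#
  pow≈1⇒root {y} e eq = trans (evalAt-xpow-1 y e) (x≈y⇒x∙y⁻¹≈ε eq)

-- Degrees, division and roots

module _ (R : CRing) where
  open CommutativeRing R hiding (zero)
  open IntegerSolver R

  -- One step of long division by `a`, read in the polynomial ring with `x` the variable: `c` is the
  -- coefficient brought down and `t` the new digit of the quotient.
  division-step : ∀ c x a q s t → c + x * (a * q + s) ≈ a * (t + x * q) + ((c + x * s) - t * a)
  division-step = solve 6 (λ c x a q s t → c :+ x :* (a :* q :+ s) := a :* (t :+ x :* q) :+ ((c :+ x :* s) ⊝ t :* a)) refl

  -- One step of Horner's scheme: `s` is the quotient by x - c and `v` the value at c found so far.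
  synthetic-step : ∀ a x c s v → a + x * ((x - c) * s + v) ≈ (x - c) * (v + x * s) + (a + c * v)
  synthetic-step = solve 5 (λ a x c s v → a :+ x :* ((x ⊝ c) :* s :+ v) := (x ⊝ c) :* (v :+ x :* s) :+ (a :+ c :* v)) refl

module Degree (R : CRing) where
  open CommutativeRing R hiding (zero)
  open Poly R
  open PolyRing R
  private
    module P = CommutativeRing polyRing
  open ≈-Reasoning setoid

  Deg< : Pol → ℕ → Set
  Deg< p N = ∀ i → N ≤ i → coeff p i ≈ 0#

  deg<-length : ∀ p → Deg< p (length p)
  deg<-length []      i       _         = refl
  deg<-length (a ∷ p) (suc i) (s≤s len) = deg<-length p i len

  deg<-cong : ∀ {p q N} → p ≋ q → Deg< p N → Deg< q N
  deg<-cong eq deg i N≤i = trans (sym (coeff-eq eq i)) (deg i N≤i)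

  deg<-mono : ∀ {p M N} → M ≤ N → Deg< p M → Deg< p N
  deg<-mono M≤N deg i N≤i = deg i (ℕₚ.≤-trans M≤N N≤i)

  deg<-minus : ∀ {p q N} → Deg< p N → Deg< q N → Deg< (p +ₚ (-ₚ q)) N
  deg<-minus {p} {q} degp degq i N≤i =
    trans (coeff-minus p q i) (trans (+-cong (degp i N≤i) (-‿cong (degq i N≤i))) (-‿inverseʳ 0#))

  deg<-0 : ∀ {p} → Deg< p 0 → p ≋ []
  deg<-0 deg = coeffs λ i → deg i z≤n

  -- Bounds instead of exact degrees: enlarging the bound on `q` makes the right side vanish, which
  -- is how `deg<-*` treats all higher coefficients.
  coeff-*-top : ∀ p q k l → Deg< p (suc k) → Deg< q (suc l) → coeff (p *ₚ q) (k ℕ.+ l) ≈ coeff p k * coeff q l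
  coeff-*-top []      q k       l _    _    = sym (zeroˡ _)
  coeff-*-top (a ∷ p) q zero    l degp degq = begin
    coeff (scale a q +ₚ (0# ∷ p *ₚ q)) l  ≈⟨ coeff-eq (P.+-cong (≋-refl {scale a q})
        (0∷[] refl (P.*-cong {p} {[]} {q} {q} (deg<-0 {p} (λ i _ → degp (suc i) (s≤s z≤n))) (≋-refl {q})))) l ⟩
    coeff (scale a q +ₚ []) l  ≈⟨ coeff-eq (P.+-identityʳ (scale a q)) l ⟩
    coeff (scale a q) l  ≈⟨ coeff-scale a q l ⟩
    a * coeff q l  ∎
  coeff-*-top (a ∷ p) q (suc k) l degp degq = begin
    coeff (scale a q +ₚ (0# ∷ p *ₚ q)) (suc (k ℕ.+ l))  ≈⟨ coeff-+ (scale a q) (0# ∷ p *ₚ q) (suc (k ℕ.+ l)) ⟩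
    coeff (scale a q) (suc (k ℕ.+ l)) + coeff (p *ₚ q) (k ℕ.+ l)
      ≈⟨ +-cong (trans (coeff-scale a q _) (trans (*-congˡ (degq _ (s≤s (ℕₚ.m≤n+m l k)))) (zeroʳ a)))
                (coeff-*-top p q k l (λ i k<i → degp (suc i) (s≤s k<i)) degq) ⟩
    0# + coeff p k * coeff q l  ≈⟨ +-identityˡ _ ⟩
    coeff p k * coeff q l  ∎

  deg<-* : ∀ p q k l → Deg< p (suc k) → Deg< q (suc l) → Deg< (p *ₚ q) (suc (k ℕ.+ l))
  deg<-* p q k l degp degq i k+l<i = begin
    coeff (p *ₚ q) i  ≡⟨ ≡.cong (coeff (p *ₚ q)) (ℕₚ.m+[n∸m]≡n k≤i) ⟨
    coeff (p *ₚ q) (k ℕ.+ (i ℕ.∸ k))  ≈⟨ coeff-*-top p q k (i ℕ.∸ k) degp (deg<-mono {q} (ℕₚ.m≤n⇒m≤1+n l<i∸k) degq) ⟩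
    coeff p k * coeff q (i ℕ.∸ k)  ≈⟨ *-congˡ (degq _ l<i∸k) ⟩
    coeff p k * 0#  ≈⟨ zeroʳ _ ⟩
    0#  ∎
    where
    k≤i : k ≤ i
    k≤i = ℕₚ.≤-trans (ℕₚ.m≤m+n k l) (ℕₚ.<⇒≤ k+l<i)
    l<i∸k : l < i ℕ.∸ k
    l<i∸k = ≡.subst (_≤ i ℕ.∸ k) (ℕₚ.m+n∸m≡n k (suc l))
      (ℕₚ.∸-monoˡ-≤ k (≡.subst (_≤ i) (≡.sym (ℕₚ.+-suc k l)) k+l<i))

  monic-cong : ∀ {p q k} → p ≋ q → MonicOfDegree p k → MonicOfDegree q k
  monic-cong {p} {q} {k} eq (lead , deg) = trans (sym (coeff-eq eq k)) lead , deg<-cong {p} {q} eq deg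

  monic-* : ∀ {p q k l} → MonicOfDegree p k → MonicOfDegree q l → MonicOfDegree (p *ₚ q) (k ℕ.+ l)
  monic-* {p} {q} {k} {l} (leadp , degp) (leadq , degq) =
    trans (coeff-*-top p q k l degp degq) (trans (*-cong leadp leadq) (*-identityˡ 1#)) , deg<-* p q k l degp degq

  monic-1 : MonicOfDegree 1ₚ 0
  monic-1 = refl , λ { (suc i) _ → refl }

  monic-linear : ∀ c → MonicOfDegree (linear c) 1
  monic-linear c = refl , λ { (suc zero) (s≤s ()) ; (suc (suc i)) _ → refl }

  monic-monomial : ∀ t → MonicOfDegree (monomial 1# t) t
  monic-monomial zero = refl , λ { (suc i) _ → refl }
  monic-monomial (suc t) with monic-monomial t
  ... | lead , deg = lead , λ { (suc i) (s≤s t<i) → deg i t<i }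

  monic-minus-lower : ∀ {p q k} → MonicOfDegree p k → Deg< q k → MonicOfDegree (p +ₚ (-ₚ q)) k
  monic-minus-lower {p} {q} {k} (lead , deg) degq =
    trans (coeff-minus p q k) (trans (+-cong lead (trans (-‿cong (degq k ℕₚ.≤-refl)) -0#≈0#)) (+-identityʳ 1#)) ,
    deg<-minus {p} {q} deg (deg<-mono {q} (ℕₚ.n≤1+n k) degq)
    where open import Algebra.Properties.Ring ring using (-0#≈0#)

  monic-prod : ∀ {A : Set} (F : A → Pol) k → (∀ a → MonicOfDegree (F a) k) →
               ∀ as → MonicOfDegree (prodₚ (map F as)) (length as ℕ.* k)
  monic-prod F k monic []       = monic-1
  monic-prod F k monic (a ∷ as) = monic-* {F a} (monic a) (monic-prod F k monic as)

  monic-linears : ∀ as → MonicOfDegree (prodₚ (map linear as)) (length as)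
  monic-linears as = ≡.subst (MonicOfDegree (prodₚ (map linear as))) (ℕₚ.*-identityʳ (length as))
    (monic-prod linear 1 monic-linear as)

  monic-difference : ∀ {p q k} → MonicOfDegree p k → MonicOfDegree q k → Deg< (p +ₚ (-ₚ q)) k
  monic-difference {p} {q} {k} (leadp , degp) (leadq , degq) i k≤i with ℕₚ.m≤n⇒m<n∨m≡n k≤i
  ... | inj₁ k<i    = deg<-minus {p} {q} degp degq i k<i
  ... | inj₂ ≡.refl = trans (coeff-minus p q k) (trans (+-cong leadp (-‿cong leadq)) (-‿inverseʳ 1#))

  -- The top coefficient of `T` reappears unchanged in `a *ₚ T`, at an index no less than D, hence
  -- it is zero. Descending along a bound for the length of `T` removes all coefficients without
  -- testing any of them.
  monic-multiple-small : ∀ {a D} → MonicOfDegree a D → ∀ T → Deg< (a *ₚ T) D → T ≋ []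
  monic-multiple-small {a} {D} monic T deg = descend (length T) (deg<-length T)
    where
    descend : ∀ N → Deg< T N → T ≋ []
    descend zero    degT = deg<-0 degT
    descend (suc N) degT = descend N lower
      where
      top≈0 : coeff T N ≈ 0#
      top≈0 = begin
        coeff T N  ≈⟨ *-identityˡ _ ⟨
        1# * coeff T N  ≈⟨ *-congʳ (proj₁ monic) ⟨
        coeff a D * coeff T N  ≈⟨ coeff-*-top a T D N (proj₂ monic) degT ⟨
        coeff (a *ₚ T) (D ℕ.+ N)  ≈⟨ deg _ (ℕₚ.m≤m+n D N) ⟩
        0#  ∎
      lower : Deg< T N
      lower i N≤i with ℕₚ.m≤n⇒m<n∨m≡n N≤i
      ... | inj₁ N<i    = degT i N<i
      ... | inj₂ ≡.refl = top≈0

  record DivMod (a : Pol) (D : ℕ) (p : Pol) : Set where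
    constructor divMod-result
    field
      quotient remainder : Pol
      division           : p ≋ a *ₚ quotient +ₚ remainder
      remainder-small    : Deg< remainder D

  divMod : ∀ {a D} → MonicOfDegree a D → ∀ p → DivMod a D p
  divMod {a} {D} monic []      = divMod-result [] [] (P.sym (P.trans (P.+-identityʳ _) (P.zeroʳ a))) (λ i _ → refl)
  divMod {a} {D} monic (c ∷ p) with divMod {a} monic p
  ... | divMod-result Q S p≋ degS = divMod-result (top ∷ Q) ((c ∷ S) +ₚ (-ₚ scale top a)) eq small
    where
    -- The remainder `S` of the tail has degree below D, so `c ∷ S` has degree at most D and
    -- subtracting one multiple of `a` suffices.
    top : Carrier
    top = coeff (c ∷ S) D
    monic-part : ∀ i → suc D ≤ i → coeff (c ∷ S) i ≈ 0#
    monic-part (suc i) (s≤s D≤i) = degS i D≤i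
    small : Deg< ((c ∷ S) +ₚ (-ₚ scale top a)) D
    small i D≤i with ℕₚ.m≤n⇒m<n∨m≡n D≤i
    ... | inj₁ D<i = deg<-minus {c ∷ S} {scale top a} monic-part
                       (λ j D<j → trans (coeff-scale top a j) (trans (*-congˡ (proj₂ monic j D<j)) (zeroʳ top))) i D<i
    ... | inj₂ ≡.refl = begin
      coeff ((c ∷ S) +ₚ (-ₚ scale top a)) D  ≈⟨ coeff-minus (c ∷ S) (scale top a) D ⟩
      top - coeff (scale top a) D  ≈⟨ +-congˡ (-‿cong (trans (coeff-scale top a D)
          (trans (*-congˡ (proj₁ monic)) (*-identityʳ top)))) ⟩
      top - top  ≈⟨ -‿inverseʳ top ⟩
      0#  ∎
    eq : c ∷ p ≋ a *ₚ (top ∷ Q) +ₚ ((c ∷ S) +ₚ (-ₚ scale top a))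
    eq = P.trans (P.sym (∷-decompose c p)) (P.trans (P.+-cong (≋-refl {const c}) (P.*-cong (≋-refl {X}) p≋))
      (P.trans (division-step polyRing (const c) X a Q S (const top))
        (P.+-cong (P.*-cong (≋-refl {a}) (∷-decompose top Q))
          (P.+-cong (∷-decompose c S) (P.-‿cong (const-* top a))))))

  -- Horner's scheme: the quotient of a polynomial by x - c has as coefficients the values at c of
  -- its successive tails.
  synthetic : Carrier → Pol → Pol
  synthetic c []      = []
  synthetic c (a ∷ p) = eval p c ∷ synthetic c p

  synthetic-division : ∀ c p → p ≋ linear c *ₚ synthetic c p +ₚ const (eval p c)
  synthetic-division c []      = P.sym (P.trans (P.+-cong (P.zeroʳ (linear c)) (0∷[] refl ≋-refl)) (P.+-identityˡ _))
  synthetic-division c (a ∷ p) = P.trans (P.sym (∷-decompose a p)) (P.trans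
    (P.+-cong (≋-refl {const a}) (P.*-cong (≋-refl {X}) (synthetic-division c p))) (P.trans
      (P.trans lhs (synthetic-step polyRing (const a) X (const c) (synthetic c p) (const (eval p c))))
      (P.+-cong (P.*-cong linear≋ (∷-decompose (eval p c) (synthetic c p))) const-value)))
    where
    linear≋ : X +ₚ (-ₚ const c) ≋ linear c
    linear≋ = ∷-cong (+-identityˡ _) ≋-refl
    const-value : const a +ₚ const c *ₚ const (eval p c) ≋ const (a + c * eval p c)
    const-value = P.+-cong (≋-refl {const a}) (const-* c (const (eval p c)))
    lhs : const a +ₚ X *ₚ (linear c *ₚ synthetic c p +ₚ const (eval p c)) ≋
          const a +ₚ X *ₚ ((X +ₚ (-ₚ const c)) *ₚ synthetic c p +ₚ const (eval p c))
    lhs = P.+-cong (≋-refl {const a}) (P.*-cong (≋-refl {X})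
      (P.+-cong (P.*-cong (P.sym linear≋) (≋-refl {synthetic c p})) (≋-refl {const (eval p c)})))

  synthetic-deg : ∀ c p N → Deg< p (suc N) → Deg< (synthetic c p) N
  synthetic-deg c []      N       deg i       _         = refl
  synthetic-deg c (a ∷ p) zero    deg zero    _         = Eval.eval-[] R c (deg<-0 {p} (λ i _ → deg (suc i) (s≤s z≤n)))
  synthetic-deg c (a ∷ p) zero    deg (suc i) _         = synthetic-deg c p zero (λ j _ → deg (suc j) (s≤s z≤n)) i z≤n
  synthetic-deg c (a ∷ p) (suc N) deg (suc i) (s≤s N≤i) = synthetic-deg c p N (λ j le → deg (suc j) (s≤s le)) i N≤i

  -- Root counting only cancels differences of roots, so it works over any commutative ring once
  -- these are regular. In a ring that receives a field, images of nonzero elements are units and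
  -- hence regular.
  Regular : Carrier → Set
  Regular z = ∀ w → z * w ≈ 0# → w ≈ 0#

  Separated : List Carrier → Set
  Separated = AllPairs (λ a b → Regular (b - a))

  module _ where
    open Eval R

    -- Divide off x - a: by regularity of b - a each later b remains a root of the quotient, whose
    -- degree bound is one lower.
    too-many-roots : ∀ as → Separated as → ∀ p → All (λ a → eval p a ≈ 0#) as → Deg< p (length as) → p ≋ []
    too-many-roots []       []         p []             deg = deg<-0 deg
    too-many-roots (a ∷ as) (sa ∷ sep) p (root ∷ roots) deg =
      P.trans factored (P.trans (P.*-cong (≋-refl {linear a}) quotient≋[]) (P.zeroʳ (linear a)))
      where
      Q : Pol
      Q = synthetic a p
      factored : p ≋ linear a *ₚ Q
      factored = P.trans (synthetic-division a p) (P.trans (P.+-cong (≋-refl {linear a *ₚ Q}) (0∷[] root ≋-refl))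
          (P.+-identityʳ _))
      quotient-root : ∀ {b} → Regular (b - a) × eval p b ≈ 0# → eval Q b ≈ 0#
      quotient-root {b} (regular , root) = regular (eval Q b) (begin
        (b - a) * eval Q b  ≈⟨ *-congʳ (eval-linear b a) ⟨
        eval (linear a) b * eval Q b  ≈⟨ eval-* b (linear a) Q ⟨
        eval (linear a *ₚ Q) b  ≈⟨ eval-cong b factored ⟨
        eval p b  ≈⟨ root ⟩
        0#  ∎)
      quotient≋[] : Q ≋ []
      quotient≋[] = too-many-roots as sep Q (All.map quotient-root (All.zip (sa , roots)))
        (synthetic-deg a p (length as) deg)

    eval-linears-zero : ∀ as → All (λ a → eval (prodₚ (map linear as)) a ≈ 0#) as
    eval-linears-zero []       = []
    eval-linears-zero (a ∷ as) =
      trans (eval-* a (linear a) (prodₚ (map linear as)))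
        (trans (*-congʳ (trans (eval-linear a a) (-‿inverseʳ a))) (zeroˡ _))
      ∷ All.map (λ {b} root → trans (eval-* b (linear a) (prodₚ (map linear as))) (trans (*-congˡ root) (zeroʳ _)))
          (eval-linears-zero as)

    -- The difference of the two monic polynomials has lower degree and vanishes at every listed
    -- element.
    monic≋linears : ∀ as → Separated as → ∀ p → MonicOfDegree p (length as) → All (λ a → eval p a ≈ 0#) as →
                    p ≋ prodₚ (map linear as)
    monic≋linears as sep p monic roots = x∙y⁻¹≈ε⇒x≈y p Π (too-many-roots as sep (p +ₚ (-ₚ Π))
      (All.map (λ {a} (r , s) → trans (Hom.minus-homo polyRing R (λ p → eval p a) (eval-isHom a) p Π)
                                  (trans (+-cong r (-‿cong s)) (-‿inverseʳ 0#)))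
               (All.zip (roots , eval-linears-zero as)))
      (monic-difference {p} {Π} monic (monic-linears as)))
      where
      Π = prodₚ (map linear as)
      open import Algebra.Properties.Group P.+-group using (x∙y⁻¹≈ε⇒x≈y)

-- Finite fields and the Frobenius map

module _ (R : CRing) where
  open CommutativeRing R hiding (zero)
  open IntegerSolver R
  open import Algebra.Properties.Group +-group using (x∙y⁻¹≈ε⇒x≈y)

  minus-plus : ∀ x y → x ≈ y + (x - y)
  minus-plus = solve 2 (λ x y → x := y :+ (x ⊝ y)) refl

  translate-both : ∀ x y z → (x + y) - (z + y) ≈ x - z
  translate-both = solve 3 (λ x y z → (x :+ y) ⊝ (z :+ y) := x ⊝ z) refl

  cancel-all : ∀ x y → (x + y - x) - y ≈ 0#
  cancel-all = solve 2 (λ x y → (x :+ y ⊝ x) ⊝ y := :0) refl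

  three-term : ∀ x y z → (x - y) - z ≈ 0# → x ≈ y + z
  three-term x y z eq = x∙y⁻¹≈ε⇒x≈y x (y + z) (trans (solve 3 (λ x y z → x ⊝ (y :+ z) := (x ⊝ y) ⊝ z) refl x y z) eq)

module ListProduct (R : CRing) where
  open CommutativeRing R hiding (zero)
  open import Algebra.Properties.CommutativeSemigroup *-commutativeSemigroup using (interchange)

  ∏ : List Carrier → Carrier
  ∏ = foldr _*_ 1#

  ∏-cong : ∀ {A : Set} {F G : A → Carrier} as → (∀ a → F a ≈ G a) → ∏ (map F as) ≈ ∏ (map G as)
  ∏-cong []       eq = refl
  ∏-cong (a ∷ as) eq = *-cong (eq a) (∏-cong as eq)

  ∏-distrib : ∀ {A : Set} (F G : A → Carrier) as → ∏ (map (λ a → F a * G a) as) ≈ ∏ (map F as) * ∏ (map G as)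
  ∏-distrib F G []       = sym (*-identityˡ 1#)
  ∏-distrib F G (a ∷ as) = trans (*-congˡ (∏-distrib F G as)) (interchange _ _ _ _)

  ∏-++ : ∀ as bs → ∏ (as ++ bs) ≈ ∏ as * ∏ bs
  ∏-++ []       bs = sym (*-identityˡ _)
  ∏-++ (a ∷ as) bs = trans (*-congˡ (∏-++ as bs)) (sym (*-assoc a (∏ as) (∏ bs)))

module _ (R S : CRing) (φ : CommutativeRing.Carrier R → CommutativeRing.Carrier S)
         (φ-hom : IsHom R S φ) where
  private
    module S = CommutativeRing S
    module φ = Hom R S φ φ-hom
    module PR = ListProduct R
    module PS = ListProduct S

  ∏-homo : ∀ {A : Set} (F : A → CommutativeRing.Carrier R) as → φ (PR.∏ (map F as)) S.≈ PS.∏ (map (φ ∘ F) as)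
  ∏-homo F []       = φ.1#-homo
  ∏-homo F (a ∷ as) = S.trans (φ.*-homo _ _) (S.*-congˡ (∏-homo F as))

module FieldProperties (K : Field) where
  open Field K hiding (zero)
  open Poly commutativeRing
  open Degree commutativeRing using (Regular; Separated)
  open import Algebra.Properties.Group +-group public using (x∙y⁻¹≈ε⇒x≈y; x≈y⇒x∙y⁻¹≈ε)
  open ≈-Reasoning setoid

  unit⇒regular : ∀ {x y} → y * x ≈ 1# → Regular x
  unit⇒regular {x} {y} yx≈1 w xw≈0 = begin
    w  ≈⟨ *-identityˡ w ⟨
    1# * w  ≈⟨ *-congʳ yx≈1 ⟨
    y * x * w  ≈⟨ *-assoc y x w ⟩
    y * (x * w)  ≈⟨ *-congˡ xw≈0 ⟩
    y * 0#  ≈⟨ zeroʳ y ⟩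
    0#  ∎

  nonzero-regular : ∀ {x} → ¬ x ≈ 0# → Regular x
  nonzero-regular {x} x≉0 = unit⇒regular (inverseˡ x x≉0)

  difference-regular : ∀ {x y} → ¬ x ≈ y → Regular (x - y)
  difference-regular x≉y = nonzero-regular (λ x-y≈0 → x≉y (x∙y⁻¹≈ε⇒x≈y _ _ x-y≈0))

  unit⇒nonzero : ∀ {x y} → y * x ≈ 1# → ¬ x ≈ 0#
  unit⇒nonzero yx≈1 x≈0 = 0≉1 (trans (sym (zeroʳ _)) (trans (*-congˡ (sym x≈0)) yx≈1))

  nonzero-* : ∀ {x y} → ¬ x ≈ 0# → ¬ y ≈ 0# → ¬ x * y ≈ 0#
  nonzero-* x≉0 y≉0 xy≈0 = y≉0 (nonzero-regular x≉0 _ xy≈0)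

  nonzero-pow : ∀ {x} n → ¬ x ≈ 0# → ¬ pow x n ≈ 0#
  nonzero-pow zero    x≉0 = λ 1≈0 → 0≉1 (sym 1≈0)
  nonzero-pow (suc n) x≉0 = nonzero-* x≉0 (nonzero-pow n x≉0)

  pow≈1⇒nonzero : ∀ {x n} → 0 < n → pow x n ≈ 1# → ¬ x ≈ 0#
  pow≈1⇒nonzero {x} {suc n} _ eq = unit⇒nonzero {y = pow x n} (trans (*-comm _ _) eq)

  *-cancelˡ : ∀ {x y z} → ¬ x ≈ 0# → x * y ≈ x * z → y ≈ z
  *-cancelˡ {x} {y} {z} x≉0 eq = x∙y⁻¹≈ε⇒x≈y y z (nonzero-regular x≉0 (y - z)
    (trans (x[y-z]≈xy-xz x y z) (x≈y⇒x∙y⁻¹≈ε eq)))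
    where open import Algebra.Properties.Ring ring using (x[y-z]≈xy-xz)

  inverse-unique : ∀ {x y} → y * x ≈ 1# → y ≈ x ⁻¹
  inverse-unique {x} {y} yx≈1 = *-cancelˡ x≉0 (trans (*-comm x y) (trans yx≈1 (sym (trans (*-comm x (x ⁻¹)) (inverseˡ x x≉0)))))
    where x≉0 = unit⇒nonzero yx≈1

module _ (K : Field) (S : CRing) (ι : Field.Carrier K → CommutativeRing.Carrier S)
         (ι-hom : IsHom (Field.commutativeRing K) S ι) where
  private
    module K = Field K
    module S = CommutativeRing S
    module ι = Hom K.commutativeRing S ι ι-hom
    module FK = FieldProperties K
    module DS = Degree S

  image-nonzero-regular : ∀ {x} → ¬ x K.≈ K.0# → DS.Regular (ι x)
  image-nonzero-regular {x} x≉0 w ιxw≈0 = begin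
    w  ≈⟨ S.*-identityˡ w ⟨
    S.1# S.* w  ≈⟨ S.*-congʳ (S.trans (S.sym (ι.*-homo _ _)) (S.trans (ι.cong (K.inverseˡ x x≉0)) ι.1#-homo)) ⟨
    ι (x K.⁻¹) S.* ι x S.* w  ≈⟨ S.*-assoc _ _ _ ⟩
    ι (x K.⁻¹) S.* (ι x S.* w) ≈⟨ S.*-congˡ ιxw≈0 ⟩
    ι (x K.⁻¹) S.* S.0#  ≈⟨ S.zeroʳ _ ⟩
    S.0#  ∎
    where open ≈-Reasoning S.setoid

  image-difference-regular : ∀ {x y} → ¬ x K.≈ y → DS.Regular (ι x S.- ι y)
  image-difference-regular {x} {y} x≉y w eq = image-nonzero-regular
    (λ x-y≈0 → x≉y (FK.x∙y⁻¹≈ε⇒x≈y x y x-y≈0)) w (S.trans (S.*-congʳ (ι.minus-homo x y)) eq)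

module _ (K L : Field) (_≟_ : ∀ x y → Dec (Field._≈_ K x y)) (ι : Field.Carrier K → Field.Carrier L) (ι-hom : IsFieldHom K L ι) where
  private
    module K = Field K
    module L = Field L
    module ι = Hom K.commutativeRing L.commutativeRing ι ι-hom
    module FL = FieldProperties L

  -- A nonzero x - y has a unit as image, which cannot be zero in `L`. Only the source needs
  -- decidable equality.
  field-hom-injective : ∀ {x y} → ι x L.≈ ι y → x K.≈ y
  field-hom-injective {x} {y} eq with x ≟ y
  ... | yes x≈y = x≈y
  ... | no x≉y  = ⊥-elim (L.0≉1 (L.sym (image-difference-regular K L.commutativeRing ι ι-hom x≉y L.1#
                    (L.trans (L.*-identityʳ _) (FL.x≈y⇒x∙y⁻¹≈ε eq)))))

  field-hom-nonzero : ∀ {x} → ¬ x K.≈ K.0# → ¬ ι x L.≈ L.0#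
  field-hom-nonzero x≉0 ιx≈0 = x≉0 (field-hom-injective (L.trans ιx≈0 (L.sym ι.0#-homo)))

module FiniteField (K : Field) (q : ℕ) (card : HasCardinality K q) where
  open Field K hiding (zero)
  open Poly commutativeRing
  open PolyRing commutativeRing
  open Degree commutativeRing
  open FieldProperties K
  open ListProduct commutativeRing
  open ≈-Reasoning setoid

  element : Fin q → Carrier
  element = proj₁ card

  private
    element-injective : ∀ i j → element i ≈ element j → i ≡ j
    element-injective = proj₁ (proj₂ card)

  index : Carrier → Fin q
  index x = proj₁ (proj₂ (proj₂ card) x)

  element-index : ∀ x → element (index x) ≈ x
  element-index x = proj₂ (proj₂ (proj₂ card) x)

  private
    index-element : ∀ i {x} → x ≈ element i → index x ≡ i
    index-element i {x} eq = element-injective (index x) i (trans (element-index x) eq)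

  _≟_ : ∀ x y → Dec (x ≈ y)
  x ≟ y with index x Fin.≟ index y
  ... | yes eq = yes (trans (sym (element-index x)) (trans (reflexive (≡.cong element eq)) (element-index y)))
  ... | no neq = no (λ x≈y → neq (index-element (index y) (trans x≈y (sym (element-index y)))))

  permutation-of : ∀ (f g : Carrier → Carrier) → (∀ {x y} → x ≈ y → f x ≈ f y) → (∀ {x y} → x ≈ y → g x ≈ g y) →
                   (∀ x → f (g x) ≈ x) → (∀ x → g (f x) ≈ x) → Permutation q q
  permutation-of f g f-cong g-cong fg gf = permutation (λ i → index (f (element i))) (λ i → index (g (element i)))
    (λ i → index-element i (trans (f-cong (element-index _)) (fg (element i))))
    (λ i → index-element i (trans (g-cong (element-index _)) (gf (element i))))

  1<q : 1 < q
  1<q = distinct⇒1<n (index 0#) (index 1#) λ eq →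
    0≉1 (trans (sym (element-index 0#)) (trans (reflexive (≡.cong element eq)) (element-index 1#)))
    where
    distinct⇒1<n : ∀ {n} (i j : Fin n) → ¬ i ≡ j → 1 < n
    distinct⇒1<n {1}           Fin.zero Fin.zero i≢j = ⊥-elim (i≢j ≡.refl)
    distinct⇒1<n {suc (suc n)} i        j        i≢j = s≤s (s≤s z≤n)

  0<q : 0 < q
  0<q = ℕₚ.<⇒≤ 1<q

  private
    module Π = Algebra.Properties.CommutativeMonoid.Sum *-commutativeMonoid

    Π-constant : ∀ {n} (c : Fin n → Carrier) x → (∀ i → c i ≈ x) → Π.sum c ≈ pow x n
    Π-constant {zero}  c x eq = refl
    Π-constant {suc n} c x eq = *-cong (eq Fin.zero) (Π-constant (c ∘ Fin.suc) x (eq ∘ Fin.suc))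

    -- The extra factor `x` stands in for the entry at `i₀`, which avoids the exponent n - 1.
    Π-constant-but-one : ∀ {n} (c : Fin n → Carrier) x i₀ → c i₀ ≈ 1# → (∀ i → ¬ i ≡ i₀ → c i ≈ x) → x * Π.sum c ≈ pow x n
    Π-constant-but-one {suc n} c x i₀ ci₀≈1 ci≈x = *-congˡ (begin
      Π.sum c  ≈⟨ Π.sum-remove {i = i₀} c ⟩
      c i₀ * Π.sum (λ j → c (Fin.punchIn i₀ j))  ≈⟨ *-cong ci₀≈1 (Π-constant _ x (λ j → ci≈x _ (Finₚ.punchInᵢ≢i i₀ j))) ⟩
      1# * pow x n  ≈⟨ *-identityˡ _ ⟩
      pow x n  ∎)

    Π-nonzero : ∀ {n} (c : Fin n → Carrier) → (∀ i → ¬ c i ≈ 0#) → ¬ Π.sum c ≈ 0#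
    Π-nonzero {zero}  c ≉0 1≈0 = 0≉1 (sym 1≈0)
    Π-nonzero {suc n} c ≉0     = nonzero-* (≉0 Fin.zero) (Π-nonzero (c ∘ Fin.suc) (≉0 ∘ Fin.suc))

    -- Puts 1 in the place of the zero element, so that a product over all of `K` is one over its
    -- nonzero elements.
    unless-zero : ∀ x → Carrier → Carrier
    unless-zero x y with x ≟ 0#
    ... | yes _ = 1#
    ... | no _  = y

  -- Multiplication by x ≉ 0 permutes K, hence fixes the product of the nonzero elements.
  fermat : ∀ x → pow x q ≈ x
  fermat x with x ≟ 0#
  ... | yes x≈0 = trans (pow-cong q x≈0) (trans (zero-pow q 0<q) (sym x≈0))
    where
    open Powers commutativeRing
    zero-pow : ∀ n → 0 < n → pow 0# n ≈ 0#
    zero-pow (suc n) _ = zeroˡ _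
  ... | no x≉0 = begin
    pow x q  ≈⟨ Π-constant-but-one c x (index 0#) c-zero c-nonzero ⟨
    x * Π.sum c  ≈⟨ *-congˡ Πc≈1 ⟩
    x * 1#  ≈⟨ *-identityʳ x ⟩
    x  ∎
    where
    c N : Fin q → Carrier
    c i = unless-zero (element i) x
    N i = unless-zero (element i) (element i)

    x⁻¹x : x ⁻¹ * x ≈ 1#
    x⁻¹x = inverseˡ x x≉0

    π : Permutation q q
    π = permutation-of (x *_) (x ⁻¹ *_) *-congˡ *-congˡ
      (λ y → trans (sym (*-assoc _ _ _)) (trans (*-congʳ (trans (*-comm _ _) x⁻¹x)) (*-identityˡ y)))
      (λ y → trans (sym (*-assoc _ _ _)) (trans (*-congʳ x⁻¹x) (*-identityˡ y)))

    N-nonzero : ∀ i → ¬ N i ≈ 0#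
    N-nonzero i with element i ≟ 0#
    ... | yes _  = λ 1≈0 → 0≉1 (sym 1≈0)
    ... | no ≉0 = ≉0

    c-zero : c (index 0#) ≈ 1#
    c-zero with element (index 0#) ≟ 0#
    ... | yes _ = refl
    ... | no ≉0 = ⊥-elim (≉0 (element-index 0#))

    c-nonzero : ∀ i → ¬ i ≡ index 0# → c i ≈ x
    c-nonzero i i≢0 with element i ≟ 0#
    ... | yes ≈0 = ⊥-elim (i≢0 (≡.sym (index-element i (sym ≈0))))
    ... | no _   = refl

    N-permuted : ∀ i → N (π ⟨$⟩ʳ i) ≈ c i * N i
    N-permuted i with element i ≟ 0# | element (index (x * element i)) ≟ 0#
    ... | yes ≈0 | yes _  = sym (*-identityˡ 1#)
    ... | yes ≈0 | no ≉0  = ⊥-elim (≉0 (trans (element-index _) (trans (*-congˡ ≈0) (zeroʳ x))))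
    ... | no ≉0  | yes ≈0 = ⊥-elim (nonzero-* x≉0 ≉0 (trans (sym (element-index _)) ≈0))
    ... | no _   | no _   = element-index _

    Πc≈1 : Π.sum c ≈ 1#
    Πc≈1 = *-cancelˡ (Π-nonzero N N-nonzero) (begin
      Π.sum N * Π.sum c  ≈⟨ *-comm _ _ ⟩
      Π.sum c * Π.sum N  ≈⟨ Π.∑-distrib-+ c N ⟨
      Π.sum (λ i → c i * N i)  ≈⟨ Π.sum-cong-≋ N-permuted ⟨
      Π.sum (λ i → N (π ⟨$⟩ʳ i))  ≈⟨ Π.sum-permute N π ⟨
      Π.sum N  ≈⟨ *-identityʳ _ ⟨
      Π.sum N * 1#  ∎)

  elements : List Carrier
  elements = tabulate element

  X^q-X-factors : monomial 1# q +ₚ (-ₚ X) ≋ prodₚ (map linear elements)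
  X^q-X-factors = monic≋linears elements
    (AllPairs.tabulate⁺ (λ i≢j → difference-regular (λ eq → i≢j (≡.sym (element-injective _ _ eq)))))
    (monomial 1# q +ₚ (-ₚ X))
    (≡.subst (MonicOfDegree (monomial 1# q +ₚ (-ₚ X))) (≡.sym (length-tabulate element))
      (monic-minus-lower {monomial 1# q} {X} (monic-monomial q) (deg<-mono {X} 1<q (deg<-length X))))
    (All.tabulate⁺ (λ i → root (element i)))
    where
    module E = Eval commutativeRing
    root : ∀ x → eval (monomial 1# q +ₚ (-ₚ X)) x ≈ 0#
    root x = begin
      eval (monomial 1# q +ₚ (-ₚ X)) x  ≈⟨ Hom.minus-homo polyRing commutativeRing (λ p → eval p x) (E.eval-isHom x)
          (monomial 1# q) X ⟩
      eval (monomial 1# q) x - eval X x  ≈⟨ +-cong (trans (E.eval-monomial x 1# q) (trans (*-identityˡ _) (fermat x)))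
          (-‿cong (E.eval-X x)) ⟩
      x - x  ≈⟨ -‿inverseʳ x ⟩
      0#  ∎

module Frobenius (K : Field) (q : ℕ) (card : HasCardinality K q) (S : CRing)
                 (ι : Field.Carrier K → CommutativeRing.Carrier S) (ι-hom : IsHom (Field.commutativeRing K) S ι) where
  private
    module K = Field K
    module PK = Poly K.commutativeRing
    module KX = PolyRing K.commutativeRing
    module F = FiniteField K q card
    module ι = Hom K.commutativeRing S ι ι-hom
  open CommutativeRing S hiding (zero)
  open Poly S
  open PolyRing S
  open Degree S
  open ListProduct S
  open Powers S
  open Eval S
  open MapPoly K.commutativeRing S ι ι-hom
  open EvalHom K.commutativeRing S ι ι-hom using (evalAt; evalAt-isHom; evalAt-1-monomial; evalAt-multiple) public
  private
    module PSX = Poly polyRing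
    module Π = Algebra.Properties.CommutativeMonoid.Sum *-commutativeMonoid
  open ≈-Reasoning setoid

  X^q-X-product : ∀ y → pow y q - y ≈ ∏ (map (λ a → y - ι a) F.elements)
  X^q-X-product y = begin
    pow y q - y  ≈⟨ +-cong (evalAt-1-monomial y q) (-‿cong evalAt-X) ⟨
    evalAt y (PK.monomial K.1# q) - evalAt y PK.X  ≈⟨ ev.minus-homo (PK.monomial K.1# q) PK.X ⟨
    evalAt y (PK.monomial K.1# q PK.+ₚ (PK.-ₚ PK.X))  ≈⟨ ev.cong F.X^q-X-factors ⟩
    evalAt y (PK.prodₚ (map PK.linear F.elements))  ≈⟨ ∏-homo KX.polyRing S (evalAt y) (evalAt-isHom y) PK.linear F.elements ⟩
    ∏ (map (λ a → evalAt y (PK.linear a)) F.elements)  ≈⟨ ∏-cong F.elements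
        (λ a → trans (eval-cong y (map-linear a)) (eval-linear y (ι a))) ⟩
    ∏ (map (λ a → y - ι a) F.elements)  ∎
    where
    module ev = Hom KX.polyRing S (evalAt y) (evalAt-isHom y)
    evalAt-X : evalAt y PK.X ≈ y
    evalAt-X = trans (eval-cong y {map ι PK.X} {X} (∷-cong ι.0#-homo (∷-cong ι.1#-homo ≋-refl))) (eval-X y)

  ι-fixed : ∀ a → pow (ι a) q ≈ ι a
  ι-fixed a = trans (sym (ι.pow-homo a q)) (ι.cong (F.fermat a))

  private
    -- This is y^q - y, written as a product over `K` because in that form a translation by an
    -- element of `K` merely permutes the factors.
    Φ : Carrier → Carrier
    Φ y = Π.sum (λ i → y - ι (F.element i))

    ∏-tabulate : ∀ {n} {A : Set} (f : A → Carrier) (t : Fin n → A) → ∏ (map f (tabulate t)) ≈ Π.sum (f ∘ t)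
    ∏-tabulate {zero}  f t = refl
    ∏-tabulate {suc n} f t = *-congˡ (∏-tabulate f (t ∘ Fin.suc))

    pow-q : ∀ y → pow y q ≈ y + Φ y
    pow-q y = begin
      pow y q  ≈⟨ minus-plus S (pow y q) y ⟩
      y + (pow y q - y)  ≈⟨ +-congˡ (trans (X^q-X-product y) (∏-tabulate (λ a → y - ι a) F.element)) ⟩
      y + Φ y  ∎

    Φ-cong : ∀ {y z} → y ≈ z → Φ y ≈ Φ z
    Φ-cong eq = Π.sum-cong-≋ {q} (λ i → +-congʳ eq)

    Φ-translate : ∀ y b → Φ (y + ι b) ≈ Φ y
    Φ-translate y b = begin
      Φ (y + ι b)  ≈⟨ Π.sum-permute _ π ⟩
      Π.sum (λ i → (y + ι b) - ι (F.element (π ⟨$⟩ʳ i)))  ≈⟨ Π.sum-cong-≋ {q}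
          (λ i → trans (+-congˡ (-‿cong (trans (ι.cong (F.element-index _)) (ι.+-homo (F.element i) b))))
              (translate-both S y (ι b) _)) ⟩
      Φ y  ∎
      where
      π : Permutation q q
      π = F.permutation-of (K._+ b) (K._- b) K.+-congʳ K.+-congʳ
        (λ x → K.trans (K.+-assoc _ _ _) (K.trans (K.+-congˡ (K.-‿inverseˡ b)) (K.+-identityʳ x)))
        (λ x → K.trans (K.+-assoc _ _ _) (K.trans (K.+-congˡ (K.-‿inverseʳ b)) (K.+-identityʳ x)))

    -- Additivity of the q-th power when one summand comes from `K`. It provides the q roots of `Ψ`,
    -- which then frees that summand.
    translate-pow : ∀ y b → pow (ι b + y) q ≈ ι b + pow y q
    translate-pow y b = begin
      pow (ι b + y) q  ≈⟨ pow-q _ ⟩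
      ι b + y + Φ (ι b + y)  ≈⟨ +-congˡ (trans (Φ-cong (+-comm _ _)) (Φ-translate y b)) ⟩
      ι b + y + Φ y  ≈⟨ +-assoc _ _ _ ⟩
      ι b + (y + Φ y)  ≈⟨ +-congˡ (pow-q y) ⟨
      ι b + pow y q  ∎

    module _ (z : Carrier) where
      Z = PSX.pow (X +ₚ const z) q
      Ψ = (Z +ₚ (-ₚ monomial 1# q)) +ₚ (-ₚ const (pow z q))

      eval-Ψ : ∀ y → eval Ψ y ≈ (pow (y + z) q - pow y q) - pow z q
      eval-Ψ y = begin
        eval Ψ y  ≈⟨ ev.minus-homo (Z +ₚ (-ₚ monomial 1# q)) (const (pow z q)) ⟩
        eval (Z +ₚ (-ₚ monomial 1# q)) y - eval (const (pow z q)) y  ≈⟨ +-cong (ev.minus-homo Z (monomial 1# q))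
            (-‿cong (eval-const y _)) ⟩
        (eval Z y - eval (monomial 1# q) y) - pow z q  ≈⟨ +-congʳ (+-cong
            (trans (ev.pow-homo (X +ₚ const z) q) (pow-cong q (trans (eval-+ y X (const z))
                (+-cong (eval-X y) (eval-const y z))))) (-‿cong (trans (eval-monomial y 1# q) (*-identityˡ _)))) ⟩
        (pow (y + z) q - pow y q) - pow z q  ∎
        where module ev = Hom polyRing S (λ p → eval p y) (eval-isHom y)

      Z-monic : MonicOfDegree Z q
      Z-monic = ≡.subst (MonicOfDegree Z) (ℕₚ.*-identityʳ q) (power q)
        where
        base : MonicOfDegree (X +ₚ const z) 1
        base = refl , λ { (suc zero) (s≤s ()) ; (suc (suc i)) _ → refl }
        power : ∀ n → MonicOfDegree (PSX.pow (X +ₚ const z) n) (n ℕ.* 1)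
        power zero    = monic-1
        power (suc n) = monic-* {X +ₚ const z} {PSX.pow (X +ₚ const z) n} base (power n)

      Ψ-small : Deg< Ψ q
      Ψ-small = deg<-minus {Z +ₚ (-ₚ monomial 1# q)} {const (pow z q)}
        (monic-difference {Z} {monomial 1# q} Z-monic (monic-monomial q))
        (deg<-mono {const (pow z q)} F.0<q (deg<-length (const (pow z q))))

      Ψ-root : ∀ b → eval Ψ (ι b) ≈ 0#
      Ψ-root b = begin
        eval Ψ (ι b)  ≈⟨ eval-Ψ (ι b) ⟩
        (pow (ι b + z) q - pow (ι b) q) - pow z q  ≈⟨ +-congʳ (+-cong (translate-pow z b) (-‿cong (ι-fixed b))) ⟩
        (ι b + pow z q - ι b) - pow z q  ≈⟨ cancel-all S (ι b) (pow z q) ⟩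
        0#  ∎

      Ψ≋[] : Ψ ≋ []
      Ψ≋[] = too-many-roots (tabulate (ι ∘ F.element))
        (AllPairs.tabulate⁺ (λ i≢j → image-difference-regular K S ι ι-hom (λ eq → i≢j (≡.sym (proj₁ (proj₂ card) _ _ eq)))))
        Ψ (All.tabulate⁺ (λ i → Ψ-root (F.element i)))
        (≡.subst (Deg< Ψ) (≡.sym (length-tabulate (ι ∘ F.element))) Ψ-small)

  pow-q-+ : ∀ y z → pow (y + z) q ≈ pow y q + pow z q
  pow-q-+ y z = three-term S (pow (y + z) q) (pow y q) (pow z q)
    (trans (sym (eval-Ψ z y)) (eval-[] y (Ψ≋[] z)))

  frobenius-isHom : IsHom S S (λ y → pow y q)
  frobenius-isHom = isHom S S (λ y → pow y q) (pow-cong q) pow-q-+ (λ y z → pow-distrib y z q) (pow-1# q)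

  -- The coefficients come from `K` and are fixed by the q-th power; hence Frobenius maps roots of
  -- `p` to roots of `p`.
  evalAt-frobenius : ∀ p y → evalAt (pow y q) p ≈ pow (evalAt y p) q
  evalAt-frobenius p y = trans (eval-cong (pow y q) (map-fixed p)) (sym
      (MapPoly.eval-map S S (λ y → pow y q) frobenius-isHom (map ι p) y))
    where
    map-fixed : ∀ p → map ι p ≋ map (λ y → pow y q) (map ι p)
    map-fixed []      = ≋-refl
    map-fixed (a ∷ p) = ∷-cong (sym (ι-fixed a)) (map-fixed p)

-- Polynomials over a field and residue fields

module QuotientRing (R : CRing) (a : CommutativeRing.Carrier R) where
  open CommutativeRing R hiding (zero)
  open IntegerSolver R

  infix 4 _∼_
  record _∼_ (x y : Carrier) : Set where
    constructor differ-by
    field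
      multiplier : Carrier
      congruence : x ≈ y + a * multiplier

  ≈⇒∼ : ∀ {x y} → x ≈ y → x ∼ y
  ≈⇒∼ {x} {y} eq = differ-by 0# (trans eq (solve 2 (λ y a → y := y :+ a :* :0) refl y a))

  multiple∼0 : ∀ {x} h → x ≈ a * h → x ∼ 0#
  multiple∼0 h eq = differ-by h (trans eq (sym (+-identityˡ _)))

  ∼-sym : ∀ {x y} → x ∼ y → y ∼ x
  ∼-sym {x} {y} (differ-by h eq) = differ-by (- h)
    (trans (solve 3 (λ y a h → y := (y :+ a :* h) :+ a :* (:- h)) refl y a h) (+-congʳ (sym eq)))

  ∼-trans : ∀ {x y z} → x ∼ y → y ∼ z → x ∼ z
  ∼-trans {x} {y} {z} (differ-by h eq) (differ-by g eq′) = differ-by (g + h)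
    (trans eq (trans (+-congʳ eq′) (solve 4 (λ z a g h → (z :+ a :* g) :+ a :* h := z :+ a :* (g :+ h)) refl z a g h)))

  ∼-+ : ∀ {x x′ y y′} → x ∼ x′ → y ∼ y′ → x + y ∼ x′ + y′
  ∼-+ {x} {x′} {y} {y′} (differ-by h eq) (differ-by g eq′) = differ-by (h + g)
    (trans (+-cong eq eq′) (solve 5 (λ x y a h g → (x :+ a :* h) :+ (y :+ a :* g) := (x :+ y) :+ a :* (h :+ g)) refl x′ y′ a h g))

  ∼-* : ∀ {x x′ y y′} → x ∼ x′ → y ∼ y′ → x * y ∼ x′ * y′
  ∼-* {x} {x′} {y} {y′} (differ-by h eq) (differ-by g eq′) = differ-by (h * y′ + x′ * g + h * (a * g))
    (trans (*-cong eq eq′) (solve 5 (λ x y a h g →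
       (x :+ a :* h) :* (y :+ a :* g) := (x :* y) :+ a :* ((h :* y :+ x :* g) :+ h :* (a :* g))) refl x′ y′ a h g))

  ∼-neg : ∀ {x x′} → x ∼ x′ → - x ∼ - x′
  ∼-neg {x} {x′} (differ-by h eq) = differ-by (- h)
    (trans (-‿cong eq) (solve 3 (λ x a h → :- (x :+ a :* h) := :- x :+ a :* (:- h)) refl x′ a h))

  -- Only the equality is coarsened: the carrier and the operations stay, and the projection is
  -- `id`.
  quotientRing : CRing
  quotientRing = record
    { Carrier = Carrier ; _≈_ = _∼_ ; _+_ = _+_ ; _*_ = _*_ ; -_ = -_ ; 0# = 0# ; 1# = 1#
    ; isCommutativeRing = record
      { isRing = record
        { +-isAbelianGroup = record
          { isGroup = record
            { isMonoid = record
              { isSemigroup = record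
                { isMagma = record
                  { isEquivalence = record { refl = ≈⇒∼ refl ; sym = ∼-sym ; trans = ∼-trans }
                  ; ∙-cong = ∼-+
                  }
                ; assoc = λ x y z → ≈⇒∼ (+-assoc x y z)
                }
              ; identity = (λ x → ≈⇒∼ (+-identityˡ x)) , (λ x → ≈⇒∼ (+-identityʳ x))
              }
            ; inverse = (λ x → ≈⇒∼ (-‿inverseˡ x)) , (λ x → ≈⇒∼ (-‿inverseʳ x))
            ; ⁻¹-cong = ∼-neg
            }
          ; comm = λ x y → ≈⇒∼ (+-comm x y)
          }
        ; *-cong = ∼-*
        ; *-assoc = λ x y z → ≈⇒∼ (*-assoc x y z)
        ; *-identity = (λ x → ≈⇒∼ (*-identityˡ x)) , (λ x → ≈⇒∼ (*-identityʳ x))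
        ; distrib = (λ x y z → ≈⇒∼ (distribˡ x y z)) , (λ x y z → ≈⇒∼ (distribʳ x y z))
        }
      ; *-comm = λ x y → ≈⇒∼ (*-comm x y)
      }
    }

  projection-isHom : IsHom R quotientRing id
  projection-isHom = isHom R quotientRing id ≈⇒∼ (λ x y → ≈⇒∼ refl) (λ x y → ≈⇒∼ refl) (≈⇒∼ refl)

module _ (R : CRing) where
  open CommutativeRing R hiding (zero)
  open IntegerSolver R

  -- Modulo `f` the division says r ≡ - p q, so s r ≡ 1 makes - s q an inverse of `p`; the factor
  -- `c′` undoes the scaling of `x` to `p`.
  reduced-inverse : ∀ {f p q r s h c c′ x} → c′ * c ≈ 1# → f ≈ p * q + r → s * r ≈ 1# + f * h → x ≈ c * p →
                    (c′ * - (s * q)) * x ≈ 1# + f * (h - s)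
  reduced-inverse {f} {p} {q} {r} {s} {h} {c} {c′} {x} cc′ fdiv inv xcp =
    trans (*-congˡ xcp) (trans
      (solve 6 (λ c c′ s q p r → (c′ :* :- (s :* q)) :* (c :* p) := (c′ :* c) :* (s :* r ⊝ s :* (p :* q :+ r))) refl c c′ s q p r)
      (trans (*-cong cc′ (+-cong inv (-‿cong (*-congˡ (sym fdiv)))))
        (solve 3 (λ f h s → :1 :* ((:1 :+ f :* h) ⊝ s :* f) := :1 :+ f :* (h ⊝ s)) refl f h s)))

  lifted-inverse : ∀ {f p q r s h} → p ≈ f * q + r → s * r ≈ 1# + f * h → s * p ≈ 1# + f * (h + s * q)
  lifted-inverse {f} {p} {q} {r} {s} {h} pdiv inv = trans (*-congˡ pdiv) (trans
    (solve 4 (λ s f q r → s :* (f :* q :+ r) := s :* r :+ f :* (s :* q)) refl s f q r) (trans (+-congʳ inv)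
    (solve 4 (λ f h s q → (:1 :+ f :* h) :+ f :* (s :* q) := :1 :+ f :* (h :+ s :* q)) refl f h s q)))

  one-minus-multiple : ∀ {f p s h g} → s * p ≈ 1# + f * h → p ≈ f * g → 1# ≈ f * (s * g - h)
  one-minus-multiple {f} {p} {s} {h} {g} inv pfg = trans
    (solve 2 (λ f h → :1 := (:1 :+ f :* h) ⊝ f :* h) refl f h) (trans (+-congʳ (trans (sym inv) (*-congˡ pfg)))
    (solve 4 (λ f s g h → s :* (f :* g) ⊝ f :* h := f :* (s :* g ⊝ h)) refl f s g h))

module FieldPoly (K : Field) (_≟_ : ∀ x y → Dec (Field._≈_ K x y)) where
  open Field K hiding (zero)
  open Poly commutativeRing
  open PolyRing commutativeRing
  open Degree commutativeRing
  open FieldProperties K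
  private
    module P = CommutativeRing polyRing
    module C = Hom commutativeRing polyRing const const-isHom
  open ≈-Reasoning P.setoid

  -- A coefficient list may end in zeros; this view exhibits the true degree and leading
  -- coefficient, and decidability of being zero or a unit follows from it.
  data Normalised (p : Pol) : Set where
    is-zero : p ≋ [] → Normalised p
    scaled  : ∀ c k p′ → ¬ c ≈ 0# → MonicOfDegree p′ k → p ≋ scale c p′ → Normalised p

  normalise : ∀ p → Normalised p
  normalise []      = is-zero ≋-refl
  normalise (a ∷ p) with normalise p
  ... | scaled c k p′ c≉0 (lead , deg) eq = scaled c (suc k) (c ⁻¹ * a ∷ p′) c≉0
          (lead , λ { (suc i) (s≤s k<i) → deg i k<i })
          (∷-cong (sym (trans (sym (*-assoc c (c ⁻¹) a)) (trans (*-congʳ (trans (*-comm c (c ⁻¹)) (inverseˡ c c≉0)))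
              (*-identityˡ a)))) eq)
  ... | is-zero eq with a ≟ 0#
  ...   | yes a≈0 = is-zero (0∷[] a≈0 eq)
  ...   | no a≉0  = scaled a 0 1ₚ a≉0 monic-1 (∷-cong (sym (*-identityʳ a)) eq)

  monic-nonzero : ∀ {p k} → MonicOfDegree p k → ¬ p ≋ []
  monic-nonzero (lead , _) eq = 0≉1 (trans (sym (coeff-eq eq _)) lead)

  scaled-coeff : ∀ {p c k p′} → MonicOfDegree p′ k → p ≋ scale c p′ → coeff p k ≈ c
  scaled-coeff {p} {c} {k} {p′} (lead , _) eq =
    trans (coeff-eq eq k) (trans (coeff-scale c p′ k) (trans (*-congˡ lead) (*-identityʳ c)))

  scaled-degree : ∀ {p c k p′ N} → ¬ c ≈ 0# → MonicOfDegree p′ k → p ≋ scale c p′ → Deg< p N → k < N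
  scaled-degree {p} {c} {k} {p′} {N} c≉0 monic eq deg with k ℕₚ.<? N
  ... | yes k<N = k<N
  ... | no k≮N  = ⊥-elim (c≉0 (trans (sym (scaled-coeff {p} {p′ = p′} monic eq)) (deg k (ℕₚ.≮⇒≥ k≮N))))

  zero? : ∀ p → Dec (p ≋ [])
  zero? p with normalise p
  ... | is-zero eq                  = yes eq
  ... | scaled c k p′ c≉0 monic eq = no λ p≋[] → c≉0 (trans (sym (scaled-coeff {p} {p′ = p′} monic eq)) (coeff-eq p≋[] k))

  scale≋const* : ∀ c p → scale c p ≋ const c *ₚ p
  scale≋const* c p = P.sym (const-* c p)

  const-inverse : ∀ {c} → ¬ c ≈ 0# → const (c ⁻¹) *ₚ const c ≋ 1ₚ
  const-inverse {c} c≉0 = P.trans (P.sym (C.*-homo (c ⁻¹) c)) (C.cong (inverseˡ c c≉0))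

  nonzero-scale-cancel : ∀ {c p r} → ¬ c ≈ 0# → p ≋ scale c r → r ≋ const (c ⁻¹) *ₚ p
  nonzero-scale-cancel {c} {p} {r} c≉0 eq = begin
    r  ≈⟨ P.*-identityˡ r ⟨
    1ₚ *ₚ r  ≈⟨ P.*-congʳ {r} (const-inverse c≉0) ⟨
    (const (c ⁻¹) *ₚ const c) *ₚ r  ≈⟨ P.*-assoc (const (c ⁻¹)) (const c) r ⟩
    const (c ⁻¹) *ₚ (const c *ₚ r)  ≈⟨ P.*-congˡ {const (c ⁻¹)} (P.trans (const-* c r) (P.sym eq)) ⟩
    const (c ⁻¹) *ₚ p  ∎

  unit-multiple : ∀ {p c p′} → ¬ c ≈ 0# → p ≋ scale c p′ → IsUnit p′ → IsUnit p
  unit-multiple {p} {c} {p′} c≉0 eq (h , ph≈1) = const (c ⁻¹) *ₚ h , coeff-eq (begin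
    p *ₚ (const (c ⁻¹) *ₚ h)  ≈⟨ P.*-assoc p (const (c ⁻¹)) h ⟨
    (p *ₚ const (c ⁻¹)) *ₚ h  ≈⟨ P.*-congʳ {h} (P.trans (P.*-comm p (const (c ⁻¹))) (P.sym (nonzero-scale-cancel c≉0 eq))) ⟩
    p′ *ₚ h  ≈⟨ coeffs ph≈1 ⟩
    1ₚ  ∎)

  monic-0⇒1 : ∀ {p} → MonicOfDegree p 0 → p ≋ 1ₚ
  monic-0⇒1 (lead , deg) = coeffs λ { zero → lead ; (suc i) → deg (suc i) (s≤s z≤n) }

  1-small : ∀ {k} → 0 < k → Deg< 1ₚ k
  1-small 0<k (suc i) _ = refl
  1-small (s≤s z≤n) zero ()

  monic-not-dividing-1 : ∀ {p k} → MonicOfDegree p k → 0 < k → ∀ h → ¬ 1ₚ ≋ p *ₚ h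
  monic-not-dividing-1 {p} {k} monic 0<k h eq = monic-nonzero {1ₚ} monic-1 (P.trans eq (P.trans (P.*-congˡ {p} h≋[]) (P.zeroʳ p)))
    where
    h≋[] : h ≋ []
    h≋[] = monic-multiple-small {p} monic h (deg<-cong eq (1-small 0<k))

  monic-positive-nonunit : ∀ {p k} → MonicOfDegree p k → 0 < k → ¬ IsUnit p
  monic-positive-nonunit {p} monic 0<k (h , ph≈1) = monic-not-dividing-1 {p} monic 0<k h (P.sym (coeffs ph≈1))

  monic-nonunit-positive : ∀ {p k} → MonicOfDegree p k → ¬ IsUnit p → 0 < k
  monic-nonunit-positive {p} {zero}  monic ¬unit =
    ⊥-elim (¬unit (1ₚ , coeff-eq (P.trans (P.*-identityʳ p) (monic-0⇒1 {p} monic))))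
  monic-nonunit-positive {p} {suc k} monic ¬unit = s≤s z≤n

  unit? : ∀ p → Dec (IsUnit p)
  unit? p with normalise p
  ... | is-zero eq = no λ (h , ph≈1) → monic-nonzero {1ₚ} monic-1 (P.trans (P.sym (coeffs ph≈1)) (P.*-congʳ {h} eq))
  ... | scaled c zero p′ c≉0 monic eq = yes (unit-multiple {p} c≉0 eq (1ₚ , coeff-eq
      (P.trans (P.*-identityʳ p′) (monic-0⇒1 {p′} monic))))
  ... | scaled c (suc k) p′ c≉0 monic eq = no λ (h , ph≈1) → monic-positive-nonunit {p′} monic (s≤s z≤n)
          (const c *ₚ h , coeff-eq (begin
            p′ *ₚ (const c *ₚ h)  ≈⟨ P.*-assoc p′ (const c) h ⟨
            (p′ *ₚ const c) *ₚ h  ≈⟨ P.*-congʳ {h} (P.trans (P.*-comm p′ (const c)) (P.trans (const-* c p′) (P.sym eq))) ⟩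
            p *ₚ h  ≈⟨ coeffs ph≈1 ⟩
            1ₚ  ∎))

  monic-scaled-degree : ∀ {p r k j c} → MonicOfDegree p k → MonicOfDegree r j → p ≋ scale c r → k ≡ j
  monic-scaled-degree {p} {r} {k} {j} {c} (leadp , degp) monic-r@(leadr , degr) eq with ℕₚ.<-cmp k j
  ... | tri≈ _ k≡j _ = k≡j
  ... | tri< k<j _ _ = ⊥-elim (0≉1 (trans (sym (zeroˡ (coeff r k)))
          (trans (*-congʳ (trans (sym (degp j k<j)) (scaled-coeff {p} {p′ = r} monic-r eq)))
            (trans (sym (coeff-scale c r k)) (trans (sym (coeff-eq eq k)) leadp)))))
  ... | tri> _ _ j<k = ⊥-elim (0≉1 (trans (sym (zeroʳ c)) (trans (*-congˡ (sym (degr k j<k)))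
            (trans (sym (coeff-scale c r k)) (trans (sym (coeff-eq eq k)) leadp)))))

  record ProperFactor (a : Pol) (k : ℕ) : Set where
    field
      unit     : Carrier
      degree   : ℕ
      monic    : Pol
      unit≉0   : ¬ unit ≈ 0#
      is-monic : MonicOfDegree monic degree
      a≋       : a ≋ scale unit monic
      0<degree : 0 < degree
      degree<k : degree < k

  proper-factor : ∀ {p k a b} → MonicOfDegree p k → p ≋ a *ₚ b → ¬ IsUnit a → ¬ IsUnit b → ProperFactor a k
  proper-factor {p} {k} {a} {b} monic eq ¬unit-a ¬unit-b with normalise a | normalise b
  ... | is-zero a≋[] | _ = ⊥-elim (monic-nonzero monic (P.trans eq (P.*-congʳ {b} a≋[])))
  ... | _ | is-zero b≋[] = ⊥-elim (monic-nonzero monic (P.trans eq (P.trans (P.*-congˡ {a} b≋[]) (P.zeroʳ a))))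
  ... | scaled c zero a′ c≉0 monic-a a≋ | _ =
          ⊥-elim (¬unit-a (unit-multiple {a} c≉0 a≋ (1ₚ , coeff-eq (P.trans (P.*-identityʳ a′) (monic-0⇒1 {a′} monic-a)))))
  ... | _ | scaled c zero b′ c≉0 monic-b b≋ =
          ⊥-elim (¬unit-b (unit-multiple {b} c≉0 b≋ (1ₚ , coeff-eq (P.trans (P.*-identityʳ b′) (monic-0⇒1 {b′} monic-b)))))
  ... | scaled c (suc i) a′ c≉0 monic-a a≋ | scaled c′ (suc j) b′ c′≉0 monic-b b≋ = record
          { unit = c ; degree = suc i ; monic = a′ ; unit≉0 = c≉0 ; is-monic = monic-a ; a≋ = a≋ ; 0<degree = s≤s z≤n
          ; degree<k = ≡.subst (suc i <_) (≡.sym (monic-scaled-degree {p} {a′ *ₚ b′} {c = c * c′} monic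
              (monic-* {a′} {b′} monic-a monic-b) factored))
              (ℕₚ.m<m+n (suc i) (s≤s z≤n)) }
          where
          factored : p ≋ scale (c * c′) (a′ *ₚ b′)
          factored = begin
            p  ≈⟨ eq ⟩
            a *ₚ b  ≈⟨ P.*-cong a≋ b≋ ⟩
            scale c a′ *ₚ scale c′ b′  ≈⟨ scale-* c a′ (scale c′ b′) ⟩
            scale c (a′ *ₚ scale c′ b′)  ≈⟨ scale-cong refl (P.trans (P.*-comm a′ (scale c′ b′))
                (P.trans (scale-* c′ b′ a′) (scale-cong refl (P.*-comm b′ a′)))) ⟩
            scale c (scale c′ (a′ *ₚ b′))  ≈⟨ scale-scale c c′ (a′ *ₚ b′) ⟩
            scale (c * c′) (a′ *ₚ b′)  ∎

  IrreducibleFactor : Pol → ℕ → Set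
  IrreducibleFactor a N = ∃ λ b → ∃ λ D → MonicOfDegree b D × Irreducible b × D ≤ N × ∃ λ h → a ≋ b *ₚ h

  -- If there were no irreducible factor, any splitting of `a` into non-units would yield a proper
  -- factor of smaller degree, again without irreducible factors; so `a` itself would be
  -- irreducible. The double negation spares a search through the divisors and suffices for
  -- refutations. `N` bounds the recursion.
  irreducible-factor : ∀ N a k → MonicOfDegree a k → 0 < k → k ≤ N → ¬ ¬ IrreducibleFactor a k
  irreducible-factor zero    a (suc k) monic 0<k ()
  irreducible-factor (suc N) a k monic 0<k k≤1+N none =
    none (a , k , monic , (a≉0 , monic-positive-nonunit {a} monic 0<k , split) , ℕₚ.≤-refl , 1ₚ , P.sym (P.*-identityʳ a))
    where
    a≉0 : ¬ a ≈ₚ []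
    a≉0 eq = monic-nonzero {a} monic (coeffs eq)
    split : ∀ b c → a ≈ₚ b *ₚ c → IsUnit b ⊎ IsUnit c
    split b c eq with unit? b | unit? c
    ... | yes u | _     = inj₁ u
    ... | _     | yes u = inj₂ u
    ... | no ¬u | no ¬v = ⊥-elim (irreducible-factor N F.monic F.degree F.is-monic F.0<degree
            (ℕₚ.≤-pred (ℕₚ.≤-trans F.degree<k k≤1+N)) extend)
      where
      module F = ProperFactor (proper-factor {a} {k} {b} {c} monic (coeffs eq) ¬u ¬v)
      extend : ¬ IrreducibleFactor F.monic F.degree
      extend (g , D , monic-g , irr , D≤ , h , eq′) = none (g , D , monic-g , irr , ℕₚ.≤-trans D≤ (ℕₚ.<⇒≤ F.degree<k) ,
        h *ₚ (const F.unit *ₚ c) , (begin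
          a  ≈⟨ coeffs eq ⟩
          b *ₚ c  ≈⟨ P.*-congʳ {c} (P.trans F.a≋ (P.trans (scale≋const* F.unit F.monic) (P.*-comm (const F.unit) F.monic))) ⟩
          (F.monic *ₚ const F.unit) *ₚ c  ≈⟨ P.*-assoc F.monic (const F.unit) c ⟩
          F.monic *ₚ (const F.unit *ₚ c)  ≈⟨ P.*-congʳ {const F.unit *ₚ c} eq′ ⟩
          (g *ₚ h) *ₚ (const F.unit *ₚ c)  ≈⟨ P.*-assoc g h (const F.unit *ₚ c) ⟩
          g *ₚ (h *ₚ (const F.unit *ₚ c))  ∎))

  monic-multiple-degree : ∀ {f p D k h} → MonicOfDegree f D → MonicOfDegree p k → p ≋ f *ₚ h → D ≤ k
  monic-multiple-degree {f} {p} {D} {k} {h} monic-f monic-p eq with D ℕₚ.≤? k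
  ... | yes D≤k = D≤k
  ... | no D≰k  = ⊥-elim (monic-nonzero monic-p (P.trans eq (P.trans (P.*-congˡ {f} h≋[]) (P.zeroʳ f))))
    where
    h≋[] : h ≋ []
    h≋[] = monic-multiple-small {f} monic-f h (deg<-cong eq (deg<-mono {p} (ℕₚ.≰⇒> D≰k) (proj₂ monic-p)))

  module Modulus (f : Pol) (D : ℕ) (monic-f : MonicOfDegree f D) (irreducible : Irreducible f) where
    Multiple Invertible : Pol → Set
    Multiple p   = ∃ λ h → p ≋ f *ₚ h
    Invertible p = ∃ λ s → ∃ λ h → s *ₚ p ≋ 1ₚ +ₚ f *ₚ h

    0<D : 0 < D
    0<D = monic-nonunit-positive {f} monic-f (proj₁ (proj₂ irreducible))

    -- Euclid's algorithm, driven by the divisions of f itself: f = p q + r makes p invertible modulo f as soon as r is.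
    small-invertible : ∀ N p → Deg< p N → N ≤ D → ¬ p ≋ [] → Invertible p
    small-invertible zero    p deg N≤D p≉0 = ⊥-elim (p≉0 (deg<-0 {p} deg))
    small-invertible (suc N) p deg N<D p≉0 with normalise p
    ... | is-zero p≋[] = ⊥-elim (p≉0 p≋[])
    ... | scaled c k p′ c≉0 monic p≋ with divMod {p′} monic f
    ...   | divMod-result q r f≋ r-small with zero? r
    ...     | no r≉0 = let (s , h , sr≋) = small-invertible N r (deg<-mono {r} (ℕₚ.≤-pred (scaled-degree {p} {p′ = p′} c≉0 monic p≋ deg)) r-small) (ℕₚ.<⇒≤ N<D) r≉0 in
              const (c ⁻¹) *ₚ (-ₚ (s *ₚ q)) , h +ₚ (-ₚ s) ,
              reduced-inverse polyRing {f} {p′} {q} {r} {s} {h} {const c} {const (c ⁻¹)} {p} (const-inverse c≉0) f≋ sr≋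
                  (P.trans p≋ (scale≋const* c p′))
    -- With remainder zero `p′` divides the irreducible `f`. Either `p′` is a unit, or `q` is one
    -- and then `f` divides `p′`, which has smaller degree.
    ...     | yes r≋[] with proj₂ (proj₂ irreducible) p′ q (coeff-eq (P.trans f≋
        (P.trans (P.+-congˡ {p′ *ₚ q} r≋[]) (P.+-identityʳ _))))
    ...       | inj₁ unit-p′ = let (h , ph≈1) = unit-multiple {p} c≉0 p≋ unit-p′ in
                h , [] , P.trans (P.*-comm h p) (P.trans (coeffs ph≈1)
                    (P.sym (P.trans (P.+-congˡ {1ₚ} (P.zeroʳ f)) (P.+-identityʳ 1ₚ))))
    ...       | inj₂ (h , qh≈1) = ⊥-elim (ℕₚ.<-irrefl ≡.refl
                (ℕₚ.≤-trans (s≤s (monic-multiple-degree {f} {p′} {h = h} monic-f monic p′≋))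
                    (ℕₚ.≤-trans (scaled-degree {p} {p′ = p′} c≉0 monic p≋ deg) N<D)))
      where
      p′≋ : p′ ≋ f *ₚ h
      p′≋ = begin
        p′  ≈⟨ P.*-identityʳ p′ ⟨
        p′ *ₚ 1ₚ  ≈⟨ P.*-congˡ {p′} (coeffs qh≈1) ⟨
        p′ *ₚ (q *ₚ h)  ≈⟨ P.*-assoc p′ q h ⟨
        (p′ *ₚ q) *ₚ h  ≈⟨ P.*-congʳ {h} (P.trans f≋ (P.trans (P.+-congˡ {p′ *ₚ q} r≋[]) (P.+-identityʳ _))) ⟨
        f *ₚ h  ∎

    multiple-or-invertible : ∀ p → Multiple p ⊎ Invertible p
    multiple-or-invertible p with divMod {f} monic-f p
    ... | divMod-result q r p≋ r-small with zero? r
    ...   | yes r≋[] = inj₁ (q , P.trans p≋ (P.trans (P.+-congˡ {f *ₚ q} r≋[]) (P.+-identityʳ _)))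
    ...   | no r≉0   = let (s , h , sr≋) = small-invertible D r r-small ℕₚ.≤-refl r≉0 in
                       inj₂ (s , h +ₚ s *ₚ q , lifted-inverse polyRing {f} {p} {q} {r} {s} {h} p≋ sr≋)

    invertible⇒not-multiple : ∀ {p} → Invertible p → ¬ Multiple p
    invertible⇒not-multiple {p} (s , h , inv) (g , p≋fg) = monic-not-dividing-1 {f} monic-f 0<D (s *ₚ g +ₚ (-ₚ h))
      (one-minus-multiple polyRing {f} {p} {s} {h} {g} inv p≋fg)

    open QuotientRing polyRing f public using (_∼_; differ-by; ≈⇒∼; multiple∼0; ∼-trans; ∼-sym; quotientRing; projection-isHom)

    ∼0⇒multiple : ∀ {p} → p ∼ [] → Multiple p
    ∼0⇒multiple (differ-by h eq) = h , eq

    inverse : Pol → Pol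
    inverse p with multiple-or-invertible p
    -- Here `p` is zero in the residue field, so this value is arbitrary.
    ... | inj₁ _       = []
    ... | inj₂ (s , _) = s

    inverse-correct : ∀ p → ¬ p ∼ [] → inverse p *ₚ p ∼ 1ₚ
    inverse-correct p p≁0 with multiple-or-invertible p
    ... | inj₁ (h , eq)     = ⊥-elim (p≁0 (multiple∼0 h eq))
    ... | inj₂ (s , h , eq) = differ-by h eq

    quotientField : Field
    quotientField = record
      { commutativeRing = quotientRing
      ; _⁻¹ = inverse
      ; 0≉1 = λ 0∼1 → let (h , eq) = ∼0⇒multiple (∼-sym 0∼1) in monic-not-dividing-1 {f} monic-f 0<D h eq
      ; inverseˡ = inverse-correct
      }

    _∼?_ : ∀ p r → Dec (p ∼ r)
    p ∼? r with multiple-or-invertible (p +ₚ (-ₚ r))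
    ... | inj₁ (h , eq) = yes (Q.x∙y⁻¹≈ε⇒x≈y p r (multiple∼0 h eq))
      where module Q = FieldProperties quotientField
    ... | inj₂ inv      = no λ p∼r → invertible⇒not-multiple inv (∼0⇒multiple (Q.x≈y⇒x∙y⁻¹≈ε p∼r))
      where module Q = FieldProperties quotientField

    constant-isHom : IsFieldHom K quotientField const
    constant-isHom = ∘-isHom commutativeRing polyRing quotientRing const id const-isHom projection-isHom

    eval-X̄ : ∀ p → Poly.eval quotientRing (map const p) X ∼ p
    eval-X̄ p = ≈⇒∼ (P.trans (P.reflexive (≡.sym (C′.compose≡eval p X))) (C′.compose-X p))
      where module C′ = Compose commutativeRing

    X̄-root : Poly.eval quotientRing (map const f) X ∼ []
    X̄-root = ∼-trans (eval-X̄ f) (multiple∼0 1ₚ (P.sym (P.*-identityʳ f)))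

    module Lift (L : Field) (ι : Carrier → Field.Carrier L) (ι-hom : IsFieldHom K L ι) (α : Field.Carrier L)
                (root : Field._≈_ L (Poly.eval (Field.commutativeRing L) (map ι f) α) (Field.0# L)) where
      private
        module L = Field L
        module EL = Eval L.commutativeRing

      open EvalHom commutativeRing L.commutativeRing ι ι-hom using (evalAt; evalAt-isHom; evalAt-multiple)

      lift : Pol → L.Carrier
      lift = evalAt α

      private
        module H = Hom polyRing L.commutativeRing lift (evalAt-isHom α)

      multiple-root : ∀ {p} → Multiple p → lift p L.≈ L.0#
      multiple-root = evalAt-multiple {α} {f} root

      -- Otherwise `p` is invertible modulo `f`, and evaluating the inverse relation at α gives 0 =
      -- 1.
      root⇒multiple : ∀ p → lift p L.≈ L.0# → Multiple p
      root⇒multiple p p-root with multiple-or-invertible p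
      ... | inj₁ multiple     = multiple
      ... | inj₂ (s , h , eq) = ⊥-elim (L.0≉1 (L.trans (L.sym (L.trans (H.*-homo s p) (L.trans (L.*-congˡ p-root) (L.zeroʳ _))))
              (L.trans (H.cong eq) (L.trans (H.+-homo 1ₚ (f *ₚ h)) (L.trans
                  (L.+-cong H.1#-homo (multiple-root (h , P.refl))) (L.+-identityʳ _))))))

      lift-isHom : IsFieldHom quotientField L lift
      lift-isHom = isHom quotientRing L.commutativeRing lift
        (λ {p} {r} (differ-by h eq) → L.trans (H.cong eq) (L.trans (H.+-homo r (f *ₚ h))
          (L.trans (L.+-congˡ (multiple-root (h , P.refl))) (L.+-identityʳ _))))
        H.+-homo H.*-homo H.1#-homo

      lift-const : ∀ c → lift (const c) L.≈ ι c
      lift-const c = EL.eval-const α (ι c)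

      lift-X : lift X L.≈ α
      lift-X = L.trans (L.+-cong ι.0#-homo (L.*-congˡ (L.trans (EL.eval-const α (ι 1#)) ι.1#-homo)))
          (L.trans (L.+-identityˡ _) (L.*-identityʳ α))
        where module ι = Hom commutativeRing L.commutativeRing ι ι-hom

-- Conjugates and minimal polynomials

module FrobeniusField (K : Field) (q : ℕ) (card : HasCardinality K q) (E : Field)
                      (_≟_ : ∀ x y → Dec (Field._≈_ E x y)) (ι : Field.Carrier K → Field.Carrier E) (ι-hom : IsFieldHom K E ι) where
  private
    module K = Field K
    module PK = Poly K.commutativeRing
    module KX = PolyRing K.commutativeRing
    module DK = Degree K.commutativeRing
    module FK = FiniteField K q card
    module KP = FieldPoly K FK._≟_
    module ι = Hom K.commutativeRing (Field.commutativeRing E) ι ι-hom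
    module M = MapPoly K.commutativeRing (Field.commutativeRing E) ι ι-hom
  open Field E hiding (zero)
  open Poly commutativeRing
  open PolyRing commutativeRing
  open Degree commutativeRing
  open FieldProperties E
  open ListProduct commutativeRing
  open Powers commutativeRing
  open Eval commutativeRing
  open Frobenius K q card commutativeRing ι ι-hom
  private
    module P = CommutativeRing polyRing
    module σ = Hom commutativeRing commutativeRing (λ y → pow y q) frobenius-isHom
  open ≈-Reasoning setoid

  ι-injective : ∀ {x y} → ι x ≈ ι y → x K.≈ y
  ι-injective = field-hom-injective K E FK._≟_ ι ι-hom

  map-ι-injective : ∀ {p r} → map ι p ≋ map ι r → p KX.≋ r
  map-ι-injective = M.map-injective ι-injective

  zero-factor : ∀ {A : Set} (F : A → Carrier) as → ∏ (map F as) ≈ 0# → ∃ λ a → F a ≈ 0#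
  zero-factor F []       1≈0 = ⊥-elim (0≉1 (sym 1≈0))
  zero-factor F (a ∷ as) eq with F a ≟ 0#
  ... | yes Fa≈0 = a , Fa≈0
  ... | no Fa≉0  = zero-factor F as (nonzero-regular Fa≉0 _ eq)

  -- The product of all c - a with a in `K` is c^q - c = 0, and decidable equality locates a
  -- vanishing factor.
  fixed⇒image : ∀ {c} → pow c q ≈ c → ∃ λ a → ι a ≈ c
  fixed⇒image {c} fixed =
    let (a , eq) = zero-factor (λ a → c - ι a) FK.elements (trans (sym (X^q-X-product c)) (x≈y⇒x∙y⁻¹≈ε fixed))
    in a , sym (x∙y⁻¹≈ε⇒x≈y c (ι a) eq)

  fixed⇒descends : ∀ p → map (λ y → pow y q) p ≋ p → ∃ λ p₀ → map ι p₀ ≋ p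
  fixed⇒descends []      eq = [] , ≋-refl
  fixed⇒descends (a ∷ p) eq =
    let (a₀ , a-eq) = fixed⇒image (coeff-eq eq 0)
        (p₀ , p-eq) = fixed⇒descends p (∷-tail eq)
    in a₀ ∷ p₀ , ∷-cong a-eq p-eq

  pow-q^suc : ∀ y i → pow y (q ℕ.^ suc i) ≈ pow (pow y q) (q ℕ.^ i)
  pow-q^suc y i = pow-* y q (q ℕ.^ i)

  pow-q^+ : ∀ y i j → pow y (q ℕ.^ (i ℕ.+ j)) ≈ pow (pow y (q ℕ.^ i)) (q ℕ.^ j)
  pow-q^+ y i j = trans (pow-≡ y (ℕₚ.^-distribˡ-+-* q i j)) (pow-* y (q ℕ.^ i) (q ℕ.^ j))

  -- By additivity a coincidence of q-th powers makes (y - z)^q zero.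
  frobenius-injective : ∀ i {y z} → pow y (q ℕ.^ i) ≈ pow z (q ℕ.^ i) → y ≈ z
  frobenius-injective zero    {y} {z} eq = trans (sym (pow-1 y)) (trans eq (pow-1 z))
  frobenius-injective (suc i) {y} {z} eq = injective (frobenius-injective i
      (trans (sym (pow-q^suc y i)) (trans eq (pow-q^suc z i))))
    where
    injective : pow y q ≈ pow z q → y ≈ z
    injective eq with y ≟ z
    ... | yes y≈z = y≈z
    ... | no y≉z  = ⊥-elim (nonzero-pow q (λ y-z≈0 → y≉z (x∙y⁻¹≈ε⇒x≈y y z y-z≈0))
                      (trans (σ.minus-homo y z) (x≈y⇒x∙y⁻¹≈ε eq)))

  ι-pow-q^ : ∀ a i → pow (ι a) (q ℕ.^ i) ≈ ι a
  ι-pow-q^ a zero    = pow-1 (ι a)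
  ι-pow-q^ a (suc i) = trans (pow-q^suc (ι a) i) (trans (pow-cong (q ℕ.^ i) (ι-fixed a)) (ι-pow-q^ a i))

  conjugate-root : ∀ p i {y} → evalAt y p ≈ 0# → evalAt (pow y (q ℕ.^ i)) p ≈ 0#
  conjugate-root p zero    {y} root = trans (eval-congʳ (map ι p) (pow-1 y)) root
  conjugate-root p (suc i) {y} root = trans (eval-congʳ (map ι p) (pow-q^suc y i))
    (conjugate-root p i (trans (evalAt-frobenius p y) (trans (pow-cong q root) σ.0#-homo)))

  conjugates : Carrier → ℕ → List Carrier
  conjugates y k = applyUpTo (λ i → pow y (q ℕ.^ i)) k

  conjugateProduct : Carrier → ℕ → Pol
  conjugateProduct y k = prodₚ (map linear (conjugates y k))

  conjugateProduct-monic : ∀ y k → MonicOfDegree (conjugateProduct y k) k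
  conjugateProduct-monic y k = ≡.subst (MonicOfDegree (conjugateProduct y k)) (length-applyUpTo _ k)
      (monic-linears (conjugates y k))

  linear-cong : ∀ {a b} → a ≈ b → linear a ≋ linear b
  linear-cong eq = ∷-cong (-‿cong eq) ≋-refl

  private
    ∏-last : ∀ (F : ℕ → Pol) k → F 0 *ₚ prodₚ (applyUpTo (F ∘ suc) k) ≋ prodₚ (applyUpTo F k) *ₚ F k
    ∏-last F zero    = P.*-comm (F 0) 1ₚ
    ∏-last F (suc k) = P.trans (P.*-congˡ {F 0} (∏-last (F ∘ suc) k)) (P.sym
        (P.*-assoc (F 0) (prodₚ (applyUpTo (F ∘ suc) k)) (F (suc k))))

    ∏-applyUpTo-cong : ∀ {F G : ℕ → Pol} k → (∀ i → F i ≋ G i) → prodₚ (applyUpTo F k) ≋ prodₚ (applyUpTo G k)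
    ∏-applyUpTo-cong zero    eq = ≋-refl
    ∏-applyUpTo-cong (suc k) eq = P.*-cong (eq 0) (∏-applyUpTo-cong k (eq ∘ suc))

  module _ (y : Carrier) (k : ℕ) (0<k : 0 < k) (periodic : pow y (q ℕ.^ k) ≈ y) where
    private
      F : ℕ → Pol
      F i = linear (pow y (q ℕ.^ i))

      product≋ : conjugateProduct y k ≋ prodₚ (applyUpTo F k)
      product≋ = P.reflexive (≡.cong prodₚ (map-applyUpTo (λ i → pow y (q ℕ.^ i)) linear k))

      -- Frobenius turns each linear factor into the next one; the periodicity identifies the last
      -- with the first.
      rotate : ∀ k → 0 < k → pow y (q ℕ.^ k) ≈ y → prodₚ (applyUpTo (F ∘ suc) k) ≋ prodₚ (applyUpTo F k)
      rotate (suc k) _ periodic = P.trans (∏-last (F ∘ suc) k)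
        (P.trans (P.*-comm (prodₚ (applyUpTo (F ∘ suc) k)) (F (suc k)))
          (P.*-congʳ {prodₚ (applyUpTo (F ∘ suc) k)} (linear-cong (trans periodic (sym (pow-1 y))))))

      module Mσ = MapPoly commutativeRing commutativeRing (λ y → pow y q) frobenius-isHom

      fixed : map (λ z → pow z q) (conjugateProduct y k) ≋ conjugateProduct y k
      fixed = P.trans (∏-homo polyRing polyRing (map (λ z → pow z q)) Mσ.map-isHom linear (conjugates y k)) (P.trans
        (P.reflexive (≡.cong prodₚ (map-applyUpTo (λ i → pow y (q ℕ.^ i)) (map (λ z → pow z q) ∘ linear) k))) (P.trans
        (∏-applyUpTo-cong k (λ i → P.trans (Mσ.map-linear (pow y (q ℕ.^ i)))
          (linear-cong (trans (sym (pow-* y (q ℕ.^ i) q)) (pow-≡ y (ℕₚ.*-comm (q ℕ.^ i) q))))))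
        (P.trans (rotate k 0<k periodic) (P.sym product≋))))

    abstract
      -- Any period `k` of `y` is allowed, not only the least, so this may be a proper power of the
      -- minimal polynomial. Being monic of degree `k` over `K` with root `y` is all that the bound
      -- on periods needs; it is the minimal polynomial once the conjugates are distinct.
      minimal : PK.Pol
      minimal = proj₁ (fixed⇒descends (conjugateProduct y k) fixed)

      map-minimal : map ι minimal ≋ conjugateProduct y k
      map-minimal = proj₂ (fixed⇒descends (conjugateProduct y k) fixed)

    minimal-monic : PK.MonicOfDegree minimal k
    minimal-monic =
      let (lead , deg) = monic-cong (P.sym map-minimal) (conjugateProduct-monic y k) in
      ι-injective (trans (sym (M.coeff-map minimal k)) (trans lead (sym ι.1#-homo))) ,
      λ i k<i → ι-injective (trans (sym (M.coeff-map minimal i)) (trans (deg i k<i) (sym ι.0#-homo)))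

    minimal-root : evalAt y minimal ≈ 0#
    minimal-root = trans (eval-cong y map-minimal) (head-root k 0<k)
      where
      head-root : ∀ k → 0 < k → eval (conjugateProduct y k) y ≈ 0#
      head-root (suc k) _ = trans (eval-congʳ (conjugateProduct y (suc k)) (sym (pow-1 y)))
        (All.head (eval-linears-zero (conjugates y (suc k))))

    module _ (distinct : ∀ {i j} → i < j → j < k → ¬ pow y (q ℕ.^ j) ≈ pow y (q ℕ.^ i)) where
      conjugates-separated : Separated (conjugates y k)
      conjugates-separated = AllPairs.applyUpTo⁺₁ _ k (λ i<j j<k → difference-regular (distinct i<j j<k))

      -- The remainder of `p` has degree below `k` but vanishes at `k` distinct conjugates.
      minimal-divides : ∀ p → evalAt y p ≈ 0# → ∃ λ h → p KX.≋ minimal PK.*ₚ h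
      minimal-divides p root = Q , PKX.trans p≋ (PKX.trans (PKX.+-congˡ {minimal PK.*ₚ Q} S≋[]) (PKX.+-identityʳ _))
        where
        open DK.DivMod (DK.divMod {minimal} minimal-monic p)
          using () renaming (quotient to Q; remainder to S; division to p≋; remainder-small to S-small)
        module PKX = CommutativeRing KX.polyRing
        module ev = Hom KX.polyRing commutativeRing (evalAt y) (evalAt-isHom y)
        S-root : evalAt y S ≈ 0#
        S-root = begin
          evalAt y S  ≈⟨ +-identityˡ _ ⟨
          0# + evalAt y S  ≈⟨ +-congʳ (evalAt-multiple {y} {minimal} minimal-root (Q , PKX.refl)) ⟨
          evalAt y (minimal PK.*ₚ Q) + evalAt y S  ≈⟨ ev.+-homo (minimal PK.*ₚ Q) S ⟨
          evalAt y (minimal PK.*ₚ Q PK.+ₚ S)  ≈⟨ ev.cong p≋ ⟨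
          evalAt y p  ≈⟨ root ⟩
          0#  ∎
        S≋[] : S KX.≋ []
        S≋[] = map-ι-injective (too-many-roots (conjugates y k) conjugates-separated (map ι S)
          (All.applyUpTo⁺₂ _ k (λ i → conjugate-root S i S-root))
          (≡.subst (Deg< (map ι S)) (≡.sym (length-applyUpTo _ k))
            (λ i k≤i → trans (M.coeff-map S i) (trans (ι.cong (S-small i k≤i)) ι.0#-homo))))

  map-monic : ∀ {p k} → PK.MonicOfDegree p k → MonicOfDegree (map ι p) k
  map-monic {p} {k} (lead , deg) =
    trans (M.coeff-map p k) (trans (ι.cong lead) ι.1#-homo) ,
    λ i k<i → trans (M.coeff-map p i) (trans (ι.cong (deg i k<i)) ι.0#-homo)

  -- The D + 1 conjugates of a root of a polynomial of degree D cannot be distinct.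
  small-period : ∀ {f D y} → PK.MonicOfDegree f D → evalAt y f ≈ 0# → ∃ λ j → 0 < j × j ≤ D × pow y (q ℕ.^ j) ≈ y
  small-period {f} {D} {y} monic root
    with Finₚ.any? {suc D} (λ i → Finₚ.any? {suc D} (λ j → (toℕ i ℕₚ.<? toℕ j) ×-dec (pow y (q ℕ.^ toℕ j) ≟ pow y (q ℕ.^ toℕ i))))
  ... | yes (i , j , i<j , eq) = toℕ j ℕ.∸ toℕ i , ℕₚ.m<n⇒0<n∸m i<j , ℕₚ.≤-trans (ℕₚ.m∸n≤m (toℕ j) (toℕ i))
      (ℕₚ.≤-pred (Finₚ.toℕ<n j)) ,
        frobenius-injective (toℕ i) (trans (sym (pow-q^+ y (toℕ j ℕ.∸ toℕ i) (toℕ i)))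
            (trans (pow-≡ y (≡.cong (q ℕ.^_) (ℕₚ.m∸n+n≡m (ℕₚ.<⇒≤ i<j)))) eq))
  ... | no none = ⊥-elim (0≉1 (sym (trans (sym (proj₁ (map-monic {f} monic))) (coeff-eq f≋[] D))))
    where
    distinct : ∀ {i j} → i < j → j < suc D → ¬ pow y (q ℕ.^ j) ≈ pow y (q ℕ.^ i)
    distinct {i} {j} i<j j<D eq = none (Fin.fromℕ< i<D , Fin.fromℕ< j<D ,
      ≡.subst₂ _<_ (≡.sym (Finₚ.toℕ-fromℕ< i<D)) (≡.sym (Finₚ.toℕ-fromℕ< j<D)) i<j ,
      trans (pow-≡ y (≡.cong (q ℕ.^_) (Finₚ.toℕ-fromℕ< j<D))) (trans eq
          (pow-≡ y (≡.cong (q ℕ.^_) (≡.sym (Finₚ.toℕ-fromℕ< i<D))))))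
      where i<D = ℕₚ.<-trans i<j j<D
    f≋[] : map ι f ≋ []
    f≋[] = too-many-roots (conjugates y (suc D)) (AllPairs.applyUpTo⁺₁ _ (suc D)
        (λ i<j j<D → difference-regular (distinct i<j j<D)))
      (map ι f) (All.applyUpTo⁺₂ _ (suc D) (λ i → conjugate-root f i root))
      (≡.subst (Deg< (map ι f)) (≡.sym (length-applyUpTo (λ i → pow y (q ℕ.^ i)) (suc D))) (proj₂ (map-monic {f} monic)))

  module Root (f : PK.Pol) (D : ℕ) (monic-f : PK.MonicOfDegree f D) (irreducible : PK.Irreducible f)
              (ξ : Carrier) (root : evalAt ξ f ≈ 0#) where
    private
      module Mod = KP.Modulus f D monic-f irreducible
      module Lift = Mod.Lift E ι ι-hom ξ root
    open Mod public using (0<D)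

    -- A period j yields a monic polynomial over `K` of degree j with root ξ, and the irreducible
    -- `f` divides it.
    period-bound : ∀ {j} → 0 < j → pow ξ (q ℕ.^ j) ≈ ξ → D ≤ j
    period-bound {j} 0<j periodic =
      let (h , eq) = Lift.root⇒multiple (minimal ξ j 0<j periodic) (minimal-root ξ j 0<j periodic)
      in KP.monic-multiple-degree {f} {minimal ξ j 0<j periodic} {h = h} monic-f (minimal-monic ξ j 0<j periodic) eq

    period : pow ξ (q ℕ.^ D) ≈ ξ
    period = let (j , 0<j , j≤D , eq) = small-period {f} monic-f root in
      ≡.subst (λ j → pow ξ (q ℕ.^ j) ≈ ξ) (ℕₚ.≤-antisym j≤D (period-bound 0<j eq)) eq

    period-divides : ∀ M → pow ξ (q ℕ.^ M) ≈ ξ → D ∣ M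
    period-divides M = go M (<-wellFounded M)
      where
      go : ∀ M → Acc _<_ M → pow ξ (q ℕ.^ M) ≈ ξ → D ∣ M
      go zero      _         _  = D ∣0
      go M@(suc _) (acc rec) eq = ≡.subst (D ∣_) (ℕₚ.m+[n∸m]≡n D≤M) (∣m∣n⇒∣m+n ∣-refl
          (go (M ℕ.∸ D) (rec (ℕₚ.∸-monoʳ-< 0<D D≤M))
            (trans (pow-cong (q ℕ.^ (M ℕ.∸ D)) (sym period)) (trans (sym (pow-q^+ ξ D (M ℕ.∸ D)))
                (trans (pow-≡ ξ (≡.cong (q ℕ.^_) (ℕₚ.m+[n∸m]≡n D≤M))) eq)))))
        where D≤M = period-bound (s≤s z≤n) eq

    conjugates-distinct : ∀ {i j} → i < j → j < D → ¬ pow ξ (q ℕ.^ j) ≈ pow ξ (q ℕ.^ i)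
    conjugates-distinct {i} {j} i<j j<D eq = ℕₚ.<⇒≱ (ℕₚ.≤-<-trans (ℕₚ.m∸n≤m j i) j<D)
      (period-bound (ℕₚ.m<n⇒0<n∸m i<j) (frobenius-injective i
        (trans (sym (pow-q^+ ξ (j ℕ.∸ i) i)) (trans (pow-≡ ξ (≡.cong (q ℕ.^_) (ℕₚ.m∸n+n≡m (ℕₚ.<⇒≤ i<j)))) eq))))

    f-factors : map ι f ≋ conjugateProduct ξ D
    f-factors = monic≋linears (conjugates ξ D)
      (conjugates-separated ξ D 0<D period conjugates-distinct) (map ι f)
      (≡.subst (MonicOfDegree (map ι f)) (≡.sym (length-applyUpTo _ D)) (map-monic {f} monic-f))
      (All.applyUpTo⁺₂ _ D (λ i → conjugate-root f i root))

-- Divisibility and multiplicative orders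

prime-divisor : ∀ n → 1 < n → ∃ λ p → Prime p × p ∣ n
prime-divisor n@(suc _) 1<n with factorise n
... | record { factors = [] ; isFactorisation = n≡1 } = ⊥-elim (ℕₚ.<-irrefl (≡.sym n≡1) 1<n)
... | record { factors = p ∷ ps ; isFactorisation = n≡ ; factorsPrime = pr ∷ _ } =
      p , pr , ≡.subst (p ∣_) (≡.sym n≡) (m∣m*n (product ps))

prime>0 : ∀ {p} → Prime p → 0 < p
prime>0 {p} pr = ℕ.>-nonZero⁻¹ p {{prime⇒nonZero pr}}

prime∤1 : ∀ {p} → Prime p → ¬ p ∣ 1
prime∤1 pr p∣1 with ∣1⇒≡1 p∣1
... | ≡.refl = ¬prime[1] pr

coprime-by-primes : ∀ {m n} → 0 < n → (∀ p → Prime p → p ∣ m → p ∣ n → ⊥) → Coprime m n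
coprime-by-primes {m} {n} 0<n none {i} (i∣m , i∣n) with i ℕ.≟ 0 | i ℕ.≟ 1
... | _          | yes i≡1 = i≡1
... | yes ≡.refl | _       = ⊥-elim (ℕₚ.<-irrefl (≡.sym (0∣⇒≡0 i∣n)) 0<n)
... | no i≢0     | no i≢1  =
      let (p , pr , p∣i) = prime-divisor i (ℕₚ.≤∧≢⇒< (ℕₚ.n≢0⇒n>0 i≢0) (i≢1 ∘ ≡.sym))
      in ⊥-elim (none p pr (∣-trans p∣i i∣m) (∣-trans p∣i i∣n))

prime-∣-prime : ∀ {p ℓ} → Prime p → Prime ℓ → p ∣ ℓ → p ≡ ℓ
prime-∣-prime {p} prime-p prime-ℓ p∣ℓ with prime⇒irreducible prime-ℓ p∣ℓ
... | inj₁ ≡.refl = ⊥-elim (¬prime[1] prime-p)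
... | inj₂ p≡ℓ    = p≡ℓ

geometric : ℕ → ℕ → ℕ
geometric q zero    = 0
geometric q (suc n) = 1 ℕ.+ q ℕ.* geometric q n

-- The binomial coefficient n (n - 1) / 2, free of division.
triangle : ℕ → ℕ
triangle zero    = 0
triangle (suc n) = n ℕ.+ triangle n

2*triangle : ∀ n → 2 ℕ.* triangle n ℕ.+ n ≡ n ℕ.* n
2*triangle zero    = ≡.refl
2*triangle (suc n) = ≡.trans (rearrange n (triangle n)) (≡.trans (≡.cong (λ x → x ℕ.+ (n ℕ.+ suc n)) (2*triangle n)) (square n))
  where
  rearrange : ∀ n t → 2 ℕ.* (n ℕ.+ t) ℕ.+ suc n ≡ (2 ℕ.* t ℕ.+ n) ℕ.+ (n ℕ.+ suc n)
  rearrange = solve-∀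
  square : ∀ n → n ℕ.* n ℕ.+ (n ℕ.+ suc n) ≡ suc n ℕ.* suc n
  square = solve-∀

-- The binomial expansion of ((1 + c)^n - 1) / c modulo c². The linear term is kept because
-- `geometric-prime` has to know the sum of length ℓ beyond its first factor ℓ.
geometric-expansion : ∀ c n → ∃ λ y → geometric (suc c) n ≡ n ℕ.+ c ℕ.* triangle n ℕ.+ c ℕ.* c ℕ.* y
geometric-expansion c zero    = 0 , ≡.sym (≡.cong₂ ℕ._+_ (ℕₚ.*-zeroʳ c) (ℕₚ.*-zeroʳ (c ℕ.* c)))
geometric-expansion c (suc n) = let (y , eq) = geometric-expansion c n in
  triangle n ℕ.+ suc c ℕ.* y , ≡.trans (≡.cong (λ g → 1 ℕ.+ suc c ℕ.* g) eq) (step c n (triangle n) y)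
  where
  step : ∀ c n t y → 1 ℕ.+ suc c ℕ.* (n ℕ.+ c ℕ.* t ℕ.+ c ℕ.* c ℕ.* y) ≡
                     suc n ℕ.+ c ℕ.* (n ℕ.+ t) ℕ.+ c ℕ.* c ℕ.* (t ℕ.+ suc c ℕ.* y)
  step = solve-∀

geometric-power : ∀ c n → suc (c ℕ.* geometric (suc c) n) ≡ suc c ℕ.^ n
geometric-power c zero    = ≡.cong suc (ℕₚ.*-zeroʳ c)
geometric-power c (suc n) = ≡.trans (step c (geometric (suc c) n)) (≡.cong (suc c ℕ.*_) (geometric-power c n))
  where
  step : ∀ c g → suc (c ℕ.* (1 ℕ.+ suc c ℕ.* g)) ≡ suc c ℕ.* suc (c ℕ.* g)
  step = solve-∀

geometric-+ : ∀ q m n → geometric q (m ℕ.+ n) ≡ geometric q m ℕ.+ q ℕ.^ m ℕ.* geometric q n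
geometric-+ q zero    n = ≡.sym (ℕₚ.+-identityʳ _)
geometric-+ q (suc m) n = ≡.trans (≡.cong (λ g → 1 ℕ.+ q ℕ.* g) (geometric-+ q m n))
    (step q (geometric q m) (q ℕ.^ m) (geometric q n))
  where
  step : ∀ q g p h → 1 ℕ.+ q ℕ.* (g ℕ.+ p ℕ.* h) ≡ (1 ℕ.+ q ℕ.* g) ℕ.+ q ℕ.* p ℕ.* h
  step = solve-∀

geometric-* : ∀ q m n → geometric q (m ℕ.* n) ≡ geometric q n ℕ.* geometric (q ℕ.^ n) m
geometric-* q zero    n = ≡.sym (ℕₚ.*-zeroʳ (geometric q n))
geometric-* q (suc m) n = ≡.trans (geometric-+ q n (m ℕ.* n)) (≡.trans
    (≡.cong (λ g → geometric q n ℕ.+ q ℕ.^ n ℕ.* g) (geometric-* q m n))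
  (step (geometric q n) (q ℕ.^ n) (geometric (q ℕ.^ n) m)))
  where
  step : ∀ g p h → g ℕ.+ p ℕ.* (g ℕ.* h) ≡ g ℕ.* (1 ℕ.+ p ℕ.* h)
  step = solve-∀

-- Modulo ℓ every power of 1 + c is 1, so the sum of D of them is D.
prime∣geometric⇒∣ : ∀ {ℓ c D} → ℓ ∣ c → ℓ ∣ geometric (suc c) D → ℓ ∣ D
prime∣geometric⇒∣ {ℓ} {c} {D} ℓ∣c ℓ∣g = let (y , eq) = geometric-expansion c D in
  ∣m+n∣m⇒∣n (≡.subst (ℓ ∣_) (≡.trans eq (rearrange c D (triangle D) y)) ℓ∣g) (∣-trans ℓ∣c (m∣m*n _))
  where
  rearrange : ∀ c D t y → D ℕ.+ c ℕ.* t ℕ.+ c ℕ.* c ℕ.* y ≡ c ℕ.* (t ℕ.+ c ℕ.* y) ℕ.+ D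
  rearrange = solve-∀

-- For a prime ℓ dividing q - 1 the quotient v = (1 + q + ... + q^(ℓ-1)) / ℓ is 1 modulo (q - 1)/ℓ, and also modulo ℓ
-- unless ℓ = 2 and q is 3 modulo 4.
geometric-prime : ∀ {ℓ c t} → Prime ℓ → ℓ ∣ c → 0 < t → (∀ p → Prime p → p ∣ t → p ∣ c) → (ℓ ≡ 2 → 2 ∣ t → 4 ∣ c) →
                  ∃ λ v → geometric (suc c) ℓ ≡ ℓ ℕ.* v × Coprime t v
geometric-prime {ℓ} {c} {t} prime-ℓ (divides c′ ≡.refl) 0<t radical four = v , geometric≡ , λ {i} (i∣t , i∣v) → coprime
    (i∣v , i∣t)
  where
  T = triangle ℓ
  y = proj₁ (geometric-expansion c ℓ)
  v = c′ ℕ.* (T ℕ.+ ℓ ℕ.* c′ ℕ.* y) ℕ.+ 1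
  geometric≡ : geometric (suc c) ℓ ≡ ℓ ℕ.* v
  geometric≡ = ≡.trans (proj₂ (geometric-expansion c ℓ)) (step ℓ c′ T y)
    where
    step : ∀ ℓ c t y → ℓ ℕ.+ (c ℕ.* ℓ) ℕ.* t ℕ.+ (c ℕ.* ℓ) ℕ.* (c ℕ.* ℓ) ℕ.* y ≡ ℓ ℕ.* (c ℕ.* (t ℕ.+ ℓ ℕ.* c ℕ.* y) ℕ.+ 1)
    step = solve-∀

  coprime : Coprime v t
  coprime = coprime-by-primes 0<t no-common-prime
    where
    not-both : ∀ {p} → Prime p → p ∣ v → ¬ p ∣ c′ ℕ.* (T ℕ.+ ℓ ℕ.* c′ ℕ.* y)
    not-both pr p∣v p∣ = prime∤1 pr (∣m+n∣m⇒∣n p∣v p∣)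
    no-common-prime : ∀ p → Prime p → p ∣ v → p ∣ t → ⊥
    no-common-prime p pr p∣v p∣t with euclidsLemma c′ ℓ pr (radical p pr p∣t)
    ... | inj₁ p∣c′ = not-both pr p∣v (∣m⇒∣m*n _ p∣c′)
    ... | inj₂ p∣ℓ with prime-∣-prime pr prime-ℓ p∣ℓ
    -- The common prime is now ℓ itself. From 2 T + ℓ = ℓ² it divides 2 T, hence T when ℓ is odd;
    -- for ℓ = 2 the hypothesis `four` makes c′ even instead. Either way ℓ divides v - 1.
    ...   | ≡.refl with euclidsLemma 2 T prime-ℓ (∣m+n∣m⇒∣n (≡.subst (ℓ ∣_)
        (≡.trans (≡.sym (2*triangle ℓ)) (ℕₚ.+-comm (2 ℕ.* T) ℓ)) (m∣m*n ℓ)) ∣-refl)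
    ...     | inj₂ ℓ∣T = not-both pr p∣v (∣n⇒∣m*n c′ (∣m∣n⇒∣m+n ℓ∣T (∣m⇒∣m*n y (m∣m*n c′))))
    ...     | inj₁ ℓ∣2 with prime-∣-prime prime-ℓ prime[2] ℓ∣2
    ...       | ≡.refl = not-both pr p∣v (∣m⇒∣m*n _ (2∣c′ (four ≡.refl p∣t)))
            where
            2∣c′ : 4 ∣ c′ ℕ.* 2 → 2 ∣ c′
            2∣c′ = *-cancelʳ-∣ 2

-- Peel a prime ℓ off both `t` and `D`. The sum of length D′ ℓ at q is the sum of length ℓ at q
-- times the sum of length D′ at q^ℓ, and the first factor is ℓ times a number prime to t′. What is
-- left is the same claim for t′, q^ℓ and D′.
∣geometric⇒∣ : ∀ t c D → 0 < t → (∀ p → Prime p → p ∣ t → p ∣ c) → (4 ∣ t → 4 ∣ c) → t ∣ geometric (suc c) D → t ∣ D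
∣geometric⇒∣ t = go t (<-wellFounded t)
  where
  go : ∀ t → Acc _<_ t → ∀ c D → 0 < t → (∀ p → Prime p → p ∣ t → p ∣ c) → (4 ∣ t → 4 ∣ c) → t ∣ geometric (suc c) D → t ∣ D
  go t (acc rec) c D 0<t radical four t∣g with t ℕ.≟ 1
  ... | yes ≡.refl = 1∣ D
  ... | no t≢1 with prime-divisor t (ℕₚ.≤∧≢⇒< 0<t (t≢1 ∘ ≡.sym))
  ...   | ℓ , prime-ℓ , divides t′ ≡.refl with prime∣geometric⇒∣ {ℓ} {c} {D} (radical ℓ prime-ℓ (n∣m*n t′))
      (∣-trans (n∣m*n t′) t∣g)
  -- The new `c` is q^ℓ - 1, kept as a multiple of the old one so that the hypotheses on primes and
  -- on 4 carry over.
  ...     | divides D′ ≡.refl = *-monoˡ-∣ ℓ (go t′ (rec t′<t) (c ℕ.* geometric (suc c) ℓ) D′ 0<t′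
              (λ p pr p∣t′ → ∣m⇒∣m*n _ (radical p pr (∣m⇒∣m*n ℓ p∣t′)))
              (λ 4∣t′ → ∣m⇒∣m*n _ (four (∣m⇒∣m*n ℓ 4∣t′)))
              t′∣g′)
    where
    0<t′ : 0 < t′
    0<t′ = ℕₚ.n≢0⇒n>0 λ { ≡.refl → ℕₚ.<-irrefl ≡.refl 0<t }
    instance
      ℓ-nonZero : ℕ.NonZero ℓ
      ℓ-nonZero = prime⇒nonZero prime-ℓ
      t′-nonZero : ℕ.NonZero t′
      t′-nonZero = ℕ.>-nonZero 0<t′
    t′<t : t′ < t′ ℕ.* ℓ
    t′<t = ℕₚ.m<m*n t′ ℓ (ℕ.nonTrivial⇒n>1 ℓ {{prime⇒nonTrivial prime-ℓ}})
    quotient-properties = geometric-prime {ℓ} {c} {t′} prime-ℓ (radical ℓ prime-ℓ (n∣m*n t′)) 0<t′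
      (λ p pr p∣t′ → radical p pr (∣m⇒∣m*n ℓ p∣t′))
      (λ { ≡.refl 2∣t′ → four (*-monoˡ-∣ 2 2∣t′) })
    v = proj₁ quotient-properties
    t′∣g′ : t′ ∣ geometric (suc (c ℕ.* geometric (suc c) ℓ)) D′
    t′∣g′ = ≡.subst (λ q → t′ ∣ geometric q D′) (≡.sym (geometric-power c ℓ))
      (coprime-divisor (proj₂ (proj₂ quotient-properties)) (*-cancelʳ-∣ ℓ
          (≡.subst (t′ ℕ.* ℓ ∣_) (≡.trans (geometric-* (suc c) D′ ℓ)
        (≡.trans (≡.cong (ℕ._* geometric (suc c ℕ.^ ℓ) D′) (proj₁ (proj₂ quotient-properties))) (rearrange ℓ v _))) t∣g)))
      where
      rearrange : ∀ ℓ v g → ℓ ℕ.* v ℕ.* g ≡ v ℕ.* g ℕ.* ℓ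
      rearrange = solve-∀

module Orders (R : CRing) where
  open CommutativeRing R hiding (zero)
  open Poly R using (pow)
  open Powers R

  pow-coprime : ∀ x {a b} → Coprime a b → pow x a ≈ 1# → pow x b ≈ 1# → pow x 1 ≈ 1#
  pow-coprime x {a} {b} coprime xᵃ≈1 xᵇ≈1 with coprime-Bézout coprime
  ... | +- i j eq = trans (sym (trans (pow-≡ x (≡.sym eq)) (trans (pow-+ x 1 (j ℕ.* b))
      (trans (*-congˡ (trans (pow-≡ x (ℕₚ.*-comm j b)) (pow-trivial x b j xᵇ≈1))) (*-identityʳ _)))))
                      (trans (pow-≡ x (ℕₚ.*-comm i a)) (pow-trivial x a i xᵃ≈1))
  ... | -+ i j eq = trans (sym (trans (pow-≡ x (≡.sym eq)) (trans (pow-+ x 1 (i ℕ.* a))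
      (trans (*-congˡ (trans (pow-≡ x (ℕₚ.*-comm i a)) (pow-trivial x a i xᵃ≈1))) (*-identityʳ _)))))
                      (trans (pow-≡ x (ℕₚ.*-comm j b)) (pow-trivial x b j xᵇ≈1))

  HasMultiplicativeOrder : Carrier → ℕ → Set
  HasMultiplicativeOrder x d = 0 < d × pow x d ≈ 1# × (∀ j → 0 < j → j < d → ¬ pow x j ≈ 1#)

  order-divides : ∀ {x d} → HasMultiplicativeOrder x d → ∀ j → pow x j ≈ 1# → d ∣ j
  order-divides {x} {d} (0<d , xᵈ≈1 , minimal) j eq = go j (<-wellFounded j) eq
    where
    go : ∀ j → Acc _<_ j → pow x j ≈ 1# → d ∣ j
    go zero      _         _  = d ∣0
    go j@(suc _) (acc rec) eq with j ℕₚ.<? d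
    ... | yes j<d = ⊥-elim (minimal j (s≤s z≤n) j<d eq)
    ... | no j≮d  = ≡.subst (d ∣_) (ℕₚ.m+[n∸m]≡n d≤j) (∣m∣n⇒∣m+n ∣-refl (go (j ℕ.∸ d) (rec (ℕₚ.∸-monoʳ-< 0<d d≤j)) remainder))
      where
      d≤j = ℕₚ.≮⇒≥ j≮d
      remainder : pow x (j ℕ.∸ d) ≈ 1#
      remainder = trans (sym (*-identityˡ _)) (trans (*-congʳ (sym xᵈ≈1))
          (trans (sym (pow-+ x d (j ℕ.∸ d))) (trans (pow-≡ x (ℕₚ.m+[n∸m]≡n d≤j)) eq)))

  -- With G = gcd(t, g), a prime ℓ dividing t / G would give θ^u an order dividing d / ℓ.
  order-constraint : ∀ {θ z d} t u c g → HasMultiplicativeOrder θ d → 0 < t →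
                     (∀ p → Prime p → p ∣ t → p ∣ d) → (∀ p → Prime p → p ∣ t → ¬ p ∣ u) → Coprime c t →
                     pow z t * pow θ u ≈ 1# → pow z (c ℕ.* d ℕ.* g) ≈ 1# → t ∣ g
  order-constraint {θ} {z} {d} t u c g order@(0<d , θᵈ≈1 , _) 0<t radical t⊥u c⊥t zt eq
    with gcd[m,n]∣m t g | gcd[m,n]∣n t g
  ... | divides t₁ t≡ | divides s g≡ with t₁ ℕ.≟ 1
  ...   | yes ≡.refl = ≡.subst (_∣ g) (≡.trans (≡.sym (ℕₚ.*-identityˡ _)) (≡.sym t≡)) (gcd[m,n]∣n t g)
  ...   | no t₁≢1 = ⊥-elim (contradiction (prime-divisor t₁ (ℕₚ.≤∧≢⇒< 0<t₁ (t₁≢1 ∘ ≡.sym))))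
    where
    G = gcd t g
    0<factor : ∀ {a b t} → 0 < t → t ≡ a ℕ.* b → 0 < a × 0 < b
    0<factor {zero}          0<t ≡.refl = ⊥-elim (ℕₚ.<-irrefl ≡.refl 0<t)
    0<factor {suc a} {zero}  0<t ≡.refl = ⊥-elim (ℕₚ.<-irrefl (≡.sym (ℕₚ.*-zeroʳ a)) 0<t)
    0<factor {suc a} {suc b} 0<t eq     = s≤s z≤n , s≤s z≤n
    0<t₁ = proj₁ (0<factor 0<t t≡)
    instance
      G-nonZero : ℕ.NonZero G
      G-nonZero = ℕ.>-nonZero (proj₂ (0<factor {t₁} 0<t t≡))

    t₁⊥s : Coprime t₁ s
    t₁⊥s = gcd≡1⇒coprime (ℕₚ.*-cancelˡ-≡ _ 1 G (≡.trans (c*gcd[m,n]≡gcd[cm,cn] G t₁ s)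
      (≡.trans (≡.cong₂ gcd (≡.trans (ℕₚ.*-comm G t₁) (≡.sym t≡)) (≡.trans (ℕₚ.*-comm G s) (≡.sym g≡)))
          (≡.sym (ℕₚ.*-identityʳ G)))))

    t₁⊥cs : Coprime t₁ (c ℕ.* s)
    t₁⊥cs {i} (i∣t₁ , i∣cs) = t₁⊥s (i∣t₁ , coprime-divisor (λ (j∣i , j∣c) → c⊥t
        (j∣c , ∣-trans j∣i (∣-trans i∣t₁ (divides G (≡.trans t≡ (ℕₚ.*-comm t₁ G)))))) i∣cs)

    -- The element z^(G d) becomes trivial when raised to t / G, because z^t is inverse to θ^u, and
    -- when raised to c g / G, by hypothesis. These exponents are coprime.
    y≈1 : pow z (G ℕ.* d) ≈ 1#
    y≈1 = trans (sym (pow-1 _)) (pow-coprime (pow z (G ℕ.* d)) t₁⊥cs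
      (trans (sym (pow-* z (G ℕ.* d) t₁)) (trans (pow-≡ z (≡.trans (shuffle₁ G d t₁) (≡.cong (ℕ._* d) (≡.sym t≡)))) z^td))
      (trans (sym (pow-* z (G ℕ.* d) (c ℕ.* s))) (trans (pow-≡ z (≡.trans (shuffle₂ G d c s)
          (≡.cong (c ℕ.* d ℕ.*_) (≡.sym g≡)))) eq)))
      where
      shuffle₁ : ∀ G d t → G ℕ.* d ℕ.* t ≡ t ℕ.* G ℕ.* d
      shuffle₁ = solve-∀
      shuffle₂ : ∀ G d c s → G ℕ.* d ℕ.* (c ℕ.* s) ≡ c ℕ.* d ℕ.* (s ℕ.* G)
      shuffle₂ = solve-∀
      z^td : pow z (t ℕ.* d) ≈ 1#
      z^td = trans (pow-* z t d) (trans (sym (*-identityʳ _)) (trans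
        (*-congˡ (sym (trans (sym (pow-* θ u d)) (trans (pow-≡ θ (ℕₚ.*-comm u d)) (pow-trivial θ d u θᵈ≈1)))))
        (trans (sym (pow-distrib (pow z t) (pow θ u) d)) (trans (pow-cong d zt) (pow-1# d)))))

    contradiction : (∃ λ ℓ → Prime ℓ × ℓ ∣ t₁) → ⊥
    contradiction (ℓ , pr , divides t₂ t₁≡) with radical ℓ pr ℓ∣t
      where
      ℓ∣t : ℓ ∣ t
      ℓ∣t = ≡.subst (ℓ ∣_) (≡.sym t≡) (∣m⇒∣m*n G (divides t₂ t₁≡))
    ... | divides d′ d≡ = t⊥u ℓ pr (≡.subst (ℓ ∣_) (≡.sym t≡) (∣m⇒∣m*n G (divides t₂ t₁≡))) ℓ∣u
      where
      -- Since ℓ divides t / G, the exponent t d / ℓ is a multiple of G d; raising the relation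
      -- between z and θ to d / ℓ therefore leaves only θ.
      θ^ud′ : pow θ (u ℕ.* d′) ≈ 1#
      θ^ud′ = trans (pow-* θ u d′) (trans (sym (*-identityˡ _)) (trans (*-congʳ (sym z^td′))
        (trans (sym (pow-distrib (pow z t) (pow θ u) d′)) (trans (pow-cong d′ zt) (pow-1# d′)))))
        where
        shuffle : ∀ t₂ ℓ G d′ → t₂ ℕ.* ℓ ℕ.* G ℕ.* d′ ≡ G ℕ.* (d′ ℕ.* ℓ) ℕ.* t₂
        shuffle = solve-∀
        exponent : t ℕ.* d′ ≡ G ℕ.* d ℕ.* t₂
        exponent = ≡.trans (≡.cong (ℕ._* d′) (≡.trans t≡ (≡.cong (ℕ._* G) t₁≡)))
            (≡.trans (shuffle t₂ ℓ G d′) (≡.cong (λ d → G ℕ.* d ℕ.* t₂) (≡.sym d≡)))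
        z^td′ : pow (pow z t) d′ ≈ 1#
        z^td′ = trans (sym (pow-* z t d′)) (trans (pow-≡ z exponent) (pow-trivial z (G ℕ.* d) t₂ y≈1))
      instance
        d′-nonZero : ℕ.NonZero d′
        d′-nonZero = ℕ.>-nonZero (proj₁ (0<factor {d′} {ℓ} 0<d d≡))
      ℓ∣u : ℓ ∣ u
      ℓ∣u = *-cancelʳ-∣ d′ (≡.subst (_∣ u ℕ.* d′) (≡.trans d≡ (ℕₚ.*-comm d′ ℓ)) (order-divides order (u ℕ.* d′) θ^ud′))

-- Products over divisors

-- Coprimality prime by prime, the form in which a prime is easily adjoined to `c` or dropped from
-- it.
AvoidsPrimes : ℕ → ℕ → Set
AvoidsPrimes u c = ∀ p → Prime p → p ∣ c → ¬ p ∣ u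

gcd≡1⇒avoids : ∀ {u c} → gcd u c ≡ 1 → AvoidsPrimes u c
gcd≡1⇒avoids {u} {c} eq p pr p∣c p∣u = prime∤1 pr (≡.subst (p ∣_) eq (gcd-greatest p∣u p∣c))

avoids⇒gcd≡1 : ∀ {u c} → 0 < c → AvoidsPrimes u c → gcd u c ≡ 1
avoids⇒gcd≡1 0<c avoids = coprime⇒gcd≡1 (coprime-by-primes 0<c (λ p pr p∣u p∣c → avoids p pr p∣c p∣u))

0<* : ∀ {a b} → 0 < a → 0 < b → 0 < a ℕ.* b
0<* (s≤s z≤n) (s≤s z≤n) = s≤s z≤n

-- For such t the product a t runs exactly over the divisors of a b with cofactor prime to `a`; each
-- prime of `a` must occur in t as often as in b.
CoprimeCofactor : ℕ → ℕ → ℕ → Set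
CoprimeCofactor b a t = ∃ λ s → b ≡ s ℕ.* t × gcd s a ≡ 1

coprimeCofactor? : ∀ b a t → 0 < t → Dec (CoprimeCofactor b a t)
coprimeCofactor? b a t 0<t with t ∣? b
... | no t∤b = no λ (s , eq , _) → t∤b (divides s eq)
... | yes (divides s eq) with gcd s a ℕ.≟ 1
...   | yes cop = yes (s , eq , cop)
...   | no ¬cop = no λ (s′ , eq′ , cop) → ¬cop (≡.subst (λ s → gcd s a ≡ 1)
                    (ℕₚ.*-cancelʳ-≡ s′ s t {{ℕ.>-nonZero 0<t}} (≡.trans (≡.sym eq′) eq)) cop)

cofactor? : ∀ b a i → Dec (CoprimeCofactor b a (suc i))
cofactor? b a i = coprimeCofactor? b a (suc i) (s≤s z≤n)

coprime? : ∀ u c → Dec (gcd u c ≡ 1)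
coprime? u c = gcd u c ℕ.≟ 1

module RangeProduct (R : CRing) where
  open CommutativeRing R hiding (zero)
  open ListProduct R
  open import Algebra.Properties.CommutativeSemigroup *-commutativeSemigroup using (interchange)
  open ≈-Reasoning setoid

  Π : ℕ → (ℕ → Carrier) → Carrier
  Π zero    F = 1#
  Π (suc N) F = Π N F * F N

  Π-cong : ∀ N {F G : ℕ → Carrier} → (∀ i → F i ≈ G i) → Π N F ≈ Π N G
  Π-cong zero    eq = refl
  Π-cong (suc N) eq = *-cong (Π-cong N eq) (eq N)

  Π-≡ : ∀ {M N} F → M ≡ N → Π M F ≈ Π N F
  Π-≡ F ≡.refl = refl

  Π-1 : ∀ N {F : ℕ → Carrier} → (∀ i → i < N → F i ≈ 1#) → Π N F ≈ 1#
  Π-1 zero    eq = refl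
  Π-1 (suc N) eq = trans (*-cong (Π-1 N (λ i i<N → eq i (ℕₚ.m≤n⇒m≤1+n i<N))) (eq N ℕₚ.≤-refl)) (*-identityˡ 1#)

  Π-distrib : ∀ N (F G : ℕ → Carrier) → Π N (λ i → F i * G i) ≈ Π N F * Π N G
  Π-distrib zero    F G = sym (*-identityˡ 1#)
  Π-distrib (suc N) F G = trans (*-congʳ (Π-distrib N F G)) (interchange _ _ _ _)

  Π-+ : ∀ M N F → Π (M ℕ.+ N) F ≈ Π M F * Π N (λ i → F (M ℕ.+ i))
  Π-+ M zero    F = trans (Π-≡ F (ℕₚ.+-identityʳ M)) (sym (*-identityʳ _))
  Π-+ M (suc N) F = trans (Π-≡ F (ℕₚ.+-suc M N)) (trans (*-congʳ (Π-+ M N F)) (*-assoc _ _ _))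

  Π-swap : ∀ M N (F : ℕ → ℕ → Carrier) → Π M (λ i → Π N (F i)) ≈ Π N (λ j → Π M (λ i → F i j))
  Π-swap zero    N F = sym (Π-1 N (λ _ _ → refl))
  Π-swap (suc M) N F = trans (*-congʳ (Π-swap M N F)) (sym (Π-distrib N _ (F M)))

  Π-blocks : ∀ M N F → Π (M ℕ.* N) F ≈ Π M (λ i → Π N (λ j → F (i ℕ.* N ℕ.+ j)))
  Π-blocks zero    N F = refl
  Π-blocks (suc M) N F = trans (Π-≡ F (ℕₚ.+-comm N (M ℕ.* N)))
    (trans (Π-+ (M ℕ.* N) N F) (*-congʳ (Π-blocks M N F)))

  Π-extend : ∀ M N {F : ℕ → Carrier} → M ≤ N → (∀ i → M ≤ i → F i ≈ 1#) → Π N F ≈ Π M F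
  Π-extend M N {F} M≤N eq = trans (Π-≡ F (≡.sym (ℕₚ.m+[n∸m]≡n M≤N))) (trans (Π-+ M (N ℕ.∸ M) F)
    (trans (*-congˡ (Π-1 (N ℕ.∸ M) (λ i _ → eq (M ℕ.+ i) (ℕₚ.m≤m+n M i)))) (*-identityʳ _)))

  -- Writing 1 for omitted factors keeps every product over a full interval, so that reindexing
  -- never involves filtered lists.
  when : ∀ {P : Set} → Dec P → Carrier → Carrier
  when (yes _) x = x
  when (no _)  x = 1#

  when-cong : ∀ {P Q : Set} (P? : Dec P) (Q? : Dec Q) {x y} → (P → Q) → (Q → P) → x ≈ y → when P? x ≈ when Q? y
  when-cong (yes p) (yes q) to from eq = eq
  when-cong (yes p) (no ¬q) to from eq = ⊥-elim (¬q (to p))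
  when-cong (no ¬p) (yes q) to from eq = ⊥-elim (¬p (from q))
  when-cong (no ¬p) (no ¬q) to from eq = refl

  when-yes : ∀ {P : Set} (P? : Dec P) {x} → P → when P? x ≈ x
  when-yes (yes _) p = refl
  when-yes (no ¬p) p = ⊥-elim (¬p p)

  when-no : ∀ {P : Set} (P? : Dec P) {x} → ¬ P → when P? x ≈ 1#
  when-no (yes p) ¬p = ⊥-elim (¬p p)
  when-no (no _)  ¬p = refl

  when-Π : ∀ {P : Set} (P? : Dec P) N F → when P? (Π N F) ≈ Π N (λ i → when P? (F i))
  when-Π (yes _) N F = refl
  when-Π (no _)  N F = sym (Π-1 N (λ _ _ → refl))

  -- Indices stand for the numbers from 1 on, so in each block of ℓ of them exactly the last is
  -- divisible by ℓ.
  Π-multiples : ∀ N ℓ (F : ℕ → Carrier) → 0 < ℓ →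
                Π (N ℕ.* ℓ) (λ i → when (ℓ ∣? suc i) (F (suc i))) ≈ Π N (λ i → F (ℓ ℕ.* suc i))
  Π-multiples N ℓ@(suc ℓ′) F _ = trans (Π-blocks N ℓ _) (Π-cong N λ i → begin
    Π ℓ′ (G i) * G i ℓ′  ≈⟨ *-cong (Π-1 ℓ′ (λ j j<ℓ′ → when-no (ℓ ∣? suc (i ℕ.* ℓ ℕ.+ j)) (inner i j j<ℓ′)))
                                    (when-yes (ℓ ∣? suc (i ℕ.* ℓ ℕ.+ ℓ′)) (≡.subst (ℓ ∣_) (last i) (m∣m*n (suc i)))) ⟩
    1# * F (suc (i ℕ.* ℓ ℕ.+ ℓ′)) ≈⟨ *-identityˡ _ ⟩
    F (suc (i ℕ.* ℓ ℕ.+ ℓ′))  ≈⟨ reflexive (≡.cong F (≡.sym (last i))) ⟩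
    F (ℓ ℕ.* suc i)  ∎)
    where
    G : ℕ → ℕ → Carrier
    G i j = when (ℓ ∣? suc (i ℕ.* ℓ ℕ.+ j)) (F (suc (i ℕ.* ℓ ℕ.+ j)))
    last : ∀ i → ℓ ℕ.* suc i ≡ suc (i ℕ.* ℓ ℕ.+ ℓ′)
    last i = step ℓ′ i
      where
      step : ∀ l i → suc l ℕ.* suc i ≡ suc (i ℕ.* suc l ℕ.+ l)
      step = solve-∀
    inner : ∀ i j → j < ℓ′ → ¬ ℓ ∣ suc (i ℕ.* ℓ ℕ.+ j)
    inner i j j<ℓ′ ℓ∣ = ℕₚ.<⇒≱ (s≤s j<ℓ′) (∣⇒≤ (∣m+n∣m⇒∣n (≡.subst (ℓ ∣_) (≡.sym (ℕₚ.+-suc (i ℕ.* ℓ) j)) ℓ∣) (n∣m*n i)))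

  ∏-applyUpTo : ∀ N (F : ℕ → Carrier) → ∏ (applyUpTo F N) ≈ Π N F
  ∏-applyUpTo zero    F = refl
  ∏-applyUpTo (suc N) F = trans (*-congˡ (∏-applyUpTo N (F ∘ suc))) (sym (trans (Π-+ 1 N F) (*-congʳ (*-identityˡ _))))

  ∏-filter : ∀ {P : ℕ → Set} (P? : ∀ x → Dec (P x)) (F : ℕ → Carrier) xs →
             ∏ (map F (filter P? xs)) ≈ ∏ (map (λ x → when (P? x) (F x)) xs)
  ∏-filter P? F []       = refl
  ∏-filter P? F (x ∷ xs) with P? x
  ... | yes _ = *-congˡ (∏-filter P? F xs)
  ... | no _  = trans (∏-filter P? F xs) (sym (*-identityˡ _))

  ∏-filter-range : ∀ {P : ℕ → Set} (P? : ∀ x → Dec (P x)) (F : ℕ → Carrier) N →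
                   ∏ (map F (filter P? (map suc (upTo N)))) ≈ Π N (λ i → when (P? (suc i)) (F (suc i)))
  ∏-filter-range P? F N = begin
    ∏ (map F (filter P? (map suc (upTo N))))  ≈⟨ ∏-filter P? F (map suc (upTo N)) ⟩
    ∏ (map G (map suc (upTo N)))  ≈⟨ reflexive (≡.cong ∏ (≡.trans (≡.sym (map-∘ (upTo N))) (map-applyUpTo id (G ∘ suc) N))) ⟩
    ∏ (applyUpTo (G ∘ suc) N)  ≈⟨ ∏-applyUpTo N (G ∘ suc) ⟩
    Π N (G ∘ suc)  ∎
    where
    G : ℕ → Carrier
    G x = when (P? x) (F x)

  ∏-concatMap : ∀ {A : Set} (G : A → List Carrier) xs → ∏ (concatMap G xs) ≈ ∏ (map (∏ ∘ G) xs)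
  ∏-concatMap G []       = refl
  ∏-concatMap G (x ∷ xs) = trans (∏-++ (G x) (concatMap G xs)) (*-congˡ (∏-concatMap G xs))

  -- W t u will be the binomial x^t - θ^(-u) b^t. The rearrangement of the product uses nothing
  -- about it but the rule `W-prime` for opening one prime.
  module _ (d : ℕ) (0<d : 0 < d) (W : ℕ → ℕ → Carrier)
           (W-prime : ∀ ℓ d′ → Prime ℓ → d ≡ d′ ℕ.* ℓ → ∀ t v → Π ℓ (λ j → W t (v ℕ.+ j ℕ.* d′)) ≈ W (ℓ ℕ.* t) (ℓ ℕ.* v)) where

    coprimePart : ℕ → ℕ → Carrier
    coprimePart c t = Π d (λ i → when (coprime? (suc i) c) (W t (suc i)))

    private
      Radical : ℕ → Set
      Radical c = ∀ p → Prime p → p ∣ c → p ∣ d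

      -- Write u = ℓ v with v from 1 to d′ and open each factor by `W-prime`: the numbers v + j d′
      -- fill the interval from 1 to d once. Coprimality to `c` is preserved since ℓ does not divide
      -- `c` and every prime of `c` divides d′.
      multiples-part : ∀ ℓ c t → Prime ℓ → ℓ ∣ d → ¬ ℓ ∣ c → 0 < c → Radical c →
        Π d (λ i → when (ℓ ∣? suc i) (when (coprime? (suc i) c) (W (ℓ ℕ.* t) (suc i)))) ≈ coprimePart c t
      multiples-part ℓ c t prime-ℓ (divides d′ d≡) ℓ∤c 0<c radical = begin
        Π d (λ i → when (ℓ ∣? suc i) (H (suc i)))  ≈⟨ Π-≡ _ d≡ ⟩
        Π (d′ ℕ.* ℓ) (λ i → when (ℓ ∣? suc i) (H (suc i)))  ≈⟨ Π-multiples d′ ℓ H 0<ℓ ⟩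
        Π d′ (λ v → H (ℓ ℕ.* suc v))
          ≈⟨ Π-cong d′ (λ v → when-cong (coprime? (ℓ ℕ.* suc v) c) (coprime? (suc v) c) (drop v) (insert v)
               (sym (W-prime ℓ d′ prime-ℓ d≡ t (suc v)))) ⟩
        Π d′ (λ v → when (coprime? (suc v) c) (Π ℓ (λ j → W t (suc v ℕ.+ j ℕ.* d′))))
          ≈⟨ Π-cong d′ (λ v → when-Π (coprime? (suc v) c) ℓ _) ⟩
        Π d′ (λ v → Π ℓ (λ j → when (coprime? (suc v) c) (W t (suc v ℕ.+ j ℕ.* d′))))
          ≈⟨ Π-swap d′ ℓ _ ⟩
        Π ℓ (λ j → Π d′ (λ v → when (coprime? (suc v) c) (W t (suc v ℕ.+ j ℕ.* d′))))
          ≈⟨ Π-cong ℓ (λ j → Π-cong d′ (λ v → when-cong (coprime? (suc v) c) (coprime? (suc (j ℕ.* d′ ℕ.+ v)) c)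
               (translate j v) (untranslate j v) (reflexive (≡.cong (W t) (commute j v))))) ⟩
        Π ℓ (λ j → Π d′ (λ v → when (coprime? (suc (j ℕ.* d′ ℕ.+ v)) c) (W t (suc (j ℕ.* d′ ℕ.+ v)))))
          ≈⟨ Π-blocks ℓ d′ _ ⟨
        Π (ℓ ℕ.* d′) (λ i → when (coprime? (suc i) c) (W t (suc i)))  ≈⟨ Π-≡ _ (≡.trans (ℕₚ.*-comm ℓ d′) (≡.sym d≡)) ⟩
        coprimePart c t  ∎
        where
        0<ℓ : 0 < ℓ
        0<ℓ = prime>0 prime-ℓ
        H : ℕ → Carrier
        H u = when (coprime? u c) (W (ℓ ℕ.* t) u)
        drop : ∀ v → gcd (ℓ ℕ.* suc v) c ≡ 1 → gcd (suc v) c ≡ 1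
        drop v cop = avoids⇒gcd≡1 0<c (λ p pr p∣c p∣v → gcd≡1⇒avoids {ℓ ℕ.* suc v} cop p pr p∣c (∣n⇒∣m*n ℓ p∣v))
        insert : ∀ v → gcd (suc v) c ≡ 1 → gcd (ℓ ℕ.* suc v) c ≡ 1
        insert v cop = avoids⇒gcd≡1 0<c λ p pr p∣c p∣ℓv → case (euclidsLemma ℓ (suc v) pr p∣ℓv) of λ
          { (inj₁ p∣ℓ) → ℓ∤c (≡.subst (_∣ c) (prime-∣-prime pr prime-ℓ p∣ℓ) p∣c)
          ; (inj₂ p∣v) → gcd≡1⇒avoids {suc v} cop p pr p∣c p∣v }
        divides-d′ : ∀ p → Prime p → p ∣ c → p ∣ d′
        divides-d′ p pr p∣c with euclidsLemma d′ ℓ pr (≡.subst (p ∣_) d≡ (radical p pr p∣c))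
        ... | inj₁ p∣d′ = p∣d′
        ... | inj₂ p∣ℓ  = ⊥-elim (ℓ∤c (≡.subst (_∣ c) (prime-∣-prime pr prime-ℓ p∣ℓ) p∣c))
        commute : ∀ j v → suc v ℕ.+ j ℕ.* d′ ≡ suc (j ℕ.* d′ ℕ.+ v)
        commute j v = ≡.cong suc (ℕₚ.+-comm v (j ℕ.* d′))
        translate : ∀ j v → gcd (suc v) c ≡ 1 → gcd (suc (j ℕ.* d′ ℕ.+ v)) c ≡ 1
        translate j v cop = avoids⇒gcd≡1 0<c λ p pr p∣c p∣ → gcd≡1⇒avoids {suc v} cop p pr p∣c
          (∣m+n∣m⇒∣n (≡.subst (p ∣_) (≡.sym (ℕₚ.+-suc (j ℕ.* d′) v)) p∣) (∣n⇒∣m*n j (divides-d′ p pr p∣c)))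
        untranslate : ∀ j v → gcd (suc (j ℕ.* d′ ℕ.+ v)) c ≡ 1 → gcd (suc v) c ≡ 1
        untranslate j v cop = avoids⇒gcd≡1 0<c λ p pr p∣c p∣v → gcd≡1⇒avoids {suc (j ℕ.* d′ ℕ.+ v)} cop p pr p∣c
          (≡.subst (p ∣_) (ℕₚ.+-suc (j ℕ.* d′) v) (∣m∣n⇒∣m+n (∣n⇒∣m*n j (divides-d′ p pr p∣c)) p∣v))

      add-prime : ∀ {u a ℓ} → 0 < a → Prime ℓ → ¬ ℓ ∣ u → gcd u a ≡ 1 → gcd u (a ℕ.* ℓ) ≡ 1
      add-prime {u} {a} {ℓ} 0<a prime-ℓ ℓ∤u cop = avoids⇒gcd≡1 (0<* 0<a (prime>0 prime-ℓ))
        λ p pr p∣aℓ p∣u → case (euclidsLemma a ℓ pr p∣aℓ) of λ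
          { (inj₁ p∣a) → gcd≡1⇒avoids {u} cop p pr p∣a p∣u
          ; (inj₂ p∣ℓ) → ℓ∤u (≡.subst (_∣ u) (prime-∣-prime pr prime-ℓ p∣ℓ) p∣u) }

      forget-prime : ∀ u {a} ℓ → 0 < a → gcd u (a ℕ.* ℓ) ≡ 1 → gcd u a ≡ 1
      forget-prime u ℓ 0<a cop = avoids⇒gcd≡1 0<a λ p pr p∣a → gcd≡1⇒avoids {u} cop p pr (∣m⇒∣m*n ℓ p∣a)

      prime-avoided : ∀ {u a ℓ} → Prime ℓ → gcd u (a ℕ.* ℓ) ≡ 1 → ¬ ℓ ∣ u
      prime-avoided {u} {a} {ℓ} prime-ℓ cop = gcd≡1⇒avoids {u} cop ℓ prime-ℓ (n∣m*n a)

      -- Among the u prime to `a`, those divisible by ℓ open to factors at level `t`, and the others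
      -- are the u prime to a ℓ.
      split-prime : ∀ ℓ a t → Prime ℓ → ℓ ∣ d → ¬ ℓ ∣ a → 0 < a → Radical a →
                    coprimePart a (ℓ ℕ.* t) ≈ coprimePart a t * coprimePart (a ℕ.* ℓ) (ℓ ℕ.* t)
      split-prime ℓ a t prime-ℓ ℓ∣d ℓ∤a 0<a radical = trans (Π-cong d split)
        (trans (Π-distrib d _ _) (*-congʳ (multiples-part ℓ a t prime-ℓ ℓ∣d ℓ∤a 0<a radical)))
        where
        split : ∀ i → when (coprime? (suc i) a) (W (ℓ ℕ.* t) (suc i)) ≈
                      when (ℓ ∣? suc i) (when (coprime? (suc i) a) (W (ℓ ℕ.* t) (suc i))) *
                      when (coprime? (suc i) (a ℕ.* ℓ)) (W (ℓ ℕ.* t) (suc i))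
        split i with ℓ ∣? suc i
        ... | yes ℓ∣u = sym (trans (*-congˡ (when-no (coprime? (suc i) (a ℕ.* ℓ))
            (λ cop → prime-avoided {a = a} prime-ℓ cop ℓ∣u))) (*-identityʳ _))
        ... | no ℓ∤u  = sym (trans (*-identityˡ _) (when-cong (coprime? (suc i) (a ℕ.* ℓ)) (coprime? (suc i) a)
                          (forget-prime (suc i) ℓ 0<a) (add-prime 0<a prime-ℓ ℓ∤u) refl))

      repeat-prime : ∀ ℓ a t → Prime ℓ → ℓ ∣ a → 0 < a → coprimePart a t ≈ coprimePart (a ℕ.* ℓ) t
      repeat-prime ℓ a t prime-ℓ ℓ∣a 0<a = Π-cong d λ i → when-cong (coprime? (suc i) a) (coprime? (suc i) (a ℕ.* ℓ))
        (λ cop → add-prime 0<a prime-ℓ (gcd≡1⇒avoids {suc i} cop ℓ prime-ℓ ℓ∣a) cop) (forget-prime (suc i) ℓ 0<a) refl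

      B : ℕ → Carrier
      B x = coprimePart x x

      cofactorProduct : ℕ → ℕ → Carrier
      cofactorProduct a b = Π b (λ i → when (cofactor? b a i) (B (a ℕ.* suc i)))

      module _ (a b ℓ : ℕ) (0<a : 0 < a) (0<b : 0 < b) (prime-ℓ : Prime ℓ) where
        private
          0<ℓ : 0 < ℓ
          0<ℓ = prime>0 prime-ℓ

          C = CoprimeCofactor (b ℕ.* ℓ) a
          C? : ∀ i → Dec (C (suc i))
          C? i = cofactor? (b ℕ.* ℓ) a i
          C₁? : ∀ i → Dec (CoprimeCofactor b a (suc i))
          C₁? i = cofactor? b a i
          C₂? : ∀ i → Dec (CoprimeCofactor (b ℕ.* ℓ) (a ℕ.* ℓ) (suc i))
          C₂? i = cofactor? (b ℕ.* ℓ) (a ℕ.* ℓ) i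

          C₂⇒∣ : ∀ {t} → CoprimeCofactor (b ℕ.* ℓ) (a ℕ.* ℓ) t → ℓ ∣ t
          C₂⇒∣ {t} (s , eq , cop) with euclidsLemma s t prime-ℓ (≡.subst (ℓ ∣_) eq (n∣m*n b))
          ... | inj₁ ℓ∣s = ⊥-elim (prime-avoided {a = a} prime-ℓ cop ℓ∣s)
          ... | inj₂ ℓ∣t = ℓ∣t

          H : ℕ → Carrier
          -- A value for totality only: `H` is used at positive arguments.
          H zero      = 1#
          H t@(suc i) = when (C₂? i) (B (a ℕ.* t))

          H-multiple : ∀ i → H (ℓ ℕ.* suc i) ≈ when (cofactor? b (a ℕ.* ℓ) i) (B (a ℕ.* ℓ ℕ.* suc i))
          H-multiple i with ℓ ℕ.* suc i in eq
          ... | zero  = ⊥-elim (ℕₚ.<-irrefl (≡.sym eq) (0<* 0<ℓ (s≤s z≤n)))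
          ... | suc j = when-cong (C₂? j) (cofactor? b (a ℕ.* ℓ) i) to from
                          (reflexive (≡.cong B (≡.trans (≡.cong (a ℕ.*_) (≡.sym eq)) (≡.sym (ℕₚ.*-assoc a ℓ (suc i))))))
            where
            shuffle : ∀ s ℓ t → s ℕ.* (ℓ ℕ.* t) ≡ s ℕ.* t ℕ.* ℓ
            shuffle = solve-∀
            to : CoprimeCofactor (b ℕ.* ℓ) (a ℕ.* ℓ) (suc j) → CoprimeCofactor b (a ℕ.* ℓ) (suc i)
            to (s , bℓ≡ , cop) = s , ℕₚ.*-cancelʳ-≡ b (s ℕ.* suc i) ℓ {{ℕ.>-nonZero 0<ℓ}}
              (≡.trans bℓ≡ (≡.trans (≡.cong (s ℕ.*_) (≡.sym eq)) (shuffle s ℓ (suc i)))) , cop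
            from : CoprimeCofactor b (a ℕ.* ℓ) (suc i) → CoprimeCofactor (b ℕ.* ℓ) (a ℕ.* ℓ) (suc j)
            from (s , b≡ , cop) = s , ≡.trans (≡.cong (ℕ._* ℓ) b≡) (≡.trans (≡.sym (shuffle s ℓ (suc i)))
                (≡.cong (s ℕ.*_) eq)) , cop

          H-product : Π (b ℕ.* ℓ) (λ i → when (ℓ ∣? suc i) (H (suc i))) ≈ cofactorProduct (a ℕ.* ℓ) b
          H-product = trans (Π-multiples b ℓ H 0<ℓ) (Π-cong b H-multiple)

        -- A cofactor prime to `a` is prime to ℓ, so each t that occurs contains ℓ and can be
        -- divided by it.
        cofactorProduct-old-prime : ℓ ∣ a → cofactorProduct a (b ℕ.* ℓ) ≈ cofactorProduct (a ℕ.* ℓ) b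
        cofactorProduct-old-prime ℓ∣a = trans (Π-cong (b ℕ.* ℓ) pointwise) H-product
          where
          pointwise : ∀ i → when (C? i) (B (a ℕ.* suc i)) ≈ when (ℓ ∣? suc i) (H (suc i))
          pointwise i = trans (when-cong (C? i) (C₂? i)
              (λ (s , eq , cop) → s , eq , add-prime 0<a prime-ℓ (gcd≡1⇒avoids {s} cop ℓ prime-ℓ ℓ∣a) cop)
              (λ (s , eq , cop) → s , eq , forget-prime s ℓ 0<a cop) refl) (guard (ℓ ∣? suc i) (C₂? i))
            where
            guard : (ℓ∣? : Dec (ℓ ∣ suc i)) (c? : Dec (CoprimeCofactor (b ℕ.* ℓ) (a ℕ.* ℓ) (suc i))) →
                    when c? (B (a ℕ.* suc i)) ≈ when ℓ∣? (when c? (B (a ℕ.* suc i)))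
            guard (yes _)  _       = refl
            guard (no ℓ∤t) (yes c) = ⊥-elim (ℓ∤t (C₂⇒∣ c))
            guard (no _)   (no _)  = refl

        -- The t that occur fall into two disjoint classes: if ℓ divides the cofactor, then t
        -- divides b already; if not, the cofactor is prime to a ℓ and ℓ divides t.
        cofactorProduct-new-prime : ¬ ℓ ∣ a → cofactorProduct a (b ℕ.* ℓ) ≈ cofactorProduct a b * cofactorProduct (a ℕ.* ℓ) b
        cofactorProduct-new-prime ℓ∤a = trans (Π-cong (b ℕ.* ℓ) pointwise) (trans (Π-distrib (b ℕ.* ℓ) _ _) (*-cong
          (Π-extend b (b ℕ.* ℓ) (ℕₚ.m≤m*n b ℓ {{ℕ.>-nonZero 0<ℓ}})
            (λ i b≤i → when-no (C₁? i) (λ (s , eq , _) → ℕₚ.<⇒≱ (s≤s b≤i) (∣⇒≤ {{ℕ.>-nonZero 0<b}} (divides s eq)))))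
          H-product))
          where
          pointwise : ∀ i → when (C? i) (B (a ℕ.* suc i)) ≈ when (C₁? i) (B (a ℕ.* suc i)) * when (ℓ ∣? suc i) (H (suc i))
          pointwise i = combine (C? i) (C₁? i) (ℓ ∣? suc i) (C₂? i)
            where
            t = suc i
            shuffle : ∀ s ℓ t → s ℕ.* t ℕ.* ℓ ≡ s ℕ.* ℓ ℕ.* t
            shuffle = solve-∀
            multiply : CoprimeCofactor b a t → C t
            multiply (s , eq , cop) = s ℕ.* ℓ , ≡.trans (≡.cong (ℕ._* ℓ) eq) (shuffle s ℓ t) ,
              avoids⇒gcd≡1 {s ℕ.* ℓ} 0<a λ p pr p∣a p∣sℓ → case (euclidsLemma s ℓ pr p∣sℓ) of λ
                { (inj₁ p∣s) → gcd≡1⇒avoids {s} cop p pr p∣a p∣s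
                ; (inj₂ p∣ℓ) → ℓ∤a (≡.subst (_∣ a) (prime-∣-prime pr prime-ℓ p∣ℓ) p∣a) }
            exclusive : CoprimeCofactor b a t → ¬ CoprimeCofactor (b ℕ.* ℓ) (a ℕ.* ℓ) t
            exclusive (s , eq , _) (s′ , eq′ , cop) = prime-avoided {a = a} prime-ℓ cop
              (≡.subst (ℓ ∣_) (ℕₚ.*-cancelʳ-≡ (s ℕ.* ℓ) s′ t (≡.trans (≡.sym
                  (≡.trans (≡.cong (ℕ._* ℓ) eq) (shuffle s ℓ t))) eq′)) (n∣m*n s))
            one-of : C t → CoprimeCofactor b a t ⊎ CoprimeCofactor (b ℕ.* ℓ) (a ℕ.* ℓ) t
            one-of (s , eq , cop) with ℓ ∣? s
            ... | no ℓ∤s = inj₂ (s , eq , add-prime 0<a prime-ℓ ℓ∤s cop)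
            ... | yes (divides s′ ≡.refl) = inj₁ (s′ , ℕₚ.*-cancelʳ-≡ b (s′ ℕ.* t) ℓ {{ℕ.>-nonZero 0<ℓ}}
                (≡.trans eq (≡.sym (shuffle s′ ℓ t))) ,
                avoids⇒gcd≡1 {s′} 0<a (λ p pr p∣a p∣s′ → gcd≡1⇒avoids {s′ ℕ.* ℓ} cop p pr p∣a (∣m⇒∣m*n ℓ p∣s′)))
            combine : (c? : Dec (C t)) (c₁? : Dec (CoprimeCofactor b a t)) (ℓ∣? : Dec (ℓ ∣ t))
                (c₂? : Dec (CoprimeCofactor (b ℕ.* ℓ) (a ℕ.* ℓ) t)) →
                      when c? (B (a ℕ.* t)) ≈ when c₁? (B (a ℕ.* t)) * when ℓ∣? (when c₂? (B (a ℕ.* t)))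
            combine (no ¬c) (yes c₁) _ _                 = ⊥-elim (¬c (multiply c₁))
            combine (no ¬c) _ _ (yes (s , eq , cop))     = ⊥-elim (¬c (s , eq , forget-prime s ℓ 0<a cop))
            combine (no ¬c) (no _) (yes _) (no _)        = sym (*-identityˡ 1#)
            combine (no ¬c) (no _) (no _) (no _)         = sym (*-identityˡ 1#)
            combine (yes c) (yes c₁) _ (yes c₂)          = ⊥-elim (exclusive c₁ c₂)
            combine (yes c) (yes c₁) (yes _) (no _)      = sym (*-identityʳ _)
            combine (yes c) (yes c₁) (no _) (no _)       = sym (*-identityʳ _)
            combine (yes c) (no ¬c₁) (yes _) (yes c₂)    = sym (*-identityˡ _)
            combine (yes c) (no ¬c₁) (no ℓ∤t) (yes c₂)   = ⊥-elim (ℓ∤t (C₂⇒∣ c₂))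
            combine (yes c) (no ¬c₁) _ (no ¬c₂) with one-of c
            ... | inj₁ c₁ = ⊥-elim (¬c₁ c₁)
            ... | inj₂ c₂ = ⊥-elim (¬c₂ c₂)

      -- The case a = 1 is the divisor product; in general splitting off a prime ℓ of b replaces a by a ℓ.
      cofactor-factorisation : ∀ b → Acc _<_ b → ∀ a → 0 < a → 0 < b → Radical a → Radical b →
                               coprimePart a (b ℕ.* a) ≈ cofactorProduct a b
      cofactor-factorisation b (acc rec) a 0<a 0<b radical-a radical-b with b ℕ.≟ 1
      ... | yes ≡.refl = begin
        coprimePart a (1 ℕ.* a)  ≈⟨ reflexive (≡.cong (coprimePart a) (ℕₚ.*-identityˡ a)) ⟩
        coprimePart a a  ≈⟨ reflexive (≡.cong B (ℕₚ.*-identityʳ a)) ⟨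
        B (a ℕ.* 1)  ≈⟨ when-yes (cofactor? 1 a 0) (1 , ≡.refl , avoids⇒gcd≡1 0<a
            (λ p pr _ p∣1 → prime∤1 pr p∣1)) ⟨
        when (cofactor? 1 a 0) (B (a ℕ.* 1)) ≈⟨ *-identityˡ _ ⟨
        cofactorProduct a 1  ∎
      ... | no b≢1 with prime-divisor b (ℕₚ.≤∧≢⇒< 0<b (b≢1 ∘ ≡.sym))
      ...   | ℓ , prime-ℓ , divides b′ ≡.refl = by-case (ℓ ∣? a)
        where
        0<b′ : 0 < b′
        0<b′ = ℕₚ.n≢0⇒n>0 λ { ≡.refl → ℕₚ.<-irrefl ≡.refl 0<b }
        0<ℓ : 0 < ℓ
        0<ℓ = prime>0 prime-ℓ
        b′<b : b′ < b′ ℕ.* ℓ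
        b′<b = ℕₚ.m<m*n b′ ℓ {{ℕ.>-nonZero 0<b′}} (ℕ.nonTrivial⇒n>1 ℓ {{prime⇒nonTrivial prime-ℓ}})
        ℓ∣d : ℓ ∣ d
        ℓ∣d = radical-b ℓ prime-ℓ (n∣m*n b′)
        radical-b′ : Radical b′
        radical-b′ p pr p∣b′ = radical-b p pr (∣m⇒∣m*n ℓ p∣b′)
        radical-aℓ : Radical (a ℕ.* ℓ)
        radical-aℓ p pr p∣aℓ with euclidsLemma a ℓ pr p∣aℓ
        ... | inj₁ p∣a = radical-a p pr p∣a
        ... | inj₂ p∣ℓ = ≡.subst (_∣ d) (≡.sym (prime-∣-prime pr prime-ℓ p∣ℓ)) ℓ∣d
        ih-a = cofactor-factorisation b′ (rec b′<b) a 0<a 0<b′ radical-a radical-b′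
        ih-aℓ = cofactor-factorisation b′ (rec b′<b) (a ℕ.* ℓ) (0<* 0<a 0<ℓ) 0<b′ radical-aℓ radical-b′
        exponent₁ : ∀ b ℓ a → b ℕ.* ℓ ℕ.* a ≡ ℓ ℕ.* (b ℕ.* a)
        exponent₁ = solve-∀
        exponent₂ : ∀ b ℓ a → ℓ ℕ.* (b ℕ.* a) ≡ b ℕ.* (a ℕ.* ℓ)
        exponent₂ = solve-∀
        by-case : Dec (ℓ ∣ a) → coprimePart a (b′ ℕ.* ℓ ℕ.* a) ≈ cofactorProduct a (b′ ℕ.* ℓ)
        by-case (yes ℓ∣a) = begin
          coprimePart a (b′ ℕ.* ℓ ℕ.* a)  ≈⟨ reflexive (≡.cong (coprimePart a) (≡.trans (exponent₁ b′ ℓ a) (exponent₂ b′ ℓ a))) ⟩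
          coprimePart a (b′ ℕ.* (a ℕ.* ℓ))  ≈⟨ repeat-prime ℓ a (b′ ℕ.* (a ℕ.* ℓ)) prime-ℓ ℓ∣a 0<a ⟩
          coprimePart (a ℕ.* ℓ) (b′ ℕ.* (a ℕ.* ℓ))  ≈⟨ ih-aℓ ⟩
          cofactorProduct (a ℕ.* ℓ) b′  ≈⟨ cofactorProduct-old-prime a b′ ℓ 0<a 0<b′ prime-ℓ ℓ∣a ⟨
          cofactorProduct a (b′ ℕ.* ℓ)  ∎
        by-case (no ℓ∤a) = begin
          coprimePart a (b′ ℕ.* ℓ ℕ.* a)  ≈⟨ reflexive (≡.cong (coprimePart a) (exponent₁ b′ ℓ a)) ⟩
          coprimePart a (ℓ ℕ.* (b′ ℕ.* a))  ≈⟨ split-prime ℓ a (b′ ℕ.* a) prime-ℓ ℓ∣d ℓ∤a 0<a radical-a ⟩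
          coprimePart a (b′ ℕ.* a) * coprimePart (a ℕ.* ℓ) (ℓ ℕ.* (b′ ℕ.* a))  ≈⟨ *-cong ih-a
              (trans (reflexive (≡.cong (coprimePart (a ℕ.* ℓ)) (exponent₂ b′ ℓ a))) ih-aℓ) ⟩
          cofactorProduct a b′ * cofactorProduct (a ℕ.* ℓ) b′  ≈⟨ cofactorProduct-new-prime a b′ ℓ 0<a 0<b′ prime-ℓ ℓ∤a ⟨
          cofactorProduct a (b′ ℕ.* ℓ)  ∎

    divisor-factorisation : ∀ m → 0 < m → (∀ p → Prime p → p ∣ m → p ∣ d) →
      Π d (λ i → W m (suc i)) ≈ ∏ (concatMap (λ t → map (W t) (coprimeRange d t)) (divisors m))
    divisor-factorisation m 0<m radical = begin
      Π d (λ i → W m (suc i))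
        ≈⟨ Π-cong d (λ i → sym (trans (when-yes (coprime? (suc i) 1) (avoids⇒gcd≡1 {suc i} (s≤s z≤n)
             (λ p pr p∣1 _ → prime∤1 pr p∣1)))
             (reflexive (≡.cong (λ t → W t (suc i)) (ℕₚ.*-identityʳ m))))) ⟩
      coprimePart 1 (m ℕ.* 1)
        ≈⟨ cofactor-factorisation m (<-wellFounded m) 1 (s≤s z≤n) 0<m (λ p pr p∣1 → ⊥-elim (prime∤1 pr p∣1)) radical ⟩
      cofactorProduct 1 m
        ≈⟨ Π-cong m (λ i → when-cong (cofactor? m 1 i) (suc i ∣? m)
             (λ (s , eq , _) → divides s eq) (λ { (divides s eq) → s , eq , avoids⇒gcd≡1 {s} (s≤s z≤n)
                 (λ p pr p∣1 _ → prime∤1 pr p∣1) })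
             (trans (reflexive (≡.cong B (ℕₚ.*-identityˡ (suc i)))) (sym
                 (∏-filter-range (λ u → gcd u (suc i) ℕ.≟ 1) (W (suc i)) d)))) ⟩
      Π m (λ i → when (suc i ∣? m) (∏ (map (W (suc i)) (coprimeRange d (suc i)))))
        ≈⟨ ∏-filter-range (_∣? m) (λ t → ∏ (map (W t) (coprimeRange d t))) m ⟨
      ∏ (map (λ t → ∏ (map (W t) (coprimeRange d t))) (divisors m))
        ≈⟨ ∏-concatMap (λ t → map (W t) (coprimeRange d t)) (divisors m) ⟨
      ∏ (concatMap (λ t → map (W t) (coprimeRange d t)) (divisors m)) ∎

-- Factorisation of binomials

module _ (R : CRing) where
  open CommutativeRing R hiding (zero)
  open ListProduct R
  open Poly R using (pow)
  open Powers R

  ∏-constant : ∀ {A : Set} c (as : List A) → ∏ (map (λ _ → c) as) ≈ pow c (length as)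
  ∏-constant c []       = refl
  ∏-constant c (a ∷ as) = *-congˡ (∏-constant c as)

  ∏-swap : ∀ {A B : Set} (G : A → B → Carrier) as bs →
           ∏ (map (λ a → ∏ (map (G a) bs)) as) ≈ ∏ (map (λ b → ∏ (map (λ a → G a b) as)) bs)
  ∏-swap G []       bs = sym (trans (∏-constant 1# bs) (pow-1# (length bs)))
  ∏-swap G (a ∷ as) bs = trans (*-congˡ (∏-swap G as bs)) (sym (∏-distrib (G a) (λ b → ∏ (map (λ a → G a b) as)) bs))

  -- Binomials are factored separately for each conjugate, whereas a factor of the theorem collects
  -- all conjugates for one pair t, u; this exchanges the two orders.
  ∏-concatMap-swap : ∀ {I : Set} (us : ℕ → List ℕ) (F : ℕ → ℕ → Carrier) (W : I → ℕ → ℕ → Carrier) is →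
    (∀ t u → F t u ≈ ∏ (map (λ i → W i t u) is)) → ∀ ts →
    ∏ (concatMap (λ t → map (F t) (us t)) ts) ≈ ∏ (map (λ i → ∏ (concatMap (λ t → map (W i t) (us t)) ts)) is)
  ∏-concatMap-swap us F W is F≈ ts = begin
    ∏ (concatMap (λ t → map (F t) (us t)) ts)  ≈⟨ RP.∏-concatMap (λ t → map (F t) (us t)) ts ⟩
    ∏ (map (λ t → ∏ (map (F t) (us t))) ts)
      ≈⟨ ∏-cong ts (λ t → trans (∏-cong (us t) (F≈ t)) (∏-swap (λ u i → W i t u) (us t) is)) ⟩
    ∏ (map (λ t → ∏ (map (λ i → ∏ (map (W i t) (us t))) is)) ts)  ≈⟨ ∏-swap (λ t i → ∏ (map (W i t) (us t))) ts is ⟩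
    ∏ (map (λ i → ∏ (map (λ t → ∏ (map (W i t) (us t))) ts)) is)
      ≈⟨ ∏-cong is (λ i → sym (RP.∏-concatMap (λ t → map (W i t) (us t)) ts)) ⟩
    ∏ (map (λ i → ∏ (concatMap (λ t → map (W i t) (us t)) ts)) is)  ∎
    where
    module RP = RangeProduct R
    open ≈-Reasoning setoid

module Binomials (L : Field) where
  open Field L hiding (zero)
  open Poly commutativeRing
  open PolyRing commutativeRing
  open Degree commutativeRing
  open FieldProperties L
  open Powers commutativeRing
  open Orders commutativeRing
  open Eval commutativeRing
  open Compose commutativeRing
  private
    module P = CommutativeRing polyRing
    module PP = Poly polyRing
    module PW = Powers polyRing
    module LP = ListProduct polyRing
    module RP = RangeProduct polyRing
    module C = Hom commutativeRing polyRing const const-isHom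
  open ≈-Reasoning P.setoid

  compose-monomial : ∀ c t Y → compose (monomial c t) Y ≋ const c *ₚ PP.pow Y t
  compose-monomial c t Y = P.trans (P.reflexive (compose≡eval (monomial c t) Y))
    (P.trans (Eval.eval-cong polyRing Y (MapPoly.map-monomial commutativeRing polyRing const const-isHom c t))
      (Eval.eval-monomial polyRing Y (const c) t))

  compose-const : ∀ a Y → compose (const a) Y ≋ const a
  compose-const a Y = Eval.eval-const polyRing Y (const a)

  compose-linears : ∀ {A : Set} (F : A → Carrier) as Y →
                    compose (prodₚ (map (linear ∘ F) as)) Y ≋ prodₚ (map (λ a → Y +ₚ (-ₚ const (F a))) as)
  compose-linears F as Y = P.trans (∏-homo polyRing polyRing (λ p → compose p Y) (compose-isHom Y) (linear ∘ F) as)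
    (LP.∏-cong as (λ a → compose-linear Y (F a)))

  monomial-1≋ : ∀ t → monomial 1# t ≋ PP.pow X t
  monomial-1≋ t = P.trans (monomial≋ 1# t) (P.*-identityˡ _)

  monomial-cong : ∀ {c c′} t → c ≈ c′ → monomial c t ≋ monomial c′ t
  monomial-cong zero    eq = C.cong eq
  monomial-cong (suc t) eq = ∷-cong refl (monomial-cong t eq)

  scaled-monomial : ∀ {c c′} t → c * c′ ≈ 1# → const c *ₚ monomial c′ t ≋ monomial 1# t
  scaled-monomial {c} {c′} t eq = begin
    const c *ₚ monomial c′ t  ≈⟨ P.*-congˡ {const c} (monomial≋ c′ t) ⟩
    const c *ₚ (const c′ *ₚ PP.pow X t)  ≈⟨ P.*-assoc (const c) (const c′) (PP.pow X t) ⟨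
    (const c *ₚ const c′) *ₚ PP.pow X t  ≈⟨ P.*-congʳ {PP.pow X t} (P.trans (P.sym (C.*-homo c c′)) (C.cong eq)) ⟩
    1ₚ *ₚ PP.pow X t  ≈⟨ monomial≋ 1# t ⟨
    monomial 1# t  ∎

  -- The identity is proved for the variable by counting the N distinct roots ω^j c, and then `Z` is
  -- substituted.
  difference-of-powers : ∀ ω N c Z → HasMultiplicativeOrder ω N → ¬ c ≈ 0# →
    RP.Π N (λ j → Z +ₚ (-ₚ const (pow ω j * c))) ≋ PP.pow Z N +ₚ (-ₚ const (pow c N))
  difference-of-powers ω N c Z (0<N , ω^N≈1 , minimal) c≉0 = begin
    RP.Π N (λ j → Z +ₚ (-ₚ const (pow ω j * c)))  ≈⟨ RP.∏-applyUpTo N _ ⟨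
    prodₚ (applyUpTo (λ j → Z +ₚ (-ₚ const (pow ω j * c))) N)  ≈⟨ P.reflexive
        (≡.cong prodₚ (≡.sym (map-applyUpTo id (λ j → Z +ₚ (-ₚ const (pow ω j * c))) N))) ⟩
    prodₚ (map (λ j → Z +ₚ (-ₚ const (pow ω j * c))) (upTo N))  ≈⟨ compose-linears root (upTo N) Z ⟨
    compose (prodₚ (map (linear ∘ root) (upTo N))) Z  ≈⟨ compZ.cong (P.reflexive
        (≡.cong prodₚ (≡.trans (map-applyUpTo id (linear ∘ root) N) (≡.sym (map-applyUpTo root linear N))))) ⟩
    compose (prodₚ (map linear roots)) Z  ≈⟨ compZ.cong binomial-factors ⟨
    compose (monomial 1# N +ₚ (-ₚ const (pow c N))) Z  ≈⟨ compZ.minus-homo (monomial 1# N) (const (pow c N)) ⟩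
    compose (monomial 1# N) Z +ₚ (-ₚ compose (const (pow c N)) Z)  ≈⟨ P.+-cong
        (P.trans (compose-monomial 1# N Z) (P.*-identityˡ _)) (P.-‿cong (compose-const (pow c N) Z)) ⟩
    PP.pow Z N +ₚ (-ₚ const (pow c N))  ∎
    where
    module compZ = Hom polyRing polyRing (λ p → compose p Z) (compose-isHom Z)
    root : ℕ → Carrier
    root j = pow ω j * c
    roots : List Carrier
    roots = applyUpTo root N
    ω≉0 : ¬ ω ≈ 0#
    ω≉0 = pow≈1⇒nonzero 0<N ω^N≈1
    distinct : ∀ {i j} → i < j → j < N → ¬ root j ≈ root i
    distinct {i} {j} i<j j<N eq = minimal (j ℕ.∸ i) (ℕₚ.m<n⇒0<n∸m i<j) (ℕₚ.≤-<-trans (ℕₚ.m∸n≤m j i) j<N)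
      (*-cancelˡ (nonzero-pow i ω≉0) (trans (sym (pow-+ ω i (j ℕ.∸ i))) (trans (pow-≡ ω (ℕₚ.m+[n∸m]≡n (ℕₚ.<⇒≤ i<j)))
        (trans (*-cancelˡ c≉0 (trans (*-comm c _) (trans eq (*-comm _ c)))) (sym (*-identityʳ _))))))
    is-root : ∀ j → eval (monomial 1# N +ₚ (-ₚ const (pow c N))) (root j) ≈ 0#
    is-root j = trans (ev.minus-homo (monomial 1# N) (const (pow c N))) (x≈y⇒x∙y⁻¹≈ε (trans
      (trans (eval-monomial (root j) 1# N) (*-identityˡ _)) (trans (pow-distrib (pow ω j) c N)
        (trans (*-congʳ (trans (pow-comm ω j N) (trans (pow-cong j ω^N≈1) (pow-1# j))))
            (trans (*-identityˡ _) (sym (eval-const (root j) (pow c N))))))))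
      where module ev = Hom polyRing commutativeRing (λ p → eval p (root j)) (eval-isHom (root j))
    binomial-factors : monomial 1# N +ₚ (-ₚ const (pow c N)) ≋ prodₚ (map linear roots)
    binomial-factors = monic≋linears roots (AllPairs.applyUpTo⁺₁ root N (λ i<j j<N → difference-regular (distinct i<j j<N)))
      (monomial 1# N +ₚ (-ₚ const (pow c N)))
      (≡.subst (MonicOfDegree (monomial 1# N +ₚ (-ₚ const (pow c N)))) (≡.sym (length-applyUpTo root N))
        (monic-minus-lower {monomial 1# N} {const (pow c N)} (monic-monomial N)
            (deg<-mono {const (pow c N)} 0<N (deg<-length (const (pow c N))))))
      (All.applyUpTo⁺₂ root N is-root)

  module _ (η : Carrier) (d : ℕ) (η-order : HasMultiplicativeOrder η d) (b : Carrier) (b≉0 : ¬ b ≈ 0#) where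
    private
      0<d = proj₁ η-order
      η≉0 : ¬ η ≈ 0#
      η≉0 = pow≈1⇒nonzero 0<d (proj₁ (proj₂ η-order))

    binomial : ℕ → ℕ → Pol
    binomial t u = monomial 1# t +ₚ (-ₚ const (pow η u * pow b t))

    power-order : ∀ ℓ d′ → 0 < ℓ → d ≡ d′ ℕ.* ℓ → HasMultiplicativeOrder (pow η d′) ℓ
    power-order ℓ d′ 0<ℓ d≡ = 0<ℓ , trans (sym (pow-* η d′ ℓ)) (trans (pow-≡ η (≡.sym d≡)) (proj₁ (proj₂ η-order))) ,
      λ j 0<j j<ℓ eq → ℕₚ.<⇒≱ j<ℓ (∣⇒≤ {{ℕ.>-nonZero 0<j}} (*-cancelˡ-∣ d′ {{d′-nonZero}}
        (≡.subst (_∣ d′ ℕ.* j) d≡ (order-divides η-order (d′ ℕ.* j) (trans (pow-* η d′ j) eq)))))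
      where
      d′-nonZero : ℕ.NonZero d′
      d′-nonZero = ℕ.>-nonZero (ℕₚ.n≢0⇒n>0 λ { ≡.refl → ℕₚ.<-irrefl (≡.sym d≡) 0<d })

    binomial-power : ∀ ω N t v → HasMultiplicativeOrder ω N →
      RP.Π N (λ j → monomial 1# t +ₚ (-ₚ const (pow ω j * (pow η v * pow b t)))) ≋ binomial (N ℕ.* t) (N ℕ.* v)
    binomial-power ω N t v order = P.trans
      (difference-of-powers ω N (pow η v * pow b t) (monomial 1# t) order (nonzero-* (nonzero-pow v η≉0) (nonzero-pow t b≉0)))
      (P.+-cong monomial-pow (P.-‿cong (C.cong (trans (pow-distrib (pow η v) (pow b t) N) (*-cong (collect η v) (collect b t))))))
      where
      collect : ∀ x v → pow (pow x v) N ≈ pow x (N ℕ.* v)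
      collect x v = trans (sym (pow-* x v N)) (pow-≡ x (ℕₚ.*-comm v N))
      monomial-pow : PP.pow (monomial 1# t) N ≋ monomial 1# (N ℕ.* t)
      monomial-pow = P.trans (PW.pow-cong N (monomial-1≋ t)) (P.trans (P.sym (PW.pow-* X t N))
        (P.trans (PW.pow-≡ X (ℕₚ.*-comm t N)) (P.sym (monomial-1≋ (N ℕ.* t)))))

    binomial-prime : ∀ ℓ d′ → Prime ℓ → d ≡ d′ ℕ.* ℓ → ∀ t v → RP.Π ℓ (λ j → binomial t (v ℕ.+ j ℕ.* d′)) ≋ binomial
        (ℓ ℕ.* t) (ℓ ℕ.* v)
    binomial-prime ℓ d′ prime-ℓ d≡ t v = P.trans
      (RP.Π-cong ℓ (λ j → P.+-congˡ {monomial 1# t} (P.-‿cong (C.cong (trans (*-congʳ (split j)) (*-assoc _ _ _))))))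
      (binomial-power (pow η d′) ℓ t v (power-order ℓ d′ (prime>0 prime-ℓ) d≡))
      where
      split : ∀ j → pow η (v ℕ.+ j ℕ.* d′) ≈ pow (pow η d′) j * pow η v
      split j = trans (pow-≡ η (≡.trans (ℕₚ.+-comm v (j ℕ.* d′)) (≡.cong (ℕ._+ v) (ℕₚ.*-comm j d′))))
        (trans (pow-+ η (d′ ℕ.* j) v) (*-congʳ (pow-* η d′ j)))

    binomial-factorisation : ∀ m → 0 < m → (∀ p → Prime p → p ∣ m → p ∣ d) →
      monomial 1# (d ℕ.* m) +ₚ (-ₚ const (pow b (d ℕ.* m))) ≋ prodₚ (concatMap (λ t → map (binomial t) (coprimeRange d t))
          (divisors m))
    binomial-factorisation m 0<m radical = begin
      monomial 1# (d ℕ.* m) +ₚ (-ₚ const (pow b (d ℕ.* m)))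
        ≈⟨ P.+-congˡ {monomial 1# (d ℕ.* m)} (P.-‿cong (C.cong (trans (*-congʳ
             (trans (pow-* η d 1) (trans (pow-1 _) (proj₁ (proj₂ η-order))))) (*-identityˡ _)))) ⟨
      -- As η^d = 1 the constant b^(dm) may carry the factor η^(d · 1). Its d-th roots then involve
      -- η^1, ..., η^d, which matches u running from 1 to d.
      binomial (d ℕ.* m) (d ℕ.* 1)
        ≈⟨ binomial-power η d m 1 η-order ⟨
      RP.Π d (λ j → monomial 1# m +ₚ (-ₚ const (pow η j * (pow η 1 * pow b m))))
        ≈⟨ RP.Π-cong d (λ j → P.+-congˡ {monomial 1# m} (P.-‿cong (C.cong (trans (sym (*-assoc _ _ _))
             (*-congʳ (trans (*-congˡ (pow-1 η)) (*-comm _ _))))))) ⟩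
      RP.Π d (λ j → binomial m (suc j))
        ≈⟨ RP.divisor-factorisation d 0<d binomial binomial-prime m 0<m radical ⟩
      prodₚ (concatMap (λ t → map (binomial t) (coprimeRange d t)) (divisors m)) ∎

    binomial-monic : ∀ t u → 0 < t → MonicOfDegree (binomial t u) t
    binomial-monic t u 0<t = monic-minus-lower {monomial 1# t} {const (pow η u * pow b t)} (monic-monomial t)
      (deg<-mono {const (pow η u * pow b t)} 0<t (deg<-length (const (pow η u * pow b t))))

-- Factorisation of f(x^n)

module _ (R : CRing) where
  open CommutativeRing R hiding (zero)
  open Poly R using (pow)
  open Powers R

  pow-one-more : ∀ {x e N} → pow x e ≈ 1# → 0 < N → e ∣ N ℕ.∸ 1 → pow x N ≈ x
  pow-one-more {x} {e} {suc N} eq _ (divides c N≡) =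
    trans (*-congˡ (trans (pow-≡ x (≡.trans N≡ (ℕₚ.*-comm c e))) (pow-trivial x e c eq))) (*-identityʳ x)

module Factorisation
  (q n : ℕ) (0<n : 0 < n) (radical-n : ∀ p → Prime p → p ∣ n → p ∣ q ℕ.∸ 1) (mod-4 : 8 ∣ n → q ℕ.% 4 ≡ 1)
  (K : Field) (card : HasCardinality K q)
  (f : PolyF.Pol K) (k e : ℕ)
  (monic-f : PolyF.MonicOfDegree K f k) (irreducible-f : PolyF.Irreducible K f) (order-f : PolyF.HasOrder K f e)
  (ek⊥n : gcd (e ℕ.* k) n ≡ 1) (r : ℕ) (0<r : 0 < r) (e∣nr-1 : e ∣ n ℕ.* r ℕ.∸ 1)
  (L : Field) (ι : Field.Carrier K → Field.Carrier L) (ι-hom : IsFieldHom K L ι)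
  (α : Field.Carrier L) (α-root : Field._≈_ L (PolyF.eval L (map ι f) α) (Field.0# L))
  (d : ℕ) (d≡ : d ≡ gcd n (q ℕ.∸ 1)) (θ : Field.Carrier K) (θ≉0 : ¬ Field._≈_ K θ (Field.0# K))
  (θᵈ≈1 : Field._≈_ K (PolyF.pow K θ d) (Field.1# K))
  (θ-minimal : ∀ j → 0 < j → j < d → ¬ Field._≈_ K (PolyF.pow K θ j) (Field.1# K))
  (m : ℕ) (n≡ : n ≡ m ℕ.* d) where
  private
    module K = Field K
    module PK = Poly K.commutativeRing
    module KX = PolyRing K.commutativeRing
    module PKX = CommutativeRing KX.polyRing
    module FP = FieldProperties K
    module FK = FiniteField K q card
    module KP = FieldPoly K FK._≟_
    module Mod = KP.Modulus f k monic-f irreducible-f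
    E : Field
    E = Mod.quotientField
    module E = Field E
    module PE = Poly E.commutativeRing
    module EX = PolyRing E.commutativeRing
    module FE = FrobeniusField K q card E Mod._∼?_ PK.const Mod.constant-isHom
    module RE = EvalHom K.commutativeRing E.commutativeRing PK.const Mod.constant-isHom
    module RootE = FE.Root f k monic-f irreducible-f PK.X Mod.X̄-root
    module PwE = Powers E.commutativeRing
    ξ : E.Carrier
    ξ = PK.X

  0<k : 0 < k
  0<k = Mod.0<D

  0<m×0<d : 0 < m × 0 < d
  0<m×0<d = factors m d n≡
    where
    factors : ∀ m d → n ≡ m ℕ.* d → 0 < m × 0 < d
    factors zero    d       eq = ⊥-elim (ℕₚ.<-irrefl (≡.sym eq) 0<n)
    factors (suc m) zero    eq = ⊥-elim (ℕₚ.<-irrefl (≡.sym (≡.trans eq (ℕₚ.*-zeroʳ m))) 0<n)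
    factors (suc m) (suc d) eq = s≤s z≤n , s≤s z≤n

  0<m : 0 < m
  0<m = proj₁ 0<m×0<d

  0<d : 0 < d
  0<d = proj₂ 0<m×0<d

  0<nr : 0 < n ℕ.* r
  0<nr = 0<* 0<n 0<r

  d∣q-1 : d ∣ q ℕ.∸ 1
  d∣q-1 = ≡.subst (_∣ q ℕ.∸ 1) (≡.sym d≡) (gcd[m,n]∣n n (q ℕ.∸ 1))

  m∣n : m ∣ n
  m∣n = ≡.subst (m ∣_) (≡.sym n≡) (m∣m*n d)

  radical-d : ∀ p → Prime p → p ∣ n → p ∣ d
  radical-d p pr p∣n = ≡.subst (p ∣_) (≡.sym d≡) (gcd-greatest p∣n (radical-n p pr p∣n))

  f∣xᵉ-1 : ∃ λ h → PK.xpow-1 e KX.≋ f PK.*ₚ h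
  f∣xᵉ-1 = let (h , eq) = proj₁ (proj₂ order-f) in h , KX.coeffs eq

  ξᵉ≈1 : PE.pow ξ e E.≈ E.1#
  ξᵉ≈1 = RE.root⇒pow≈1 e (RE.evalAt-multiple {ξ} {f} Mod.X̄-root f∣xᵉ-1)

  ξⁿʳ≈ξ : PE.pow ξ (n ℕ.* r) E.≈ ξ
  ξⁿʳ≈ξ = pow-one-more E.commutativeRing ξᵉ≈1 0<nr e∣nr-1

  private
    module L = Field L
    module PL = Poly L.commutativeRing
    module LX = PolyRing L.commutativeRing
    module PLX = CommutativeRing LX.polyRing
    module DL = Degree L.commutativeRing
    module FL = FieldProperties L
    module PwL = Powers L.commutativeRing
    module PwLX = Powers LX.polyRing
    module LPX = ListProduct LX.polyRing
    module BL = Binomials L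
    module CL = Compose L.commutativeRing
    module RL = EvalHom K.commutativeRing L.commutativeRing ι ι-hom
    module OL = Orders L.commutativeRing
    module ι = Hom K.commutativeRing L.commutativeRing ι ι-hom
    module Mι = MapPoly K.commutativeRing L.commutativeRing ι ι-hom
    module Lift = Mod.Lift L ι ι-hom α α-root
    module lift = Hom E.commutativeRing L.commutativeRing Lift.lift Lift.lift-isHom
    module Mlift = MapPoly E.commutativeRing L.commutativeRing Lift.lift Lift.lift-isHom
    module constL = Hom L.commutativeRing LX.polyRing PL.const LX.const-isHom

  ι-injective : ∀ {x y} → ι x L.≈ ι y → x K.≈ y
  ι-injective = field-hom-injective K L FK._≟_ ι ι-hom

  monic-reflect : ∀ {p j} → PL.MonicOfDegree (map ι p) j → PK.MonicOfDegree p j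
  monic-reflect {p} {j} (lead , deg) =
    ι-injective (L.trans (L.sym (Mι.coeff-map p j)) (L.trans lead (L.sym ι.1#-homo))) ,
    λ i j<i → ι-injective (L.trans (L.sym (Mι.coeff-map p i)) (L.trans (deg i j<i) (L.sym ι.0#-homo)))

  αᵉ≈1 : PL.pow α e L.≈ L.1#
  αᵉ≈1 = RL.root⇒pow≈1 e (RL.evalAt-multiple {α} {f} α-root f∣xᵉ-1)

  αⁿʳ≈α : PL.pow α (n ℕ.* r) L.≈ α
  αⁿʳ≈α = pow-one-more L.commutativeRing αᵉ≈1 0<nr e∣nr-1

  η : L.Carrier
  η = ι θ L.⁻¹

  η*θ≈1 : η L.* ι θ L.≈ L.1#
  η*θ≈1 = L.inverseˡ (ι θ) (field-hom-nonzero K L FK._≟_ ι ι-hom θ≉0)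

  η-order : OL.HasMultiplicativeOrder η d
  η-order = 0<d , inverse-power d (L.trans (L.sym (ι.pow-homo θ d)) (L.trans (ι.cong θᵈ≈1) ι.1#-homo)) ,
    λ j 0<j j<d eq → θ-minimal j 0<j j<d (ι-injective (L.trans (ι.pow-homo θ j) (L.trans (power-inverse j eq) (L.sym ι.1#-homo))))
    where
    both : ∀ j → PL.pow η j L.* PL.pow (ι θ) j L.≈ L.1#
    both j = L.trans (L.sym (PwL.pow-distrib η (ι θ) j)) (L.trans (PwL.pow-cong j η*θ≈1) (PwL.pow-1# j))
    inverse-power : ∀ j → PL.pow (ι θ) j L.≈ L.1# → PL.pow η j L.≈ L.1#
    inverse-power j eq = L.trans (L.sym (L.*-identityʳ _)) (L.trans (L.*-congˡ (L.sym eq)) (both j))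
    power-inverse : ∀ j → PL.pow η j L.≈ L.1# → PL.pow (ι θ) j L.≈ L.1#
    power-inverse j eq = L.trans (L.sym (L.*-identityˡ _)) (L.trans (L.*-congʳ (L.sym eq)) (both j))

  -- An n-th root of the conjugate α^(q^i), because α^(n r) = α.
  root-of : ℕ → L.Carrier
  root-of i = PL.pow α (r ℕ.* q ℕ.^ i)

  root-of≉0 : ∀ i → ¬ root-of i L.≈ L.0#
  root-of≉0 i = FL.nonzero-pow (r ℕ.* q ℕ.^ i) (FL.pow≈1⇒nonzero (proj₁ order-f) αᵉ≈1)

  binomialOf : ℕ → ℕ → ℕ → PL.Pol
  binomialOf i = BL.binomial η d η-order (root-of i) (root-of≉0 i)

  -- The passage to `L`: conjugates are powers, so the homomorphism from E turns a product over
  -- conjugates of `y` into one over the conjugates of its image.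
  lift-conjugates : ∀ y → map Lift.lift (FE.conjugateProduct y k) LX.≋
                          PL.prodₚ (map (λ i → PL.linear (PL.pow (Lift.lift y) (q ℕ.^ i))) (upTo k))
  lift-conjugates y = begin
    map Lift.lift (FE.conjugateProduct y k)
      ≈⟨ ∏-homo EX.polyRing LX.polyRing (map Lift.lift) Mlift.map-isHom PE.linear (FE.conjugates y k) ⟩
    PL.prodₚ (map (map Lift.lift ∘ PE.linear) (FE.conjugates y k))
      ≈⟨ PLX.reflexive (≡.cong PL.prodₚ (≡.trans (map-applyUpTo conjugate (map Lift.lift ∘ PE.linear) k)
           (≡.sym (map-applyUpTo id (map Lift.lift ∘ PE.linear ∘ conjugate) k)))) ⟩
    PL.prodₚ (map (map Lift.lift ∘ PE.linear ∘ conjugate) (upTo k))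
      ≈⟨ LPX.∏-cong (upTo k) (λ i → PLX.trans (Mlift.map-linear (conjugate i))
           (LX.∷-cong (L.-‿cong (lift.pow-homo y (q ℕ.^ i))) LX.≋-refl)) ⟩
    PL.prodₚ (map (λ i → PL.linear (PL.pow (Lift.lift y) (q ℕ.^ i))) (upTo k)) ∎
    where
    open ≈-Reasoning PLX.setoid
    conjugate : ℕ → E.Carrier
    conjugate i = PE.pow y (q ℕ.^ i)

  map-ι≋lift : ∀ p → map ι p LX.≋ map Lift.lift (map PK.const p)
  map-ι≋lift []      = LX.≋-refl
  map-ι≋lift (c ∷ p) = LX.∷-cong (L.sym (Lift.lift-const c)) (map-ι≋lift p)

  linear-cong : ∀ {x y} → x L.≈ y → PL.linear x LX.≋ PL.linear y
  linear-cong eq = LX.∷-cong (L.-‿cong eq) LX.≋-refl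

  f-factors : map ι f LX.≋ PL.prodₚ (map (λ i → PL.linear (PL.pow α (q ℕ.^ i))) (upTo k))
  f-factors = PLX.trans (map-ι≋lift f) (PLX.trans (Mlift.map-cong RootE.f-factors) (PLX.trans (lift-conjugates ξ)
    (LPX.∏-cong (upTo k) (λ i → linear-cong (PwL.pow-cong (q ℕ.^ i) Lift.lift-X)))))

  -- The scalar θ^(-uk) is spent as one θ^(-u) on each of the k linear factors of g_t, making θ^u
  -- x^t monic and multiplying the constant by θ^(-u).
  factor≋binomials : ∀ t u → factor L (ι θ) α q k r t u LX.≋ PL.prodₚ (map (λ i → binomialOf i t u) (upTo k))
  factor≋binomials t u = begin
    PL.scale (PL.pow η (u ℕ.* k)) (PL.compose (gpoly L α q k r t) Y)
      ≈⟨ LX.const-* (PL.pow η (u ℕ.* k)) (PL.compose (gpoly L α q k r t) Y) ⟨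
    PL.const (PL.pow η (u ℕ.* k)) PL.*ₚ PL.compose (gpoly L α q k r t) Y
      ≈⟨ PLX.*-cong constant (BL.compose-linears a (upTo k) Y) ⟩
    PL.prodₚ (map (λ _ → c) (upTo k)) PL.*ₚ PL.prodₚ (map (λ i → Y PL.+ₚ (PL.-ₚ PL.const (a i))) (upTo k))
      ≈⟨ LPX.∏-distrib (λ _ → c) (λ i → Y PL.+ₚ (PL.-ₚ PL.const (a i))) (upTo k) ⟨
    PL.prodₚ (map (λ i → c PL.*ₚ (Y PL.+ₚ (PL.-ₚ PL.const (a i)))) (upTo k))
      ≈⟨ LPX.∏-cong (upTo k) each ⟩
    PL.prodₚ (map (λ i → binomialOf i t u) (upTo k)) ∎
    where
    open ≈-Reasoning PLX.setoid
    Y c : PL.Pol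
    Y = PL.monomial (PL.pow (ι θ) u) t
    c = PL.const (PL.pow η u)
    a : ℕ → L.Carrier
    a i = PL.pow α (t ℕ.* r ℕ.* q ℕ.^ i)
    constant : PL.const (PL.pow η (u ℕ.* k)) LX.≋ PL.prodₚ (map (λ _ → c) (upTo k))
    constant = PLX.trans (constL.cong (PwL.pow-* η u k)) (PLX.trans (constL.pow-homo (PL.pow η u) k)
      (PLX.trans (PwLX.pow-≡ c (≡.sym (length-applyUpTo id k))) (PLX.sym (∏-constant LX.polyRing c (upTo k)))))
    shuffle : ∀ t r x → t ℕ.* r ℕ.* x ≡ r ℕ.* x ℕ.* t
    shuffle = solve-∀
    each : ∀ i → c PL.*ₚ (Y PL.+ₚ (PL.-ₚ PL.const (a i))) LX.≋ binomialOf i t u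
    each i = PLX.trans (x[y-z]≈xy-xz c Y (PL.const (a i))) (PLX.+-cong
      (BL.scaled-monomial t (L.trans (L.sym (PwL.pow-distrib η (ι θ) u)) (L.trans (PwL.pow-cong u η*θ≈1) (PwL.pow-1# u))))
      (PLX.-‿cong (PLX.trans (PLX.sym (constL.*-homo (PL.pow η u) (a i)))
        (constL.cong (L.*-congˡ (L.trans (PwL.pow-≡ α (shuffle t r (q ℕ.^ i))) (PwL.pow-* α (r ℕ.* q ℕ.^ i) t)))))))
      where open import Algebra.Properties.Ring PLX.ring using (x[y-z]≈xy-xz)

  factor-monic : ∀ t u → 0 < t → PL.MonicOfDegree (factor L (ι θ) α q k r t u) (k ℕ.* t)
  factor-monic t u 0<t = DL.monic-cong (PLX.sym (factor≋binomials t u))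
    (≡.subst (λ l → PL.MonicOfDegree (PL.prodₚ (map (λ i → binomialOf i t u) (upTo k))) (l ℕ.* t)) (length-applyUpTo id k)
      (DL.monic-prod (λ i → binomialOf i t u) t (λ i → BL.binomial-monic η d η-order (root-of i) (root-of≉0 i) t u 0<t) (upTo k)))

  composition-factors : map ι (PK.compose f (PK.monomial K.1# n)) LX.≋ factorProduct L (ι θ) α q k r d m
  composition-factors = begin
    map ι (PK.compose f (PK.monomial K.1# n))
      ≈⟨ Mι.map-compose f (PK.monomial K.1# n) ⟩
    PL.compose (map ι f) (map ι (PK.monomial K.1# n))
      ≈⟨ CL.compose-congʳ (map ι f) (PLX.trans (Mι.map-monomial K.1# n) (BL.monomial-cong n ι.1#-homo)) ⟩
    PL.compose (map ι f) (PL.monomial L.1# n)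
      ≈⟨ compX.cong f-factors ⟩
    PL.compose (PL.prodₚ (map (λ i → PL.linear (PL.pow α (q ℕ.^ i))) (upTo k))) (PL.monomial L.1# n)
      ≈⟨ BL.compose-linears (λ i → PL.pow α (q ℕ.^ i)) (upTo k) (PL.monomial L.1# n) ⟩
    PL.prodₚ (map (λ i → PL.monomial L.1# n PL.+ₚ (PL.-ₚ PL.const (PL.pow α (q ℕ.^ i)))) (upTo k))
      ≈⟨ LPX.∏-cong (upTo k) (λ i → PLX.trans
           (PLX.+-cong (PLX.reflexive (≡.cong (PL.monomial L.1#) n≡dm)) (PLX.-‿cong (constL.cong (n-th-power i))))
           (BL.binomial-factorisation η d η-order (root-of i) (root-of≉0 i) m 0<m (λ p pr p∣m → radical-d p pr (∣-trans p∣m m∣n)))) ⟩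
    PL.prodₚ (map (λ i → PL.prodₚ (concatMap (λ t → map (binomialOf i t) (coprimeRange d t)) (divisors m))) (upTo k))
      ≈⟨ ∏-concatMap-swap LX.polyRing (coprimeRange d) (factor L (ι θ) α q k r) binomialOf (upTo k) factor≋binomials
           (divisors m) ⟨
    factorProduct L (ι θ) α q k r d m ∎
    where
    open ≈-Reasoning PLX.setoid
    module compX = Hom LX.polyRing LX.polyRing (λ p → PL.compose p (PL.monomial L.1# n)) (CL.compose-isHom (PL.monomial L.1# n))
    n≡dm : n ≡ d ℕ.* m
    n≡dm = ≡.trans n≡ (ℕₚ.*-comm m d)
    shuffle : ∀ n r x → n ℕ.* r ℕ.* x ≡ r ℕ.* x ℕ.* n
    shuffle = solve-∀
    n-th-power : ∀ i → PL.pow α (q ℕ.^ i) L.≈ PL.pow (root-of i) (d ℕ.* m)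
    n-th-power i = L.trans (PwL.pow-cong (q ℕ.^ i) (L.sym αⁿʳ≈α)) (L.trans (L.sym (PwL.pow-* α (n ℕ.* r) (q ℕ.^ i)))
      (L.trans (PwL.pow-≡ α (≡.trans (shuffle n r (q ℕ.^ i)) (≡.cong (r ℕ.* q ℕ.^ i ℕ.*_) n≡dm)))
          (PwL.pow-* α (r ℕ.* q ℕ.^ i) (d ℕ.* m))))

  -- Irreducibility of the individual factors

  module Factor (t : ℕ) (t∣m : t ∣ m) where
    0<t : 0 < t
    0<t = ℕₚ.n≢0⇒n>0 λ { ≡.refl → ℕₚ.<-irrefl (≡.sym (0∣⇒≡0 t∣m)) 0<m }

    t∣n : t ∣ n
    t∣n = ∣-trans t∣m m∣n

    s : ℕ
    s = _∣_.quotient t∣n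

    n≡st : n ≡ s ℕ.* t
    n≡st = _∣_.equality t∣n

    y : E.Carrier
    y = PE.pow ξ (t ℕ.* r)

    yˢ≈ξ : PE.pow y s E.≈ ξ
    yˢ≈ξ = E.trans (E.sym (PwE.pow-* ξ (t ℕ.* r) s)) (E.trans (PwE.pow-≡ ξ
        (≡.trans (shuffle t r s) (≡.cong (ℕ._* r) (≡.sym n≡st)))) ξⁿʳ≈ξ)
      where
      shuffle : ∀ t r s → t ℕ.* r ℕ.* s ≡ s ℕ.* t ℕ.* r
      shuffle = solve-∀

    y-periodic : PE.pow y (q ℕ.^ k) E.≈ y
    y-periodic = E.trans (PwE.pow-comm ξ (t ℕ.* r) (q ℕ.^ k)) (PwE.pow-cong (t ℕ.* r) RootE.period)

    -- Since ξ is the power y^s, coinciding conjugates of `y` would make conjugates of ξ coincide.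
    y-distinct : ∀ {i j} → i < j → j < k → ¬ PE.pow y (q ℕ.^ j) E.≈ PE.pow y (q ℕ.^ i)
    y-distinct {i} {j} i<j j<k eq = RootE.conjugates-distinct i<j j<k
      (E.trans (E.sym (conjugate j)) (E.trans (PwE.pow-cong s eq) (conjugate i)))
      where
      conjugate : ∀ i → PE.pow (PE.pow y (q ℕ.^ i)) s E.≈ PE.pow ξ (q ℕ.^ i)
      conjugate i = E.trans (PwE.pow-comm y (q ℕ.^ i) s) (PwE.pow-cong (q ℕ.^ i) yˢ≈ξ)

    abstract
      G : PK.Pol
      G = FE.minimal y k 0<k y-periodic

      map-G : map PK.const G EX.≋ FE.conjugateProduct y k
      map-G = FE.map-minimal y k 0<k y-periodic

      G-divides : ∀ p → RE.evalAt y p E.≈ E.0# → ∃ λ h → p KX.≋ G PK.*ₚ h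
      G-divides = FE.minimal-divides y k 0<k y-periodic y-distinct

    map-ι-G : map ι G LX.≋ gpoly L α q k r t
    map-ι-G = PLX.trans (map-ι≋lift G) (PLX.trans (Mlift.map-cong map-G) (PLX.trans (lift-conjugates y)
      (LPX.∏-cong (upTo k) (λ i → linear-cong (L.trans (PwL.pow-cong (q ℕ.^ i)
        (L.trans (lift.pow-homo ξ (t ℕ.* r)) (PwL.pow-cong (t ℕ.* r) Lift.lift-X))) (L.sym (PwL.pow-* α (t ℕ.* r) (q ℕ.^ i))))))))

    -- This and `G∣f[xˢ]` record, as divisibilities over `K`, that y^e = 1 and that y^s is a root of
    -- `f`. In this form they apply to a root of `G` in a residue field not related to E.
    G∣xᵉ-1 : ∃ λ h → PK.xpow-1 e KX.≋ G PK.*ₚ h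
    G∣xᵉ-1 = G-divides (PK.xpow-1 e) (RE.pow≈1⇒root e (E.trans (PwE.pow-comm ξ (t ℕ.* r) e)
        (E.trans (PwE.pow-cong (t ℕ.* r) ξᵉ≈1) (PwE.pow-1# (t ℕ.* r)))))

    G∣f[xˢ] : ∃ λ h → PK.compose f (PK.monomial K.1# s) KX.≋ G PK.*ₚ h
    G∣f[xˢ] = G-divides (PK.compose f (PK.monomial K.1# s)) (E.trans (RE.evalAt-compose y f (PK.monomial K.1# s))
      (E.trans (Eval.eval-congʳ E.commutativeRing (map PK.const f) (E.trans (RE.evalAt-1-monomial y s) yˢ≈ξ)) Mod.X̄-root))

    module _ (u : ℕ) (u⊥t : gcd u t ≡ 1) where
      scalar : K.Carrier
      scalar = PK.pow (θ K.⁻¹) (u ℕ.* k)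

      h : PK.Pol
      h = PK.scale scalar (PK.compose G (PK.monomial (PK.pow θ u) t))

      scalar≉0 : ¬ scalar K.≈ K.0#
      scalar≉0 = FP.nonzero-pow (u ℕ.* k) (FP.unit⇒nonzero {y = θ} (K.trans (K.*-comm θ (θ K.⁻¹)) (K.inverseˡ θ θ≉0)))

      map-ι-h : map ι h LX.≋ factor L (ι θ) α q k r t u
      map-ι-h = PLX.trans (Mι.map-scale scalar (PK.compose G (PK.monomial (PK.pow θ u) t))) (LX.scale-cong
        (L.trans (ι.pow-homo (θ K.⁻¹) (u ℕ.* k)) (PwL.pow-cong (u ℕ.* k)
          (FL.inverse-unique (L.trans (L.sym (ι.*-homo (θ K.⁻¹) θ)) (L.trans (ι.cong (K.inverseˡ θ θ≉0)) ι.1#-homo)))))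
        (PLX.trans (Mι.map-compose G (PK.monomial (PK.pow θ u) t)) (PLX.trans
          (CL.compose-congʳ (map ι G) (PLX.trans (Mι.map-monomial (PK.pow θ u) t) (BL.monomial-cong t (ι.pow-homo θ u))))
          (Hom.cong LX.polyRing LX.polyRing (λ p → PL.compose p Y) (CL.compose-isHom Y) map-ι-G))))
        where
        Y : PL.Pol
        Y = PL.monomial (PL.pow (ι θ) u) t

      h-monic : PK.MonicOfDegree h (k ℕ.* t)
      h-monic = monic-reflect {h} (DL.monic-cong (PLX.sym map-ι-h) (factor-monic t u 0<t))

      t∣geometric⇒t∣ : ∀ j → t ∣ geometric q j → t ∣ j
      t∣geometric⇒t∣ j t∣g = ∣geometric⇒∣ t (q ℕ.∸ 1) j 0<t (λ p pr p∣t → radical-n p pr (∣-trans p∣t t∣n)) four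
        (≡.subst (λ q → t ∣ geometric q j) (≡.sym suc-q-1) t∣g)
        where
        suc-q-1 : suc (q ℕ.∸ 1) ≡ q
        suc-q-1 = ℕₚ.m+[n∸m]≡n FK.0<q
        -- From 4 ∣ t follow 4 ∣ m and 2 ∣ n, hence 2 ∣ d and 8 ∣ m d = n; then q is 1 modulo 4.
        four : 4 ∣ t → 4 ∣ q ℕ.∸ 1
        four 4∣t = ≡.subst (4 ∣_) (≡.sym (≡.trans (≡.cong (ℕ._∸ 1) (m≡m%n+[m/n]*n q 4))
            (≡.cong (λ x → x ℕ.+ q ℕ./ 4 ℕ.* 4 ℕ.∸ 1) (mod-4 8∣n)))) (n∣m*n (q ℕ./ 4))
          where
          4∣m : 4 ∣ m
          4∣m = ∣-trans 4∣t t∣m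
          2∣d : 2 ∣ d
          2∣d = radical-d 2 prime[2] (∣-trans (divides 2 ≡.refl) (∣-trans 4∣m m∣n))
          8∣n : 8 ∣ n
          8∣n = ≡.subst (8 ∣_) (≡.sym n≡) (∣-trans (*-monoˡ-∣ 2 4∣m) (*-monoʳ-∣ m 2∣d))

      -- Dividing n and q - 1 by their greatest common divisor d leaves coprime m and `c`, and t
      -- divides m.
      cofactor-coprime : ∀ c → q ℕ.∸ 1 ≡ c ℕ.* d → Coprime c t
      cofactor-coprime c q-1≡ {i} (i∣c , i∣t) = gcd≡1⇒coprime gcd[m,c]≡1 (∣-trans i∣t t∣m , i∣c)
        where
        gcd[m,c]≡1 : gcd m c ≡ 1
        gcd[m,c]≡1 = ℕₚ.*-cancelˡ-≡ (gcd m c) 1 d {{ℕ.>-nonZero 0<d}} (≡.trans (c*gcd[m,n]≡gcd[cm,cn] d m c)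
          (≡.trans (≡.cong₂ gcd (≡.trans (ℕₚ.*-comm d m) (≡.sym n≡)) (≡.trans (ℕₚ.*-comm d c) (≡.sym q-1≡)))
            (≡.trans (≡.sym d≡) (≡.sym (ℕₚ.*-identityʳ d)))))

      avoids-ue : ∀ p → Prime p → p ∣ t → ¬ p ∣ u ℕ.* e
      avoids-ue p pr p∣t p∣ue with euclidsLemma u e pr p∣ue
      ... | inj₁ p∣u = gcd≡1⇒avoids {u} u⊥t p pr p∣t p∣u
      ... | inj₂ p∣e = gcd≡1⇒avoids {e ℕ.* k} ek⊥n p pr (∣-trans p∣t t∣n) (∣m⇒∣m*n k p∣e)

      coprime-k-t : Coprime k t
      coprime-k-t (i∣k , i∣t) = gcd≡1⇒coprime ek⊥n (∣n⇒∣m*n e i∣k , ∣-trans i∣t t∣n)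

      k*t≤ : ∀ {j} → 0 < j → k ∣ j → t ∣ j → k ℕ.* t ≤ j
      k*t≤ 0<j k∣j (divides x ≡.refl) = ∣⇒≤ {{ℕ.>-nonZero 0<j}}
        (*-monoˡ-∣ t (coprime-divisor coprime-k-t (≡.subst (k ∣_) (ℕₚ.*-comm x t) k∣j)))

      module SmallFactor (a : PK.Pol) (D : ℕ) (monic-a : PK.MonicOfDegree a D) (irreducible-a : PK.Irreducible a)
                         (b : PK.Pol) (h≋ab : h KX.≋ a PK.*ₚ b) where
        private
          module ModA = KP.Modulus a D monic-a irreducible-a
          F : Field
          F = ModA.quotientField
          module F = Field F
          module PF = Poly F.commutativeRing
          module FF = FrobeniusField K q card F ModA._∼?_ PK.const ModA.constant-isHom
          module RF = EvalHom K.commutativeRing F.commutativeRing PK.const ModA.constant-isHom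
          module FFP = FieldProperties F
          module PwF = Powers F.commutativeRing
          module OF = Orders F.commutativeRing
          module c = Hom K.commutativeRing F.commutativeRing PK.const ModA.constant-isHom
          γ θF w : F.Carrier
          γ = PK.X
          θF = PK.const θ
          w = PF.pow θF u F.* PF.pow γ t

          θF-order : OF.HasMultiplicativeOrder θF d
          θF-order = 0<d , F.trans (F.sym (c.pow-homo θ d)) (F.trans (c.cong θᵈ≈1) c.1#-homo) ,
            λ j 0<j j<d eq → θ-minimal j 0<j j<d (FF.ι-injective (F.trans (c.pow-homo θ j) (F.trans eq (F.sym c.1#-homo))))

          G[w]≈0 : RF.evalAt w G F.≈ F.0#
          G[w]≈0 = FFP.nonzero-regular (field-hom-nonzero K F FK._≟_ PK.const ModA.constant-isHom scalar≉0) _ (begin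
            PK.const scalar F.* RF.evalAt w G
              ≈⟨ F.*-congˡ {PK.const scalar} (Eval.eval-congʳ F.commutativeRing (map PK.const G) value) ⟨
            PK.const scalar F.* RF.evalAt (RF.evalAt γ (PK.monomial (PK.pow θ u) t)) G
              ≈⟨ F.*-congˡ {PK.const scalar} (RF.evalAt-compose γ G (PK.monomial (PK.pow θ u) t)) ⟨
            PK.const scalar F.* RF.evalAt γ (PK.compose G (PK.monomial (PK.pow θ u) t))
              ≈⟨ Eval.eval-scale F.commutativeRing γ (PK.const scalar)
                   (map PK.const (PK.compose G (PK.monomial (PK.pow θ u) t))) ⟨
            PF.eval (PF.scale (PK.const scalar) (map PK.const (PK.compose G (PK.monomial (PK.pow θ u) t)))) γ
              ≈⟨ Eval.eval-cong F.commutativeRing γ (MapPoly.map-scale K.commutativeRing F.commutativeRing PK.const ModA.constant-isHom scalar (PK.compose G (PK.monomial (PK.pow θ u) t))) ⟨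
            RF.evalAt γ h
              ≈⟨ RF.evalAt-multiple {γ} {a} ModA.X̄-root (b , h≋ab) ⟩
            F.0# ∎)
            where
            open ≈-Reasoning F.setoid
            value : RF.evalAt γ (PK.monomial (PK.pow θ u) t) F.≈ w
            value = F.trans (RF.evalAt-monomial γ (PK.pow θ u) t) (F.*-congʳ {PF.pow γ t} (c.pow-homo θ u))

          wᵉ≈1 : PF.pow w e F.≈ F.1#
          wᵉ≈1 = RF.root⇒pow≈1 e (RF.evalAt-multiple {w} {G} G[w]≈0 G∣xᵉ-1)

          wˢ-root : RF.evalAt (PF.pow w s) f F.≈ F.0#
          wˢ-root = F.trans (Eval.eval-congʳ F.commutativeRing (map PK.const f) (F.sym (RF.evalAt-1-monomial w s)))
            (F.trans (F.sym (RF.evalAt-compose w f (PK.monomial K.1# s))) (RF.evalAt-multiple {w} {G} G[w]≈0 G∣f[xˢ]))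

          module RootF = FF.Root f k monic-f irreducible-f (PF.pow w s) wˢ-root

          -- If γ were zero, so would be w, against w^e = 1. This permits cancelling γ in γ^(q^j) =
          -- γ.
          γ≉0 : ¬ γ F.≈ F.0#
          γ≉0 γ≈0 = FFP.pow≈1⇒nonzero (proj₁ order-f) wᵉ≈1 (F.trans (F.*-congˡ {PF.pow θF u} (zero-power t 0<t))
              (F.zeroʳ (PF.pow θF u)))
            where
            zero-power : ∀ t → 0 < t → PF.pow γ t F.≈ F.0#
            zero-power (suc t) _ = F.trans (F.*-congʳ {PF.pow γ t} γ≈0) (F.zeroˡ (PF.pow γ t))

          module _ (j : ℕ) (γ-periodic : PF.pow γ (q ℕ.^ j) F.≈ γ) where
            w-periodic : PF.pow w (q ℕ.^ j) F.≈ w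
            w-periodic = F.trans (PwF.pow-distrib (PF.pow θF u) (PF.pow γ t) (q ℕ.^ j)) (F.*-cong
              (F.trans (PwF.pow-comm θF u (q ℕ.^ j)) (PwF.pow-cong u (FF.ι-pow-q^ θ j)))
              (F.trans (PwF.pow-comm γ t (q ℕ.^ j)) (PwF.pow-cong t γ-periodic)))

            k∣j : k ∣ j
            k∣j = RootF.period-divides j (F.trans (PwF.pow-comm w s (q ℕ.^ j)) (PwF.pow-cong s w-periodic))

            γ-order : PF.pow γ ((q ℕ.∸ 1) ℕ.* geometric q j) F.≈ F.1#
            γ-order = FFP.*-cancelˡ γ≉0 (F.trans (PwF.pow-≡ γ exponent) (F.trans γ-periodic (F.sym (F.*-identityʳ γ))))
              where
              exponent : suc ((q ℕ.∸ 1) ℕ.* geometric q j) ≡ q ℕ.^ j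
              exponent = ≡.subst (λ q′ → suc ((q ℕ.∸ 1) ℕ.* geometric q′ j) ≡ q′ ℕ.^ j) (ℕₚ.m+[n∸m]≡n FK.0<q)
                  (geometric-power (q ℕ.∸ 1) j)

            z : F.Carrier
            z = PF.pow γ e

            zᵗθ≈1 : PF.pow z t F.* PF.pow θF (u ℕ.* e) F.≈ F.1#
            zᵗθ≈1 = F.trans (F.*-cong (PwF.pow-comm γ e t) (PwF.pow-* θF u e))
                (F.trans (F.*-comm (PF.pow (PF.pow γ t) e) (PF.pow (PF.pow θF u) e))
              (F.trans (F.sym (PwF.pow-distrib (PF.pow θF u) (PF.pow γ t) e)) wᵉ≈1))

            -- With q - 1 = c d the relation γ^(q^j - 1) = 1, raised to e, becomes z^(c d g) = 1 for
            -- g = 1 + q + ... + q^(j-1). `order-constraint` turns it into t ∣ g.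
            t∣j : t ∣ j
            t∣j with d∣q-1
            ... | divides c q-1≡ = t∣geometric⇒t∣ j (OF.order-constraint {θF} {z} {d} t (u ℕ.* e) c (geometric q j) θF-order 0<t
                    (λ p pr p∣t → radical-d p pr (∣-trans p∣t t∣n)) avoids-ue (cofactor-coprime c q-1≡) zᵗθ≈1
                    (F.trans (PwF.pow-comm γ e (c ℕ.* d ℕ.* geometric q j)) (F.trans (PwF.pow-cong e
                      (F.trans (PwF.pow-≡ γ (≡.cong (ℕ._* geometric q j) (≡.sym q-1≡))) γ-order)) (PwF.pow-1# e))))

        not-small : ¬ D < k ℕ.* t
        not-small D<kt =
          let (j , 0<j , j≤D , γ-periodic) = FF.small-period {a} monic-a ModA.X̄-root
          in ℕₚ.<⇒≱ D<kt (ℕₚ.≤-trans (k*t≤ 0<j (k∣j j γ-periodic) (t∣j j γ-periodic)) j≤D)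

      h-irreducible : PK.Irreducible h
      h-irreducible = (λ h≈0 → KP.monic-nonzero {h} h-monic (KX.coeffs h≈0)) ,
                      KP.monic-positive-nonunit {h} h-monic (0<* 0<k 0<t) , split
        where
        split : ∀ a b → h PK.≈ₚ a PK.*ₚ b → PK.IsUnit a ⊎ PK.IsUnit b
        split a b h≈ab with KP.unit? a | KP.unit? b
        ... | yes unit-a | _          = inj₁ unit-a
        ... | _          | yes unit-b = inj₂ unit-b
        -- Two non-units give a proper factor of degree below k t, hence up to double negation an
        -- irreducible one; the goal here is absurdity, so this is enough.
        ... | no ¬unit-a | no ¬unit-b = ⊥-elim (KP.irreducible-factor A.degree A.monic A.degree A.is-monic A.0<degree ℕₚ.≤-refl
                λ (a′ , D , monic-a′ , irreducible-a′ , D≤ , c , A≋) →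
                  SmallFactor.not-small a′ D monic-a′ irreducible-a′ (c PK.*ₚ (PK.const A.unit PK.*ₚ b)) (h≋ a′ c A≋)
                      (ℕₚ.≤-<-trans D≤ A.degree<k))
          where
          module A = KP.ProperFactor (KP.proper-factor {h} {k ℕ.* t} {a} {b} h-monic (KX.coeffs h≈ab) ¬unit-a ¬unit-b)
          open ≈-Reasoning PKX.setoid
          h≋ : ∀ a′ c → A.monic KX.≋ a′ PK.*ₚ c → h KX.≋ a′ PK.*ₚ (c PK.*ₚ (PK.const A.unit PK.*ₚ b))
          h≋ a′ c A≋ = begin
            h  ≈⟨ KX.coeffs h≈ab ⟩
            a PK.*ₚ b  ≈⟨ PKX.*-congʳ {b} (PKX.trans A.a≋ (PKX.sym (KX.const-* A.unit A.monic))) ⟩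
            (PK.const A.unit PK.*ₚ A.monic) PK.*ₚ b  ≈⟨ PKX.*-congʳ {b} (PKX.*-comm (PK.const A.unit) A.monic) ⟩
            (A.monic PK.*ₚ PK.const A.unit) PK.*ₚ b  ≈⟨ PKX.*-assoc A.monic (PK.const A.unit) b ⟩
            A.monic PK.*ₚ (PK.const A.unit PK.*ₚ b)  ≈⟨ PKX.*-congʳ {PK.const A.unit PK.*ₚ b} A≋ ⟩
            (a′ PK.*ₚ c) PK.*ₚ (PK.const A.unit PK.*ₚ b)  ≈⟨ PKX.*-assoc a′ c (PK.const A.unit PK.*ₚ b) ⟩
            a′ PK.*ₚ (c PK.*ₚ (PK.const A.unit PK.*ₚ b))  ∎

  factor-descends : ∀ t → t ∈ divisors m → ∀ u → u ∈ coprimeRange d t →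
    ∃ λ h → PK.Monic h × PK.Irreducible h × map ι h PL.≈ₚ factor L (ι θ) α q k r t u
  factor-descends t t∈ u u∈ = h u u⊥t , (k ℕ.* t , h-monic u u⊥t) , h-irreducible u u⊥t , LX.coeff-eq (map-ι-h u u⊥t)
    where
    open Factor t (proj₂ (∈-filter⁻ (_∣? m) {xs = map suc (upTo m)} t∈))
    u⊥t : gcd u t ≡ 1
    u⊥t = proj₂ (∈-filter⁻ (λ u → gcd u t ℕ.≟ 1) {xs = map suc (upTo d)} u∈)

open import Data.Nat using (_*_; _∸_; _%_)

theorem2p3 : (q n : ℕ) → IsPrimePower q → 0 < n →
    (∀ p → Prime p → p ∣ n → p ∣ q ∸ 1) →
    (8 ∣ n → q % 4 ≡ 1) →
    (K : Field) → HasCardinality K q →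
    (f : PolyF.Pol K) (k e : ℕ) →
    PolyF.MonicOfDegree K f k → PolyF.Irreducible K f → PolyF.HasOrder K f e →
    gcd (e * k) n ≡ 1 →
    (r : ℕ) → 0 < r → e ∣ n * r ∸ 1 →
    (L : Field) (ι : Field.Carrier K → Field.Carrier L) → IsFieldHom K L ι →
    (α : Field.Carrier L) → Field._≈_ L (PolyF.eval L (map ι f) α) (Field.0# L) →
    (d : ℕ) → d ≡ gcd n (q ∸ 1) →
    (θ : Field.Carrier K) → ¬ Field._≈_ K θ (Field.0# K) →
    Field._≈_ K (PolyF.pow K θ d) (Field.1# K) →
    (∀ j → 0 < j → j < d → ¬ Field._≈_ K (PolyF.pow K θ j) (Field.1# K)) →
    (m : ℕ) → n ≡ m * d →
    (∀ t → t ∈ divisors m → ∀ u → u ∈ coprimeRange d t →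
    ∃ λ h → PolyF.Monic K h × PolyF.Irreducible K h ×
    PolyF._≈ₚ_ L (map ι h) (factor L (ι θ) α q k r t u))
    ×
    PolyF._≈ₚ_ L (map ι (PolyF.compose K f (PolyF.monomial K (Field.1# K) n)))
    (factorProduct L (ι θ) α q k r d m)
theorem2p3 q n _ 0<n radical-n mod-4 K card f k e monic-f irreducible-f order-f ek⊥n r 0<r e∣nr-1 L ι ι-hom α α-root
  d d≡ θ θ≉0 θᵈ≈1 θ-minimal m n≡ = factor-descends , PolyRing.coeff-eq composition-factors
  where
  open Factorisation q n 0<n radical-n mod-4 K card f k e monic-f irreducible-f order-f ek⊥n r 0<r e∣nr-1 L ι ι-hom α α-root
    d d≡ θ θ≉0 θᵈ≈1 θ-minimal m n≡
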